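{- Let $\mu \in \Lambda^{\mathrm{bal}}$ and define $$k \coloneqq \max\left(\{0\} \cup \left\{ m \in \mathbb{Z}_{>0} \;\middle|\; p^m \le \tfrac{|\mu|}{2},\ \mu \in B\bigl(p^m\Lambda^{\mathrm{bal}}_{\mathrm{odd}},\, p^m\bigr)\right\}\right).$$ (1) Suppose $k=0$. (a) If $\mu \in \Lambda^{\mathrm{bal}}_{\mathrm{odd}}$, then $\Delta(\mu)=1$ and $\exp(\mathcal{A},\mu) = \left(\frac{|\mu|-1}{2},\ \frac{|\mu|+1}{2}\right)$. (b) If $\mu \in \Lambda^{\mathrm{bal}}_{\mathrm{even}}$, then $\Delta(\mu)=0$ and $\exp(\mathcal{A},\mu) = \left(\frac{|\mu|}{2},\ \frac{|\mu|}{2}\right)$. (2) Suppose $k>0$ and write $\mu = p^k\alpha + \beta$ with $\alpha \in \Lambda$ and $0 \le \beta_i < p^k$ for $i=1,2,3$. Indices $i, i+1, i+2$ are taken modulo $3$ in $\{1,2,3\}$. (c) If $\alpha \in \Lambda_{\mathrm{even}}$ and $\beta_i > \frac{|\beta|}{2}$ for some $i \in \{1,2,3\}$, then $\Delta(\mu) = \beta_i - \beta_{i+1} - \beta_{i+2}$ and $\exp(\mathcal{A},\mu) = \left(\frac{|\alpha|}{2}p^k + \beta_{i+1}+\beta_{i+2},\ \frac{|\alpha|}{2}p^k + \beta_i\right)$. (d) If $\alpha \in \Lambda_{\mathrm{even}}$ and $\frac{|\beta|}{2} > p^k$, then $\Delta(\mu) = |\beta| - 2p^k$ and $\exp(\mathcal{A},\mu)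 = \left(\frac{|\alpha|}{2}p^k + p^k,\ \frac{|\alpha|}{2}p^k + |\beta| - p^k\right)$. (e) If $\alpha \in \Lambda_{\mathrm{odd}}$ and $p^k - \beta_i > \frac{|p^k\mathbf{1} - \beta|}{2}$ for some $i\in\{1,2,3\}$, where $\mathbf{1}=(1,1,1)$, then $\Delta(\mu) = -\beta_i + \beta_{i+1} + \beta_{i+2} - p^k$ and $\exp(\mathcal{A},\mu) = \left(\frac{|\alpha|+1}{2}p^k + \beta_i,\ \frac{|\alpha|-1}{2}p^k + \beta_{i+1}+\beta_{i+2}\right)$. (f) If $\alpha \in \Lambda_{\mathrm{odd}}$ and $\frac{|p^k\mathbf{1}-\beta|}{2} > p^k$, then $\Delta(\mu) = p^k - |\beta|$ and $\exp(\mathcal{A},\mu) = \left(\frac{|\alpha|-1}{2}p^k + |\beta|,\ \frac{|\alpha|+1}{2}p^k\right)$.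
   Context: Let $p$ be a prime, $\mathbb{F}=\mathbb{F}_p$, $S=\mathbb{F}[x,y]$ and $\mathrm{Der}_S = S\partial_x \oplus S\partial_y$. Let $\mathcal{A}=\{H_1,H_2,H_3\}$ be the arrangement of lines in $\mathbb{F}^2$ with $H_1=\ker x$, $H_2 = \ker y$, $H_3 = \ker(x+y)$, and set $\alpha_1 = x$, $\alpha_2=y$, $\alpha_3 = x+y$. A multiplicity is an element $\mu=(\mu_1,\mu_2,\mu_3)$ of $\Lambda \coloneqq \mathbb{Z}_{\ge 0}^3$; write $|z| = |z_1|+|z_2|+|z_3|$ for $z \in \mathbb{Z}^3$. Let $D(\mathcal{A},\mu) = \{\theta \in \mathrm{Der}_S : \theta(\alpha_i) \in \alpha_i^{\mu_i}S \text{ for } i=1,2,3\}$. This $S$-module is free of rank $2$ with a basis $\{\theta,\theta'\}$ of homogeneous derivations (each of the form $f\partial_x+g\partial_y$ with $f,g$ homogeneous of a common degree, its degree); the pair of degrees $\exp(\mathcal{A},\mu)$ (the exponents) is uniquely determined up to order and its entries sum to $|\mu|$. Define $\Delta(\mu)\ge 0$ as the absolute difference of the two exponents. $\mu$ is balanced if $\mu_i \le |\mu|/2$ for all $i$; $\Lambda^{\mathrm{bal}}$ is the set of balanced multiplicities. $\Lambda_{\mathrm{odd}} = \{\mu\in\Lambda : |\mu| \text{ odd}\}$, $\Lambda_{\mathrm{even}} = \{\mu\in\Lambda : |\mu| \text{ even}\}$, $\Lambda^{\mathrm{bal}}_{\mathrm{odd}} = \Lambda^{\mathrm{bal}}\cap\Lambda_{\mathrm{odd}}$,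 $\Lambda^{\mathrm{bal}}_{\mathrm{even}} = \Lambda^{\mathrm{bal}}\cap\Lambda_{\mathrm{even}}$. For $\zeta \in \Lambda$ and $r\in\mathbb{Z}_{>0}$, $B(\zeta,r) = \{\mu \in \Lambda : |\mu - \zeta| < r\}$, and for $T\subseteq \Lambda$, $B(T,r) = \bigcup_{\zeta\in T} B(\zeta,r)$; also $cT = \{c\nu : \nu \in T\}$. -}

module Defs where

open import Data.Nat using (ℕ; zero; suc; _+_; _*_; _∸_; _^_; _≤_; _<_; _≟_; ∣_-_∣; _%_)
open import Data.Bool using (Bool; true; false; _∧_; if_then_else_)
open import Data.List using (List; []; _∷_; _++_; map; concatMap)
open import Data.Product using (_×_; _,_; ∃; ∃₂; proj₁; proj₂)
open import Data.Sum using (_⊎_)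
open import Data.Fin using (Fin; zero; suc)
open import Relation.Nullary using (¬_; does)
open import Relation.Binary.PropositionalEquality using (_≡_)

-- The field F_p: elements represented by natural numbers, equality is
-- congruence modulo p (no subtraction needed: a ≡ b mod p iff
-- a + k p = b + l p for some k l).

Cong : ℕ → ℕ → ℕ → Set
Cong p a b = ∃₂ λ k l → a + k * p ≡ b + l * p

-- S = F_p[x,y]: a polynomial is a finite list of terms (c , i , j)
-- standing for c x^i y^j; two lists are equal as polynomials iff all
-- coefficients agree mod p.

Term : Set
Term = ℕ × ℕ × ℕ

Poly : Set
Poly = List Term

coeff : Poly → ℕ → ℕ → ℕ
coeff [] a b = 0
coeff ((c , i , j) ∷ P) a b =
  (if does (i ≟ a) ∧ does (j ≟ b) then c else 0) + coeff P a b

PolyEq : ℕ → Poly → Poly → Set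
PolyEq p P Q = ∀ a b → Cong p (coeff P a b) (coeff Q a b)

_⊕_ : Poly → Poly → Poly
P ⊕ Q = P ++ Q

_⊗_ : Poly → Poly → Poly
P ⊗ Q = concatMap (λ { (c , i , j) → map (λ { (d , k , l) → (c * d , i + k , j + l) }) Q }) P

one : Poly
one = (1 , 0 , 0) ∷ []

polyX : Poly
polyX = (1 , 1 , 0) ∷ []

polyY : Poly
polyY = (1 , 0 , 1) ∷ []

pow : Poly → ℕ → Poly
pow P zero = one
pow P (suc n) = P ⊗ pow P n

-- homogeneous of degree d (the zero polynomial is homogeneous of every degree)
Homogeneous : ℕ → ℕ → Poly → Set
Homogeneous p d P = ∀ a b → ¬ (a + b ≡ d) → Cong p (coeff P a b) 0

-- Derivations  f ∂x + g ∂y  in Der_S, represented by the pair (f , g).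

Der : Set
Der = Poly × Poly

DerEq : ℕ → Der → Der → Set
DerEq p θ η = PolyEq p (proj₁ θ) (proj₁ η) × PolyEq p (proj₂ θ) (proj₂ η)

HomDer : ℕ → ℕ → Der → Set
HomDer p d θ = Homogeneous p d (proj₁ θ) × Homogeneous p d (proj₂ θ)

linForm : Fin 3 → Poly
linForm zero = polyX
linForm (suc zero) = polyY
linForm (suc (suc zero)) = polyX ⊕ polyY

-- θ(α) = f ∂α/∂x + g ∂α/∂y for the three linear forms
applyDer : Der → Fin 3 → Poly
applyDer (f , g) zero = f
applyDer (f , g) (suc zero) = g
applyDer (f , g) (suc (suc zero)) = f ⊕ g

Mult : Set
Mult = Fin 3 → ℕ

size : Mult → ℕ
size μ = μ zero + μ (suc zero) + μ (suc (suc zero))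

InD : ℕ → Mult → Der → Set
InD p μ θ = ∀ i → ∃ λ h → PolyEq p (applyDer θ i) (pow (linForm i) (μ i) ⊗ h)

comb : Poly → Der → Poly → Der → Der
comb s θ s' θ' = ((s ⊗ proj₁ θ) ⊕ (s' ⊗ proj₁ θ')) , ((s ⊗ proj₂ θ) ⊕ (s' ⊗ proj₂ θ'))

IsBasis : ℕ → Mult → Der → Der → Set
IsBasis p μ θ θ' =
  InD p μ θ × InD p μ θ' ×
  (∀ η → InD p μ η → ∃₂ λ s s' → DerEq p η (comb s θ s' θ')) ×
  (∀ s s' t t' → DerEq p (comb s θ s' θ') (comb t θ t' θ') →
     PolyEq p s t × PolyEq p s' t')

Exps : ℕ → Mult → ℕ → ℕ → Set
Exps p μ d₁ d₂ = ∃₂ λ θ θ' → HomDer p d₁ θ × HomDer p d₂ θ' × IsBasis p μ θ θ'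

IsΔ : ℕ → Mult → ℕ → Set
IsΔ p μ n = ∃₂ λ d₁ d₂ → Exps p μ d₁ d₂ × ∣ d₁ - d₂ ∣ ≡ n

Balanced : Mult → Set
Balanced μ = ∀ i → 2 * μ i ≤ size μ

IsOdd : Mult → Set
IsOdd μ = size μ % 2 ≡ 1

IsEven : Mult → Set
IsEven μ = size μ % 2 ≡ 0

dist : Mult → Mult → ℕ
dist μ ν = ∣ μ zero - ν zero ∣ + ∣ μ (suc zero) - ν (suc zero) ∣
         + ∣ μ (suc (suc zero)) - ν (suc (suc zero)) ∣

scale : ℕ → Mult → Mult
scale c ν i = c * ν i

GoodLevel : ℕ → Mult → ℕ → Set
GoodLevel p μ m =
  2 * p ^ m ≤ size μ ×
  ∃ λ ν → Balanced ν × IsOdd ν × dist μ (scale (p ^ m) ν) < p ^ m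

IsK : ℕ → Mult → ℕ → Set
IsK p μ k =
  (k ≡ 0 ⊎ (0 < k × GoodLevel p μ k)) ×
  (∀ m → 0 < m → GoodLevel p μ m → m ≤ k)

next : Fin 3 → Fin 3
next zero = suc zero
next (suc zero) = suc (suc zero)
next (suc (suc zero)) = zero

-- p^k 𝟏 - β (componentwise; all entries are positive when β_i < p^k)
compl : ℕ → Mult → Mult
compl q β i = q ∸ β i

{-# OPTIONS --safe #-}
-- For a homogeneous basis of D(μ) of degrees d ≤ d + g, the gap g is Δ(μ).  Saito's criterion (a pair
-- with determinant x^a y^b (x+y)^c is a basis) lets one pass from a basis of D(μ) to one of D(μ ± e_i):
-- g changes by 1 and the low element θ is kept, multiplied or divided by α_i.  Raising g as long as
-- possible leads from μ to a peak.  At a peak with g ≥ 2 the Wronskian F ∂G − G ∂F of the components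
-- of θ vanishes for degree reasons, and since F and G are coprime, ∂F = ∂G = 0 for both ∂x and ∂y.
-- So the peak and θ are Frobenius pullbacks of an element of some D(ν) with gap g/p, and induction on the
-- degree shows that g ≤ p^m − |μ − p^m ν| for some m ≥ 1 and some odd balanced ν.  For k = 0 this
-- forces g ≤ 1.  For k > 0 it shows that the peak above p^k ν is p^k ν itself, with gap p^k;
-- descending from there to μ, g drops by 1 at each step, which gives the exponents.
module Submission where

-- Gap 2 is the threshold because a derivation that kills one of the three forms costs one factor of
-- each of the other two only: multiplied by these two, the Wronskian has degree 2d + 1 and is a
-- multiple of x^a y^b (x+y)^c, of degree 2d + g. The climb needs protection: if θ(α_i) = 0, raising
-- μ_i increases g for ever. Balancedness with g ≥ 1 excludes this by degree; nonvanishing then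
-- survives the climb and bounds every μ_i by d. Coprimality of F and G comes without unique
-- factorization: det(θ, θ′) = x^a y^b (x+y)^c acts as a Bézout identity, and at a peak no α_i with
-- μ_i > 0 divides θ. Undoing Frobenius yields a nonzero element of D(ν), not a basis; its degree
-- bounds the low degree of D(ν) from above, so a basis of D(ν) has gap at least g/p. Near p^k ν
-- there are two opposite bounds: Frobenius gives gap at least p^k at p^k ν, and maximality of k
-- gives gap at most p^k at the peak above it. Everything runs over an abstract `Frame`; lists of
-- terms are shown to form one only near the end.

open import Defs
open import Algebra.Bundles using (CommutativeRing)
import Algebra.Properties.Ring
import Algebra.Properties.Semiring.Exp
import Algebra.Properties.Semiring.Mult
import Algebra.Properties.Semiring.Mult.TCOptimised
import Algebra.Solver.Ring
import Algebra.Solver.Ring.AlmostCommutativeRing as ACR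
open import Data.Bool.Base using (true; false; _∧_; if_then_else_)
open import Data.Empty using (⊥; ⊥-elim)
open import Data.Fin.Base using (Fin)
open import Data.Fin.Patterns using (0F; 1F; 2F)
import Data.Fin.Properties as Finₚ
open import Data.Integer.Base as ℤ using (ℤ; -[1+_]; _⊖_; _◃_)
import Data.Integer.Properties as ℤₚ
open import Data.List.Base using ([]; _∷_; _++_; map)
import Data.List.Properties as Listₚ
open import Data.Maybe.Base using (Maybe; just; nothing)
open import Data.Nat.Base as ℕ using (ℕ; zero; suc; pred; z≤n; s≤s; NonZero)
open import Data.Nat.Coprimality using (Coprime; coprime-Bézout)
import Data.Nat.Divisibility as ℕᵈ
import Data.Nat.DivMod as Div
open import Data.Nat.GCD using (module Bézout)
open import Data.Nat.Primality using (Prime; prime⇒nonZero; prime⇒nonTrivial; prime⇒irreducible; euclidsLemma)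
import Data.Nat.Properties as ℕₚ
open import Data.Nat.Tactic.RingSolver using (solve-∀)
open import Data.Product.Base using (_×_; _,_; ∃; ∃₂; proj₁; proj₂)
import Data.Sign.Base as Sign
open import Data.Sum.Base using (_⊎_; inj₁; inj₂)
open import Data.Vec.Functional using (updateAt)
open import Data.Vec.Functional.Properties using (updateAt-updates; updateAt-minimal)
open import Function.Base using (_∘_; const)
open import Level using (0ℓ)
open import Relation.Binary.Definitions using (tri<; tri≈; tri>)
open import Relation.Binary.PropositionalEquality as ≡ using (_≡_; _≢_)
import Relation.Binary.Reasoning.Setoid
open import Relation.Binary.Structures using (IsEquivalence)
open import Relation.Nullary using (¬_; does; yes; no; contradiction)

-- The generic ring solver with integer coefficients, so that cancellations x - x = 0 are
-- recognised in an arbitrary commutative ring.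
module IntegerSolver (R : CommutativeRing 0ℓ 0ℓ) where
  open CommutativeRing R
  open Algebra.Properties.Ring ring
  open Algebra.Properties.Semiring.Mult.TCOptimised semiring renaming (_×_ to _·_)
  open Relation.Binary.Reasoning.Setoid setoid

  fromℤ : ℤ → Carrier
  fromℤ (ℤ.+ n) = n · 1#
  fromℤ -[1+ n ] = - (suc n · 1#)

  fromℤ-⊖ : ∀ m n → fromℤ (m ⊖ n) ≈ m · 1# - n · 1#
  fromℤ-⊖ m zero = sym (trans (+-congˡ -0#≈0#) (+-identityʳ _))
  fromℤ-⊖ zero (suc n) = sym (+-identityˡ _)
  fromℤ-⊖ (suc m) (suc n) = begin
    fromℤ (suc m ⊖ suc n)               ≡⟨ ≡.cong fromℤ (ℤₚ.[1+m]⊖[1+n]≡m⊖n m n) ⟩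
    fromℤ (m ⊖ n)                       ≈⟨ fromℤ-⊖ m n ⟩
    m · 1# - n · 1#                     ≈⟨ +-congʳ (sym (trans (+-congʳ (-‿inverseʳ 1#)) (+-identityˡ _))) ⟩
    (1# - 1#) + m · 1# - n · 1#         ≈⟨ +-congʳ (trans (+-congʳ (+-comm _ _)) (trans (+-assoc _ _ _) (+-comm _ _))) ⟩
    (1# + m · 1#) + - 1# - n · 1#       ≈⟨ +-assoc _ _ _ ⟩
    (1# + m · 1#) + (- 1# - n · 1#)     ≈⟨ +-congˡ (-‿+-comm 1# (n · 1#)) ⟩
    (1# + m · 1#) - (1# + n · 1#)       ≈⟨ +-cong (1+× m 1#) (-‿cong (1+× n 1#)) ⟨
    suc m · 1# - suc n · 1#             ∎

  fromℤ-+ : ∀ i j → fromℤ (i ℤ.+ j) ≈ fromℤ i + fromℤ j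
  fromℤ-+ (ℤ.+ m) (ℤ.+ n) = ×-homo-+ 1# m n
  fromℤ-+ (ℤ.+ m) -[1+ n ] = fromℤ-⊖ m (suc n)
  fromℤ-+ -[1+ m ] (ℤ.+ n) = trans (fromℤ-⊖ n (suc m)) (+-comm _ _)
  fromℤ-+ -[1+ m ] -[1+ n ] = begin
    - (suc (suc (m ℕ.+ n)) · 1#)    ≡⟨ ≡.cong (λ k → - (k · 1#)) (ℕₚ.+-suc (suc m) n) ⟨
    - ((suc m ℕ.+ suc n) · 1#)      ≈⟨ -‿cong (×-homo-+ 1# (suc m) (suc n)) ⟩
    - (suc m · 1# + suc n · 1#)     ≈⟨ -‿+-comm _ _ ⟨
    - (suc m · 1#) - suc n · 1#     ∎

  fromℤ-◃ : ∀ n → fromℤ (Sign.- ◃ n) ≈ - (n · 1#)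
  fromℤ-◃ zero = sym -0#≈0#
  fromℤ-◃ (suc n) = refl

  fromℤ-* : ∀ i j → fromℤ (i ℤ.* j) ≈ fromℤ i * fromℤ j
  fromℤ-* (ℤ.+ m) (ℤ.+ n) = trans (reflexive (≡.cong fromℤ (ℤₚ.+◃n≡+n (m ℕ.* n)))) (×1-homo-* m n)
  fromℤ-* (ℤ.+ m) -[1+ n ] = trans (fromℤ-◃ (m ℕ.* suc n))
    (trans (-‿cong (×1-homo-* m (suc n))) (-‿distribʳ-* _ _))
  fromℤ-* -[1+ m ] (ℤ.+ n) = trans (fromℤ-◃ (suc m ℕ.* n))
    (trans (-‿cong (×1-homo-* (suc m) n)) (-‿distribˡ-* _ _))
  fromℤ-* -[1+ m ] -[1+ n ] = begin
    (suc m ℕ.* suc n) · 1#              ≈⟨ ×1-homo-* (suc m) (suc n) ⟩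
    (suc m · 1#) * (suc n · 1#)         ≈⟨ -‿involutive _ ⟨
    - - ((suc m · 1#) * (suc n · 1#))   ≈⟨ -‿cong (-‿distribʳ-* _ _) ⟩
    - ((suc m · 1#) * - (suc n · 1#))   ≈⟨ -‿distribˡ-* _ _ ⟩
    - (suc m · 1#) * - (suc n · 1#)     ∎

  fromℤ-neg : ∀ i → fromℤ (ℤ.- i) ≈ - fromℤ i
  fromℤ-neg (ℤ.+ zero) = sym -0#≈0#
  fromℤ-neg (ℤ.+ suc n) = refl
  fromℤ-neg -[1+ n ] = sym (-‿involutive _)

  private
    almostRing = ACR.fromCommutativeRing R

    morphism : ℤ.+-*-rawRing ACR.-Raw-AlmostCommutative⟶ almostRing
    morphism = record
      { ⟦_⟧ = fromℤ ; +-homo = fromℤ-+ ; *-homo = fromℤ-* ; -‿homo = fromℤ-neg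
      ; 0-homo = refl ; 1-homo = refl }

    equal? : ∀ i j → Maybe (fromℤ i ≈ fromℤ j)
    equal? i j with i ℤₚ.≟ j
    ... | yes i≡j = just (reflexive (≡.cong fromℤ i≡j))
    ... | no _ = nothing

  open Algebra.Solver.Ring ℤ.+-*-rawRing almostRing morphism equal? public
    using (Polynomial; solve; _:=_; _:+_; _:*_; _:-_; :-_; con)

  :0 :1 : ∀ {n} → Polynomial n
  :0 = con (ℤ.+ 0)
  :1 = con (ℤ.+ 1)

-- Lists of terms modulo p as a commutative ring.

module Polynomials where
  open import Data.Nat.Base using (_+_; _*_; _≤_; _<_)
  open ≡ using (refl; sym; trans; cong; cong₂; subst; module ≡-Reasoning)

  module Congruence (p : ℕ) where

    ≡⇒Cong : ∀ {a b} → a ≡ b → Cong p a b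
    ≡⇒Cong refl = 0 , 0 , refl

    Cong-sym : ∀ {a b} → Cong p a b → Cong p b a
    Cong-sym (k , l , e) = l , k , sym e

    Cong-trans : ∀ {a b c} → Cong p a b → Cong p b c → Cong p a c
    Cong-trans {a} {b} {c} (k , l , e) (m , n , f) = k + m , n + l , (begin
      a + (k + m) * p      ≡⟨ split a k m p ⟩
      (a + k * p) + m * p  ≡⟨ cong (_+ m * p) e ⟩
      (b + l * p) + m * p  ≡⟨ swap b l m p ⟩
      (b + m * p) + l * p  ≡⟨ cong (_+ l * p) f ⟩
      (c + n * p) + l * p  ≡⟨ split c n l p ⟨
      c + (n + l) * p      ∎)
      where
      open ≡-Reasoning
      split : ∀ a k m p → a + (k + m) * p ≡ (a + k * p) + m * p
      split = solve-∀
      swap : ∀ b l m p → (b + l * p) + m * p ≡ (b + m * p) + l * p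
      swap = solve-∀

    Cong-+ : ∀ {a b c d} → Cong p a b → Cong p c d → Cong p (a + c) (b + d)
    Cong-+ {a} {b} {c} {d} (k , l , e) (m , n , f) = k + m , l + n ,
      trans (split a c k m p) (trans (cong₂ _+_ e f) (sym (split b d l n p)))
      where
      split : ∀ a c k m p → (a + c) + (k + m) * p ≡ (a + k * p) + (c + m * p)
      split = solve-∀

    Cong-*ˡ : ∀ c {a b} → Cong p a b → Cong p (c * a) (c * b)
    Cong-*ˡ c {a} {b} (k , l , e) = c * k , c * l ,
      trans (split c a k p) (trans (cong (c *_) e) (sym (split c b l p)))
      where
      split : ∀ c a k p → c * a + c * k * p ≡ c * (a + k * p)
      split = solve-∀

    Cong-p*0 : ∀ a → Cong p (p * a) 0
    Cong-p*0 a = 0 , a , trans (ℕₚ.+-identityʳ _) (ℕₚ.*-comm p a)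

  -- A weight φ turns polynomials into numbers by c x^i y^j ↦ c φ(i,j); coefficients are the
  -- special case of indicator weights, and all ring laws can be checked on arbitrary weights.
  eval : (ℕ → ℕ → ℕ) → Poly → ℕ
  eval φ [] = 0
  eval φ ((c , i , j) ∷ P) = c * φ i j + eval φ P

  eval-cong : ∀ {φ ψ} → (∀ i j → φ i j ≡ ψ i j) → ∀ P → eval φ P ≡ eval ψ P
  eval-cong φ≗ψ [] = refl
  eval-cong φ≗ψ ((c , i , j) ∷ P) = cong₂ (λ a b → c * a + b) (φ≗ψ i j) (eval-cong φ≗ψ P)

  eval-++ : ∀ φ P Q → eval φ (P ++ Q) ≡ eval φ P + eval φ Q
  eval-++ φ [] Q = refl
  eval-++ φ ((c , i , j) ∷ P) Q =
    trans (cong (c * φ i j +_) (eval-++ φ P Q)) (sym (ℕₚ.+-assoc (c * φ i j) _ _))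

  eval-+ : ∀ φ ψ P → eval (λ i j → φ i j + ψ i j) P ≡ eval φ P + eval ψ P
  eval-+ φ ψ [] = refl
  eval-+ φ ψ ((c , i , j) ∷ P) =
    trans (cong (c * (φ i j + ψ i j) +_) (eval-+ φ ψ P)) (split c (φ i j) (ψ i j) _ _)
    where
    split : ∀ c a b x y → c * (a + b) + (x + y) ≡ (c * a + x) + (c * b + y)
    split = solve-∀

  eval-* : ∀ a φ P → eval (λ i j → a * φ i j) P ≡ a * eval φ P
  eval-* a φ [] = sym (ℕₚ.*-zeroʳ a)
  eval-* a φ ((c , i , j) ∷ P) = trans (cong (c * (a * φ i j) +_) (eval-* a φ P)) (split a c (φ i j) _)
    where
    split : ∀ a c x y → c * (a * x) + a * y ≡ a * (c * x + y)
    split = solve-∀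

  eval-zero : ∀ P → eval (λ _ _ → 0) P ≡ 0
  eval-zero [] = refl
  eval-zero ((c , _) ∷ P) = cong₂ _+_ (ℕₚ.*-zeroʳ c) (eval-zero P)

  -- Fubini for finite sums; commutativity of the product rests on it.
  eval-swap : ∀ (φ : ℕ → ℕ → ℕ → ℕ → ℕ) P Q →
    eval (λ i j → eval (φ i j) Q) P ≡ eval (λ k l → eval (λ i j → φ i j k l) P) Q
  eval-swap φ [] Q = sym (eval-zero Q)
  eval-swap φ ((c , i , j) ∷ P) Q = begin
    c * eval (φ i j) Q + eval (λ i j → eval (φ i j) Q) P
      ≡⟨ cong₂ _+_ (sym (eval-* c (φ i j) Q)) (eval-swap φ P Q) ⟩
    eval (λ k l → c * φ i j k l) Q + eval (λ k l → eval (λ i j → φ i j k l) P) Q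
      ≡⟨ eval-+ _ _ Q ⟨
    eval (λ k l → eval (λ i j → φ i j k l) ((c , i , j) ∷ P)) Q ∎
    where open ≡-Reasoning

  eval-map : ∀ φ ψ (f : Term → Term) a →
    (∀ c i j → proj₁ (f (c , i , j)) * φ (proj₁ (proj₂ (f (c , i , j)))) (proj₂ (proj₂ (f (c , i , j))))
      ≡ a * (c * ψ i j)) →
    ∀ P → eval φ (map f P) ≡ a * eval ψ P
  eval-map φ ψ f a h [] = sym (ℕₚ.*-zeroʳ a)
  eval-map φ ψ f a h ((c , i , j) ∷ P) =
    trans (cong₂ _+_ (h c i j) (eval-map φ ψ f a h P)) (sym (ℕₚ.*-distribˡ-+ a _ _))

  eval-⊗ : ∀ φ P Q → eval φ (P ⊗ Q) ≡ eval (λ i j → eval (λ k l → φ (i + k) (j + l)) Q) P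
  eval-⊗ φ [] Q = refl
  eval-⊗ φ ((c , i , j) ∷ P) Q = trans (eval-++ φ (map _ Q) (P ⊗ Q))
    (cong₂ _+_ (eval-map φ (λ k l → φ (i + k) (j + l)) _ c (λ d k l → ℕₚ.*-assoc c d _) Q) (eval-⊗ φ P Q))

  -- Kronecker delta, by recursion so that common successors cancel by computation.
  χ : ℕ → ℕ → ℕ
  χ zero zero = 1
  χ zero (suc n) = 0
  χ (suc m) zero = 0
  χ (suc m) (suc n) = χ m n

  χ-≢ : ∀ {m n} → m ≢ n → χ m n ≡ 0
  χ-≢ {zero} {zero} m≢n = contradiction refl m≢n
  χ-≢ {zero} {suc n} m≢n = refl
  χ-≢ {suc m} {zero} m≢n = refl
  χ-≢ {suc m} {suc n} m≢n = χ-≢ (m≢n ∘ cong suc)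

  χ-refl : ∀ n → χ n n ≡ 1
  χ-refl zero = refl
  χ-refl (suc n) = χ-refl n

  δ : ℕ → ℕ → ℕ → ℕ → ℕ
  δ a b i j = χ i a * χ j b

  coeff≡eval : ∀ P a b → coeff P a b ≡ eval (δ a b) P
  coeff≡eval [] a b = refl
  coeff≡eval ((c , i , j) ∷ P) a b = cong₂ _+_
    (trans (select c (does (i ℕₚ.≟ a)) (does (j ℕₚ.≟ b))) (cong₂ (λ s t → c * (s * t)) (χ≡does i a) (χ≡does j b)))
    (coeff≡eval P a b)
    where
    χ≡does : ∀ m n → (if does (m ℕₚ.≟ n) then 1 else 0) ≡ χ m n
    χ≡does zero zero = refl
    χ≡does zero (suc n) = refl
    χ≡does (suc m) zero = refl
    χ≡does (suc m) (suc n) = χ≡does m n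
    select : ∀ c s t → (if s ∧ t then c else 0) ≡ c * ((if s then 1 else 0) * (if t then 1 else 0))
    select c true true = sym (ℕₚ.*-identityʳ c)
    select c true false = sym (ℕₚ.*-zeroʳ c)
    select c false t = sym (ℕₚ.*-zeroʳ c)

  ∑ : ℕ → (ℕ → ℕ) → ℕ
  ∑ zero f = 0
  ∑ (suc n) f = f 0 + ∑ n (f ∘ suc)

  ∑-cong : ∀ n {f g} → (∀ i → f i ≡ g i) → ∑ n f ≡ ∑ n g
  ∑-cong zero f≗g = refl
  ∑-cong (suc n) f≗g = cong₂ _+_ (f≗g 0) (∑-cong n (f≗g ∘ suc))

  ∑-zero : ∀ n → ∑ n (λ _ → 0) ≡ 0
  ∑-zero zero = refl
  ∑-zero (suc n) = ∑-zero n

  ∑-+ : ∀ n f g → ∑ n (λ i → f i + g i) ≡ ∑ n f + ∑ n g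
  ∑-+ zero f g = refl
  ∑-+ (suc n) f g = trans (cong (f 0 + g 0 +_) (∑-+ n (f ∘ suc) (g ∘ suc))) (shuffle (f 0) (g 0) _ _)
    where
    shuffle : ∀ a b x y → a + b + (x + y) ≡ a + x + (b + y)
    shuffle = solve-∀

  ∑-χ : ∀ n (f : ℕ → ℕ) {i} → i < n → ∑ n (λ a → χ i a * f a) ≡ f i
  ∑-χ (suc n) f {zero} i<n =
    trans (cong₂ _+_ (ℕₚ.*-identityˡ (f 0)) (∑-zero n)) (ℕₚ.+-identityʳ _)
  ∑-χ (suc n) f {suc i} (ℕ.s≤s i<n) = ∑-χ n (f ∘ suc) i<n

  -- A crude bound: every exponent occurring in the list is smaller.
  box : Poly → ℕ
  box [] = 0
  box ((c , i , j) ∷ P) = suc (i + j + box P)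

  -- On a box containing all exponents, any weight is a finite combination of indicator weights.
  -- Agreement of coefficients therefore forces agreement under every weight.
  eval≡∑coeff : ∀ φ P N → box P ≤ N → eval φ P ≡ ∑ N (λ a → ∑ N (λ b → φ a b * eval (δ a b) P))
  eval≡∑coeff φ [] N _ = sym (trans
    (∑-cong N (λ a → trans (∑-cong N (λ b → ℕₚ.*-zeroʳ (φ a b))) (∑-zero N))) (∑-zero N))
  eval≡∑coeff φ ((c , i , j) ∷ P) N box≤N = begin
    c * φ i j + eval φ P
      ≡⟨ cong₂ _+_ (sym single) (eval≡∑coeff φ P N (ℕₚ.≤-trans (ℕₚ.m≤n⇒m≤1+n (ℕₚ.m≤n+m _ (i + j))) box≤N)) ⟩
    ∑ N (λ a → ∑ N (λ b → φ a b * (c * δ a b i j))) + ∑ N (λ a → ∑ N (λ b → φ a b * eval (δ a b) P))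
      ≡⟨ ∑-+ N _ _ ⟨
    ∑ N (λ a → ∑ N (λ b → φ a b * (c * δ a b i j)) + ∑ N (λ b → φ a b * eval (δ a b) P))
      ≡⟨ ∑-cong N (λ a → trans (sym (∑-+ N _ _)) (∑-cong N (λ b → sym (ℕₚ.*-distribˡ-+ (φ a b) _ _)))) ⟩
    ∑ N (λ a → ∑ N (λ b → φ a b * (c * δ a b i j + eval (δ a b) P))) ∎
    where
    open ≡-Reasoning
    i<N : i < N
    i<N = ℕₚ.≤-trans (ℕ.s≤s (ℕₚ.≤-trans (ℕₚ.m≤m+n i j) (ℕₚ.m≤m+n _ _))) box≤N
    j<N : j < N
    j<N = ℕₚ.≤-trans (ℕ.s≤s (ℕₚ.≤-trans (ℕₚ.m≤n+m j i) (ℕₚ.m≤m+n _ _))) box≤N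
    rearrange : ∀ f c x y → f * (c * (x * y)) ≡ y * (x * (c * f))
    rearrange = solve-∀
    single : ∑ N (λ a → ∑ N (λ b → φ a b * (c * δ a b i j))) ≡ c * φ i j
    single = trans
      (∑-cong N λ a → trans (∑-cong N λ b → rearrange (φ a b) c (χ i a) (χ j b)) (∑-χ N (λ b → χ i a * (c * φ a b)) j<N))
      (∑-χ N (λ a → c * φ a j) i<N)

  -- Negation, homogeneous parts, derivatives, the exchange of x and y, Frobenius and its left
  -- inverse all send monomials to multiples of monomials; this common form gives them one proof of
  -- well-definedness.
  operator : (ℕ → ℕ → ℕ) → (ℕ → ℕ → ℕ) → (ℕ → ℕ → ℕ) → Poly → Poly
  operator w f g = map λ { (c , i , j) → c * w i j , f i j , g i j }

  eval-operator : ∀ φ w f g P → eval φ (operator w f g P) ≡ eval (λ i j → w i j * φ (f i j) (g i j)) P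
  eval-operator φ w f g P = trans
    (eval-map φ _ _ 1 (λ c i j → trans (ℕₚ.*-assoc c (w i j) _) (sym (ℕₚ.*-identityˡ _))) P) (ℕₚ.*-identityˡ _)

  module PolynomialRing (p : ℕ) .{{_ : NonZero p}} where
    open Congruence p

    -- Quantifying over all weights makes the relation stable under substitution into weights, which
    -- is how products and monomial operators respect it. The record wrapper keeps both polynomials
    -- inferable.
    record _≈_ (P Q : Poly) : Set where
      constructor mk≈
      field eval-≈ : ∀ φ → Cong p (eval φ P) (eval φ Q)
    open _≈_ public

    ≡⇒≈ : ∀ {P Q} → (∀ φ → eval φ P ≡ eval φ Q) → P ≈ Q
    ≡⇒≈ h = mk≈ λ φ → ≡⇒Cong (h φ)

    ≈⇒PolyEq : ∀ {P Q} → P ≈ Q → PolyEq p P Q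
    ≈⇒PolyEq {P} {Q} P≈Q a b rewrite coeff≡eval P a b | coeff≡eval Q a b = eval-≈ P≈Q (δ a b)

    PolyEq⇒≈ : ∀ {P Q} → PolyEq p P Q → P ≈ Q
    PolyEq⇒≈ {P} {Q} h = mk≈ λ φ → Cong-trans
      (≡⇒Cong (eval≡∑coeff φ P N (ℕₚ.m≤m+n _ _)))
      (Cong-trans (∑-Cong N λ a → ∑-Cong N λ b → Cong-*ˡ (φ a b) (coeffs a b))
        (≡⇒Cong (sym (eval≡∑coeff φ Q N (ℕₚ.m≤n+m _ _)))))
      where
      N = box P + box Q
      coeffs : ∀ a b → Cong p (eval (δ a b) P) (eval (δ a b) Q)
      coeffs a b rewrite sym (coeff≡eval P a b) | sym (coeff≡eval Q a b) = h a b
      ∑-Cong : ∀ n {f g} → (∀ i → Cong p (f i) (g i)) → Cong p (∑ n f) (∑ n g)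
      ∑-Cong zero h = ≡⇒Cong refl
      ∑-Cong (suc n) h = Cong-+ (h 0) (∑-Cong n (h ∘ suc))

    operator-cong : ∀ w f g {P Q} → P ≈ Q → operator w f g P ≈ operator w f g Q
    operator-cong w f g {P} {Q} P≈Q = mk≈ λ φ →
      subst (λ n → Cong p n _) (sym (eval-operator φ w f g P))
        (subst (Cong p _) (sym (eval-operator φ w f g Q)) (eval-≈ P≈Q _))

    eval-Cong : ∀ {φ ψ} → (∀ i j → Cong p (φ i j) (ψ i j)) → ∀ P → Cong p (eval φ P) (eval ψ P)
    eval-Cong h [] = ≡⇒Cong refl
    eval-Cong h ((c , i , j) ∷ P) = Cong-+ (Cong-*ˡ c (h i j)) (eval-Cong h P)

    -- Coefficients are natural numbers, so -1 is represented by p - 1.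
    negate : Poly → Poly
    negate = operator (λ _ _ → pred p) (λ i j → i) (λ i j → j)

    ⊗-cong : ∀ {P P′ Q Q′} → P ≈ P′ → Q ≈ Q′ → (P ⊗ Q) ≈ (P′ ⊗ Q′)
    ⊗-cong {P} {P′} {Q} {Q′} P≈P′ Q≈Q′ = mk≈ λ φ →
      subst (λ n → Cong p n _) (sym (eval-⊗ φ P Q))
        (subst (Cong p _) (sym (eval-⊗ φ P′ Q′))
          (Cong-trans (eval-≈ P≈P′ _) (eval-Cong (λ i j → eval-≈ Q≈Q′ _) P′)))

    ⊕-cong : ∀ {P P′ Q Q′} → P ≈ P′ → Q ≈ Q′ → (P ⊕ Q) ≈ (P′ ⊕ Q′)
    ⊕-cong {P} {P′} {Q} {Q′} P≈P′ Q≈Q′ = mk≈ λ φ →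
      subst (λ n → Cong p n _) (sym (eval-++ φ P Q))
        (subst (Cong p _) (sym (eval-++ φ P′ Q′)) (Cong-+ (eval-≈ P≈P′ φ) (eval-≈ Q≈Q′ φ)))

    ⊕-comm : ∀ P Q → (P ⊕ Q) ≈ (Q ⊕ P)
    ⊕-comm P Q = ≡⇒≈ λ φ → trans (eval-++ φ P Q) (trans (ℕₚ.+-comm (eval φ P) _) (sym (eval-++ φ Q P)))

    ⊗-comm : ∀ P Q → (P ⊗ Q) ≈ (Q ⊗ P)
    ⊗-comm P Q = ≡⇒≈ λ φ → begin
      eval φ (P ⊗ Q)                                           ≡⟨ eval-⊗ φ P Q ⟩
      eval (λ i j → eval (λ k l → φ (i + k) (j + l)) Q) P      ≡⟨ eval-swap _ P Q ⟩
      eval (λ k l → eval (λ i j → φ (i + k) (j + l)) P) Q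
        ≡⟨ eval-cong (λ k l → eval-cong (λ i j → cong₂ φ (ℕₚ.+-comm i k) (ℕₚ.+-comm j l)) P) Q ⟩
      eval (λ k l → eval (λ i j → φ (k + i) (l + j)) P) Q      ≡⟨ eval-⊗ φ Q P ⟨
      eval φ (Q ⊗ P)                                           ∎
      where open ≡-Reasoning

    ⊗-assoc : ∀ P Q R → ((P ⊗ Q) ⊗ R) ≈ (P ⊗ (Q ⊗ R))
    ⊗-assoc P Q R = ≡⇒≈ λ φ → begin
      eval φ ((P ⊗ Q) ⊗ R)
        ≡⟨ trans (eval-⊗ φ (P ⊗ Q) R) (eval-⊗ _ P Q) ⟩
      eval (λ i j → eval (λ k l → eval (λ m n → φ (i + k + m) (j + l + n)) R) Q) P
        ≡⟨ eval-cong (λ i j → eval-cong (λ k l → eval-cong (λ m n →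
             cong₂ φ (ℕₚ.+-assoc i k m) (ℕₚ.+-assoc j l n)) R) Q) P ⟩
      eval (λ i j → eval (λ k l → eval (λ m n → φ (i + (k + m)) (j + (l + n))) R) Q) P
        ≡⟨ trans (eval-⊗ φ P (Q ⊗ R)) (eval-cong (λ i j → eval-⊗ _ Q R) P) ⟨
      eval φ (P ⊗ (Q ⊗ R)) ∎
      where open ≡-Reasoning

    ⊗-identityˡ : ∀ P → (one ⊗ P) ≈ P
    ⊗-identityˡ P = ≡⇒≈ λ φ → trans (eval-⊗ φ one P) (trans (ℕₚ.+-identityʳ _) (ℕₚ.*-identityˡ _))

    ⊗-distribʳ : ∀ P Q R → ((Q ⊕ R) ⊗ P) ≈ ((Q ⊗ P) ⊕ (R ⊗ P))
    ⊗-distribʳ P Q R = ≡⇒≈ λ φ → trans (eval-⊗ φ (Q ⊕ R) P) (trans (eval-++ _ Q R)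
      (sym (trans (eval-++ φ (Q ⊗ P) (R ⊗ P)) (cong₂ _+_ (eval-⊗ φ Q P) (eval-⊗ φ R P)))))

    negate-inverseˡ : ∀ P → (negate P ⊕ P) ≈ []
    negate-inverseˡ P = mk≈ λ φ → Cong-trans (≡⇒Cong (begin
      eval φ (negate P ⊕ P)             ≡⟨ eval-++ φ (negate P) P ⟩
      eval φ (negate P) + eval φ P
        ≡⟨ cong (_+ eval φ P) (trans (eval-operator φ _ _ _ P) (eval-* (pred p) φ P)) ⟩
      pred p * eval φ P + eval φ P      ≡⟨ ℕₚ.+-comm (pred p * eval φ P) _ ⟩
      suc (pred p) * eval φ P           ≡⟨ cong (_* eval φ P) (ℕₚ.suc-pred p) ⟩
      p * eval φ P                      ∎)) (Cong-p*0 (eval φ P))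
      where open ≡-Reasoning

    polynomialRing : CommutativeRing 0ℓ 0ℓ
    polynomialRing = record
      { Carrier = Poly ; _≈_ = _≈_ ; _+_ = _⊕_ ; _*_ = _⊗_ ; -_ = negate ; 0# = [] ; 1# = one
      ; isCommutativeRing = record
        { isRing = record
          { +-isAbelianGroup = record
            { isGroup = record
              { isMonoid = record
                { isSemigroup = record
                  { isMagma = record { isEquivalence = ≈-isEquivalence ; ∙-cong = ⊕-cong }
                  ; assoc = λ P Q R → ≡⇒≈ λ φ → cong (eval φ) (Listₚ.++-assoc P Q R) }
                ; identity = (λ P → ≈-refl) , λ P → ≡⇒≈ λ φ → cong (eval φ) (Listₚ.++-identityʳ P) }
              ; inverse = negate-inverseˡ , λ P → ≈-trans (⊕-comm P (negate P)) (negate-inverseˡ P)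
              ; ⁻¹-cong = operator-cong _ _ _ }
            ; comm = ⊕-comm }
          ; *-cong = ⊗-cong
          ; *-assoc = ⊗-assoc
          ; *-identity = ⊗-identityˡ , λ P → ≈-trans (⊗-comm P one) (⊗-identityˡ P)
          ; distrib = (λ P Q R → ≈-trans (⊗-comm P (Q ⊕ R)) (≈-trans (⊗-distribʳ P Q R)
                        (⊕-cong (⊗-comm Q P) (⊗-comm R P))))
                    , ⊗-distribʳ }
        ; *-comm = ⊗-comm } }
      where
      ≈-refl : ∀ {P} → P ≈ P
      ≈-refl = ≡⇒≈ λ φ → refl
      ≈-trans : ∀ {P Q R} → P ≈ Q → Q ≈ R → P ≈ R
      ≈-trans P≈Q Q≈R = mk≈ λ φ → Cong-trans (eval-≈ P≈Q φ) (eval-≈ Q≈R φ)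
      ≈-isEquivalence : IsEquivalence _≈_
      ≈-isEquivalence = record
        { refl = ≈-refl ; sym = λ P≈Q → mk≈ λ φ → Cong-sym (eval-≈ P≈Q φ) ; trans = ≈-trans }

-- Multiplicities, their distances, and the arithmetic of exponents.

module Arithmetic where
  open import Data.Nat.Base using (_+_; _*_; _∸_; _^_; _≤_; _<_; ∣_-_∣; _/_; _%_)
  open ≡ using (refl; sym; trans; cong; cong₂; subst; subst₂)

  -- This is μ′ = μ + e_i, stated pointwise because multiplicities are functions without extensional
  -- equality.
  Bump : Fin 3 → Mult → Mult → Set
  Bump i μ μ′ = μ′ i ≡ suc (μ i) × (∀ j → j ≢ i → μ′ j ≡ μ j)

  size-cong : ∀ {μ ν : Mult} → (∀ i → μ i ≡ ν i) → size μ ≡ size ν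
  size-cong h = cong₂ _+_ (cong₂ _+_ (h 0F) (h 1F)) (h 2F)

  Bump-size : ∀ i {μ μ′} → Bump i μ μ′ → size μ′ ≡ suc (size μ)
  Bump-size 0F (e , h) rewrite e | h 1F (λ ()) | h 2F (λ ()) = refl
  Bump-size 1F {μ} (e , h) rewrite e | h 0F (λ ()) | h 2F (λ ()) = cong (_+ μ 2F) (ℕₚ.+-suc (μ 0F) _)
  Bump-size 2F (e , h) rewrite e | h 0F (λ ()) | h 1F (λ ()) = ℕₚ.+-suc _ _

  AgreeOff : Fin 3 → Mult → Mult → Set
  AgreeOff i μ μ′ = ∀ j → j ≢ i → μ′ j ≡ μ j

  predecessor : ∀ i {μ : Mult} {n} → μ i ≡ suc n → ∃ λ μ′ → Bump i μ′ μ
  predecessor i {μ} {n} e = updateAt μ i (const n) ,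
    trans e (cong suc (sym (updateAt-updates i μ))) , λ j j≢i → sym (updateAt-minimal j i μ j≢i)

  successor : ∀ i (μ : Mult) → ∃ λ μ′ → Bump i μ μ′
  successor i μ = updateAt μ i suc , updateAt-updates i μ , λ j → updateAt-minimal j i μ

  zero⊎suc : ∀ (μ : Mult) → (∀ i → μ i ≡ 0) ⊎ ∃₂ λ i n → μ i ≡ suc n
  zero⊎suc μ with μ 0F in e₀ | μ 1F in e₁ | μ 2F in e₂
  ... | suc n | _ | _ = inj₂ (0F , n , e₀)
  ... | zero | suc n | _ = inj₂ (1F , n , e₁)
  ... | zero | zero | suc n = inj₂ (2F , n , e₂)
  ... | zero | zero | zero = inj₁ λ { 0F → e₀ ; 1F → e₁ ; 2F → e₂ }

  without : Fin 3 → Mult → Mult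
  without i μ = updateAt μ i (const 0)

  without-size : ∀ i μ → size (without i μ) + μ i ≡ size μ
  without-size 0F μ = trans (ℕₚ.+-comm _ (μ 0F)) (sym (ℕₚ.+-assoc (μ 0F) (μ 1F) (μ 2F)))
  without-size 1F μ = shuffle (μ 0F) (μ 1F) (μ 2F)
    where
    shuffle : ∀ a b c → a + 0 + c + b ≡ a + b + c
    shuffle = solve-∀
  without-size 2F μ = cong (_+ μ 2F) (ℕₚ.+-identityʳ _)

  dist-triangle : ∀ μ ν ξ → dist μ ξ ≤ dist μ ν + dist ν ξ
  dist-triangle μ ν ξ = ℕₚ.≤-trans
    (ℕₚ.+-mono-≤ (ℕₚ.+-mono-≤ (triangle 0F) (triangle 1F)) (triangle 2F))
    (ℕₚ.≤-reflexive (shuffle (gap 0F) _ (gap 1F) _ (gap 2F) _))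
    where
    gap : Fin 3 → ℕ
    gap i = ∣ μ i - ν i ∣
    triangle : ∀ i → ∣ μ i - ξ i ∣ ≤ ∣ μ i - ν i ∣ + ∣ ν i - ξ i ∣
    triangle i = ℕₚ.∣-∣-triangle (μ i) (ν i) (ξ i)
    shuffle : ∀ a b c d e f → a + b + (c + d) + (e + f) ≡ a + c + e + (b + d + f)
    shuffle = solve-∀

  dist-sym : ∀ μ ν → dist μ ν ≡ dist ν μ
  dist-sym μ ν = cong₂ _+_ (cong₂ _+_ (ℕₚ.∣-∣-comm (μ 0F) (ν 0F)) (ℕₚ.∣-∣-comm (μ 1F) (ν 1F)))
    (ℕₚ.∣-∣-comm (μ 2F) (ν 2F))

  dist-refl : ∀ μ → dist μ μ ≡ 0
  dist-refl μ rewrite ℕₚ.∣n-n∣≡0 (μ 0F) | ℕₚ.∣n-n∣≡0 (μ 1F) | ℕₚ.∣n-n∣≡0 (μ 2F) = refl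

  ∣n-1+n∣≡1 : ∀ n → ∣ n - suc n ∣ ≡ 1
  ∣n-1+n∣≡1 zero = refl
  ∣n-1+n∣≡1 (suc n) = ∣n-1+n∣≡1 n

  dist-Bump : ∀ i {μ μ′} → Bump i μ μ′ → dist μ μ′ ≡ 1
  dist-Bump 0F {μ} (e , h) rewrite e | h 1F (λ ()) | h 2F (λ ())
    | ∣n-1+n∣≡1 (μ 0F) | ℕₚ.∣n-n∣≡0 (μ 1F) | ℕₚ.∣n-n∣≡0 (μ 2F) = refl
  dist-Bump 1F {μ} (e , h) rewrite e | h 0F (λ ()) | h 2F (λ ())
    | ℕₚ.∣n-n∣≡0 (μ 0F) | ∣n-1+n∣≡1 (μ 1F) | ℕₚ.∣n-n∣≡0 (μ 2F) = refl
  dist-Bump 2F {μ} (e , h) rewrite e | h 0F (λ ()) | h 1F (λ ())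
    | ℕₚ.∣n-n∣≡0 (μ 0F) | ℕₚ.∣n-n∣≡0 (μ 1F) | ∣n-1+n∣≡1 (μ 2F) = refl

  -- The number of raising steps on a shortest path from μ to μ′, hence the degree gained by the low
  -- basis element along a descent.
  excess : Mult → Mult → ℕ
  excess μ μ′ = size (λ i → μ′ i ∸ μ i)

  -- Balancedness leaves at least half of |μ| to the other two entries, while 2d < |μ|.
  balanced-degree : ∀ {d g μ} i → Balanced μ → d + (d + suc g) ≡ size μ → d < size (without i μ)
  balanced-degree {d} {g} {μ} i bal total = ℕₚ.≰⇒> λ s≤d → ℕₚ.<-irrefl refl (begin-strict
    size μ                   ≤⟨ twice ⟩
    s + s                  ≤⟨ ℕₚ.+-mono-≤ s≤d s≤d ⟩
    d + d                  <⟨ ℕₚ.+-monoʳ-< d (ℕₚ.m<m+n d (s≤s z≤n)) ⟩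
    d + (d + suc g)      ≡⟨ total ⟩
    size μ                   ∎)
    where
    open ℕₚ.≤-Reasoning
    s = size (without i μ)
    shuffle : ∀ s m → (s + m) + (s + m) ≡ (s + s) + 2 * m
    shuffle = solve-∀
    twice : size μ ≤ s + s
    twice = ℕₚ.+-cancelʳ-≤ (size μ) _ _ (begin
      size μ + size μ                    ≡⟨ cong₂ _+_ (without-size i μ) (without-size i μ) ⟨
      (s + μ i) + (s + μ i)          ≡⟨ shuffle s (μ i) ⟩
      (s + s) + 2 * μ i              ≤⟨ ℕₚ.+-monoʳ-≤ (s + s) (bal i) ⟩
      (s + s) + size μ                 ∎)

  dist-step : ∀ {μ μ′ ν g n} → dist μ μ′ ≡ 1 → suc g + dist μ′ ν ≤ n → g + dist μ ν ≤ n
  dist-step {μ} {μ′} {ν} {g} {n} δ≡1 h = begin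
    g + dist μ ν                       ≤⟨ ℕₚ.+-monoʳ-≤ g (dist-triangle μ μ′ ν) ⟩
    g + (dist μ μ′ + dist μ′ ν)      ≡⟨ cong (λ n → g + (n + dist μ′ ν)) δ≡1 ⟩
    g + suc (dist μ′ ν)                ≡⟨ ℕₚ.+-suc g _ ⟩
    suc g + dist μ′ ν                  ≤⟨ h ⟩
    n                                    ∎
    where open ℕₚ.≤-Reasoning

  size≤4* : ∀ {μ d} → (∀ i → μ i ≤ d) → size μ ≤ 4 * d
  size≤4* {μ} {d} h = begin
    size μ                ≤⟨ ℕₚ.+-mono-≤ (ℕₚ.+-mono-≤ (h 0F) (h 1F)) (h 2F) ⟩
    d + d + d         ≤⟨ ℕₚ.m≤m+n _ d ⟩
    d + d + d + d   ≡⟨ quadruple d ⟩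
    4 * d               ∎
    where
    open ℕₚ.≤-Reasoning
    quadruple : ∀ d → d + d + d + d ≡ 4 * d
    quadruple = solve-∀

  size-scale : ∀ c μ → c * size μ ≡ size (scale c μ)
  size-scale c μ = trans (ℕₚ.*-distribˡ-+ c (μ 0F + μ 1F) (μ 2F))
    (cong (_+ c * μ 2F) (ℕₚ.*-distribˡ-+ c (μ 0F) (μ 1F)))

  -- Left: two linear forms times the Wronskian of two forms of degree d + 1. Right: |μ| for low
  -- degree d + 1 and gap g + 2. At g = 0 the two sides differ by exactly 1.
  wronskian-degree : ∀ d g → 1 + (1 + (suc d + d)) < suc d + (suc d + suc (suc g))
  wronskian-degree d g = ℕₚ.≤-trans (ℕₚ.m≤m+n (4 + d + d) g) (ℕₚ.≤-reflexive (shuffle d g))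
    where
    shuffle : ∀ d g → 4 + d + d + g ≡ suc d + (suc d + suc (suc g))
    shuffle = solve-∀

  dist-cong : ∀ {μ μ′ ν ν′ : Mult} → (∀ i → μ i ≡ μ′ i) → (∀ i → ν i ≡ ν′ i) → dist μ ν ≡ dist μ′ ν′
  dist-cong h k rewrite h 0F | h 1F | h 2F | k 0F | k 1F | k 2F = refl

  dist-scale : ∀ c μ ν → dist (scale c μ) (scale c ν) ≡ c * dist μ ν
  dist-scale c μ ν
    rewrite sym (ℕₚ.*-distribˡ-∣-∣ c (μ 0F) (ν 0F))
          | sym (ℕₚ.*-distribˡ-∣-∣ c (μ 1F) (ν 1F))
          | sym (ℕₚ.*-distribˡ-∣-∣ c (μ 2F) (ν 2F)) = sym (trans
      (ℕₚ.*-distribˡ-+ c (∣ μ 0F - ν 0F ∣ + ∣ μ 1F - ν 1F ∣) ∣ μ 2F - ν 2F ∣)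
      (cong (_+ c * ∣ μ 2F - ν 2F ∣) (ℕₚ.*-distribˡ-+ c ∣ μ 0F - ν 0F ∣ ∣ μ 1F - ν 1F ∣)))

  -- The prime divides the low degree and the total, hence also the gap; dividing by it gives the
  -- same relation for ν.
  gap-multiple : ∀ p d {g n} .{{_ : NonZero p}} → p * d + (p * d + g) ≡ p * n →
    ∃ λ h → g ≡ p * h × d + (d + h) ≡ n
  gap-multiple p d {g} {n} e with ℕᵈ.∣m+n∣m⇒∣n (ℕᵈ.∣m+n∣m⇒∣n (subst (p ℕᵈ.∣_) (sym e) (ℕᵈ.m∣m*n n)) (ℕᵈ.m∣m*n d)) (ℕᵈ.m∣m*n d)
  ... | ℕᵈ.divides h g≡hp = h , g≡ph , ℕₚ.*-cancelˡ-≡ _ _ p (trans (trans (expand p d h)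
      (cong (λ g → p * d + (p * d + g)) (sym g≡ph))) e)
    where
    g≡ph = trans g≡hp (ℕₚ.*-comm h p)
    expand : ∀ p d h → p * (d + (d + h)) ≡ p * d + (p * d + p * h)
    expand = solve-∀

  bounded⇒balanced : ∀ {μ d h} → (∀ i → μ i ≤ d) → d + (d + h) ≡ size μ → Balanced μ
  bounded⇒balanced {μ} {d} {h} bound total i = ℕₚ.≤-trans (ℕₚ.+-mono-≤ (bound i) (ℕₚ.+-mono-≤ (bound i) z≤n))
    (ℕₚ.≤-reflexive total)

  1+2n-odd : ∀ {d n} → d + (d + 1) ≡ n → n % 2 ≡ 1
  1+2n-odd {d} refl = trans (cong (_% 2) (shuffle d)) (Div.[m+kn]%n≡m%n 1 d 2)
    where
    shuffle : ∀ d → d + (d + 1) ≡ 1 + d * 2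
    shuffle = solve-∀

  -- The outcome of the descent: μ lies at depth at least g in the ball of radius p^(m+1) around p^(m+1) ν.
  record GapBound (p : ℕ) (μ : Mult) (g : ℕ) : Set where
    constructor bounded-by
    field
      m : ℕ
      ν : Mult
      ν-balanced : Balanced ν
      ν-odd : IsOdd ν
      near : g + dist μ (scale (p ^ suc m) ν) ≤ p ^ suc m

  -- If the gap gained on the way from μ to ν covers their distance, the triangle inequality carries
  -- the bound back from ν to μ.
  GapBound-transfer : ∀ {p μ ν g h} → g + dist μ ν ≤ h → GapBound p ν h → GapBound p μ g
  GapBound-transfer {p} {μ} {ν} {g} {h} g≤h (bounded-by m ξ bal odd h≤) = bounded-by m ξ bal odd (begin
    g + dist μ c                    ≤⟨ ℕₚ.+-monoʳ-≤ g (dist-triangle μ ν c) ⟩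
    g + (dist μ ν + dist ν c)     ≡⟨ ℕₚ.+-assoc g _ _ ⟨
    g + dist μ ν + dist ν c       ≤⟨ ℕₚ.+-monoˡ-≤ _ g≤h ⟩
    h + dist ν c                    ≤⟨ h≤ ⟩
    p ^ suc m                       ∎)
    where
    open ℕₚ.≤-Reasoning
    c = scale (p ^ suc m) ξ

  GapBound-base : ∀ {p ν μ} → Balanced ν → IsOdd ν → (∀ i → μ i ≡ p * ν i) → GapBound p μ (p * 1)
  GapBound-base {p} {ν} {μ} bal odd h = bounded-by 0 ν bal odd (ℕₚ.≤-reflexive (trans
    (cong (p * 1 +_) (trans (dist-cong {ν = scale (p * 1) ν} h′ (λ i → refl)) (dist-refl (scale (p * 1) ν))))
    (ℕₚ.+-identityʳ _)))
    where
    h′ : ∀ i → μ i ≡ p * 1 * ν i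
    h′ i = trans (h i) (cong (_* ν i) (sym (ℕₚ.*-identityʳ p)))

  GapBound-scale : ∀ {p ν μ g h} → (∀ i → μ i ≡ p * ν i) → h ≤ g → GapBound p ν g → GapBound p μ (p * h)
  GapBound-scale {p} {ν} {μ} {g} {h} μ≡pν h≤g (bounded-by m ξ bal odd g≤) = bounded-by (suc m) ξ bal odd (begin
    p * h + dist μ (scale (p * q) ξ)
      ≡⟨ cong (p * h +_) (dist-cong {ν = scale (p * q) ξ} μ≡pν (λ i → ℕₚ.*-assoc p q (ξ i))) ⟩
    p * h + dist (scale p ν) (scale p (scale q ξ))   ≡⟨ cong (p * h +_) (dist-scale p ν (scale q ξ)) ⟩
    p * h + p * dist ν (scale q ξ)                 ≡⟨ ℕₚ.*-distribˡ-+ p h _ ⟨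
    p * (h + dist ν (scale q ξ))                     ≤⟨ ℕₚ.*-monoʳ-≤ p (ℕₚ.+-monoˡ-≤ _ h≤g) ⟩
    p * (g + dist ν (scale q ξ))                     ≤⟨ ℕₚ.*-monoʳ-≤ p g≤ ⟩
    p * q                                              ∎)
    where
    open ℕₚ.≤-Reasoning
    q = p ^ suc m

  larger-gap : ∀ {d e g h n} → d ≤ e → d + (d + g) ≡ n → e + (e + h) ≡ n → h ≤ g
  larger-gap {d} {e} {g} {h} d≤e p q = ℕₚ.+-cancelˡ-≤ d _ _ (ℕₚ.+-cancelˡ-≤ d _ _ (begin
    d + (d + h)    ≤⟨ ℕₚ.+-mono-≤ d≤e (ℕₚ.+-monoˡ-≤ h d≤e) ⟩
    e + (e + h)    ≡⟨ trans q (sym p) ⟩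
    d + (d + g)    ∎))
    where open ℕₚ.≤-Reasoning

  odd⇒1+2n : ∀ {n} → n % 2 ≡ 1 → n ≡ suc (2 * (n / 2))
  odd⇒1+2n {n} odd = trans (Div.m≡m%n+[m/n]*n n 2) (cong₂ _+_ odd (ℕₚ.*-comm (n / 2) 2))

  even⇒2n : ∀ {n} → n % 2 ≡ 0 → n ≡ 2 * (n / 2)
  even⇒2n {n} even = trans (Div.m≡m%n+[m/n]*n n 2) (cong₂ _+_ even (ℕₚ.*-comm (n / 2) 2))

  -- Sizes 0 and 2 are even, and at size 1 the single nonzero entry exceeds half.
  balanced∧odd⇒3≤size : ∀ {ν} → Balanced ν → IsOdd ν → 3 ≤ size ν
  balanced∧odd⇒3≤size {ν} bal odd = ℕₚ.≮⇒≥ λ s<3 → small (size ν) refl s<3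
    where
    small : ∀ n → size ν ≡ n → ¬ (n < 3)
    small 0 e _ = contradiction (trans (sym odd) (cong (_% 2) e)) λ ()
    small 1 e _ with zero⊎suc ν
    ... | inj₁ ν≡0 = contradiction (trans (sym e) (size-cong ν≡0)) λ ()
    ... | inj₂ (i , m , e′) = contradiction
      (subst₂ _≤_ (trans (cong (2 *_) e′) (ℕₚ.*-suc 2 m)) e (bal i)) λ { (s≤s ()) }
    small 2 e _ = contradiction (trans (sym odd) (cong (_% 2) e)) λ ()
    small (suc (suc (suc n))) e (s≤s (s≤s (s≤s ())))

  size≤size+dist : ∀ μ ν → size ν ≤ size μ + dist μ ν
  size≤size+dist μ ν = ℕₚ.≤-trans
    (ℕₚ.+-mono-≤ (ℕₚ.+-mono-≤ (bound 0F) (bound 1F)) (bound 2F))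
    (ℕₚ.≤-reflexive (shuffle (μ 0F) _ (μ 1F) _ (μ 2F) _))
    where
    bound : ∀ i → ν i ≤ μ i + ∣ μ i - ν i ∣
    bound i = ℕₚ.m≤n+∣n-m∣ (ν i) (μ i)
    shuffle : ∀ a b c d e f → a + b + (c + d) + (e + f) ≡ a + c + e + (b + d + f)
    shuffle = solve-∀

  -- With q = p^m, a balanced odd ν satisfies |qν| ≥ 3q, and μ differs from qν by less than q; this
  -- yields the size condition.
  goodLevel : ∀ {p μ ν} m → Balanced ν → IsOdd ν → dist μ (scale (p ^ m) ν) < p ^ m → GoodLevel p μ m
  goodLevel {p} {μ} {ν} m bal odd near = ℕₚ.+-cancelʳ-≤ q _ _ (begin
    2 * q + q                        ≡⟨ shuffle q ⟩
    q * 3                              ≤⟨ ℕₚ.*-monoʳ-≤ q (balanced∧odd⇒3≤size {ν} bal odd) ⟩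
    q * size ν                         ≡⟨ size-scale q ν ⟩
    size (scale q ν)                     ≤⟨ size≤size+dist μ (scale q ν) ⟩
    size μ + dist μ (scale q ν)        ≤⟨ ℕₚ.+-monoʳ-≤ (size μ) (ℕₚ.<⇒≤ near) ⟩
    size μ + q                         ∎) , ν , bal , odd , near
    where
    open ℕₚ.≤-Reasoning
    q = p ^ m
    shuffle : ∀ q → 2 * q + q ≡ q * 3
    shuffle = solve-∀

  dist≡0⇒≗ : ∀ μ ν → dist μ ν ≡ 0 → ∀ i → μ i ≡ ν i
  dist≡0⇒≗ μ ν e 0F = ℕₚ.∣m-n∣≡0⇒m≡n (ℕₚ.m+n≡0⇒m≡0 _ (ℕₚ.m+n≡0⇒m≡0 _ e))
  dist≡0⇒≗ μ ν e 1F = ℕₚ.∣m-n∣≡0⇒m≡n (ℕₚ.m+n≡0⇒n≡0 ∣ μ 0F - ν 0F ∣ (ℕₚ.m+n≡0⇒m≡0 _ e))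
  dist≡0⇒≗ μ ν e 2F = ℕₚ.∣m-n∣≡0⇒m≡n (ℕₚ.m+n≡0⇒n≡0 (∣ μ 0F - ν 0F ∣ + ∣ μ 1F - ν 1F ∣) e)

  scale-balanced : ∀ q {ν} → Balanced ν → Balanced (scale q ν)
  scale-balanced q {ν} bal i = subst₂ _≤_ (shuffle q (ν i)) (size-scale q ν) (ℕₚ.*-monoʳ-≤ q (bal i))
    where
    shuffle : ∀ q n → q * (2 * n) ≡ 2 * (q * n)
    shuffle = solve-∀

  centre-degree : ∀ q n {d} → d + (d + q) ≡ q * suc (2 * n) → d ≡ q * n
  centre-degree q n {d} e = ℕₚ.*-cancelˡ-≡ d _ 2 (ℕₚ.+-cancelʳ-≡ q _ _ (trans (shuffle d q) (trans e (expand q n))))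
    where
    shuffle : ∀ d q → 2 * d + q ≡ d + (d + q)
    shuffle = solve-∀
    expand : ∀ q n → q * suc (2 * n) ≡ 2 * (q * n) + q
    expand = solve-∀

  dist-chain : ∀ {q r g} μ ν ξ ζ → dist μ ν < q → q + dist ν ξ ≤ g → g + dist ξ ζ ≤ r → dist μ ζ < r
  dist-chain {q} {r} {g} μ ν ξ ζ h k l = begin-strict
    dist μ ζ                              ≤⟨ dist-triangle μ ν ζ ⟩
    dist μ ν + dist ν ζ                 <⟨ ℕₚ.+-monoˡ-< _ h ⟩
    q + dist ν ζ                        ≤⟨ ℕₚ.+-monoʳ-≤ q (dist-triangle ν ξ ζ) ⟩
    q + (dist ν ξ + dist ξ ζ)         ≡⟨ ℕₚ.+-assoc q _ _ ⟨
    q + dist ν ξ + dist ξ ζ           ≤⟨ ℕₚ.+-monoˡ-≤ _ k ⟩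
    g + dist ξ ζ                        ≤⟨ l ⟩
    r                                     ∎
    where open ℕₚ.≤-Reasoning

  squeeze : ∀ {q D g} → q + D ≤ g → g ≤ q → D ≡ 0 × g ≡ q
  squeeze {q} {D} {g} h k = ℕₚ.n≤0⇒n≡0 (ℕₚ.+-cancelˡ-≤ q D 0 (ℕₚ.≤-trans h (ℕₚ.≤-trans k (ℕₚ.≤-reflexive (sym (ℕₚ.+-identityʳ q)))))) ,
    ℕₚ.≤-antisym k (ℕₚ.≤-trans (ℕₚ.m≤m+n q D) h)

  excess-cong : ∀ {μ ν ξ : Mult} → (∀ i → μ i ≡ ν i) → excess μ ξ ≡ excess ν ξ
  excess-cong {ξ = ξ} h = size-cong (λ i → cong (ξ i ∸_) (h i))

  size-rotate : ∀ i (f : Mult) → size f ≡ f i + (f (next i) + f (next (next i)))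
  size-rotate 0F f = ℕₚ.+-assoc (f 0F) (f 1F) (f 2F)
  size-rotate 1F f = rotate (f 0F) (f 1F) (f 2F)
    where
    rotate : ∀ a b c → a + b + c ≡ b + (c + a)
    rotate = solve-∀
  size-rotate 2F f = rotate (f 0F) (f 1F) (f 2F)
    where
    rotate : ∀ a b c → a + b + c ≡ c + (a + b)
    rotate = solve-∀

  -- With q = b + x, a multiple q n at distance δ < q from q a + b is q a or q (a + 1);
  -- e is the truncated difference (q a + b) ∸ q n.
  data Digit (a b x : ℕ) : (n δ e : ℕ) → Set where
    floor : Digit a b x a b b
    ceil : Digit a b x (suc a) x 0

  -- Since 0 ≤ b < q, a multiple q n with n < a or n > a + 1 is at least q away from q a + b.
  digit : ∀ q a b n → b < q → ∣ q * n - (q * a + b) ∣ < q →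
    Digit a b (q ∸ b) n ∣ q * n - (q * a + b) ∣ ((q * a + b) ∸ q * n)
  digit q a b n b<q near with ℕₚ.<-cmp n a
  ... | tri≈ _ refl _ = subst₂ (Digit a b (q ∸ b) a) (sym (ℕₚ.∣m-m+n∣≡n (q * a) b)) (sym (ℕₚ.m+n∸m≡n (q * a) b)) floor
  ... | tri< n<a _ _ = contradiction near (ℕₚ.≤⇒≯ (begin
      q                                 ≡⟨ ℕₚ.m+n∸m≡n (q * n) q ⟨
      q * n + q ∸ q * n                 ≤⟨ ℕₚ.∸-monoˡ-≤ (q * n) (begin
        q * n + q     ≡⟨ trans (ℕₚ.+-comm (q * n) q) (sym (ℕₚ.*-suc q n)) ⟩
        q * suc n     ≤⟨ ℕₚ.*-monoʳ-≤ q n<a ⟩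
        q * a         ≤⟨ ℕₚ.m≤m+n _ b ⟩
        q * a + b     ∎) ⟩
      q * a + b ∸ q * n                 ≤⟨ ℕₚ.m∸n≤∣m-n∣ (q * a + b) (q * n) ⟩
      ∣ q * a + b - q * n ∣             ≡⟨ ℕₚ.∣-∣-comm (q * a + b) (q * n) ⟩
      ∣ q * n - (q * a + b) ∣           ∎))
    where open ℕₚ.≤-Reasoning
  ... | tri> _ _ a<n with ℕₚ.m≤n⇒m<n∨m≡n a<n
  ... | inj₂ refl = subst₂ (Digit a b (q ∸ b) (suc a)) (sym distance) (sym excess≡0) ceil
    where
    q[1+a]≡qa+q : q * suc a ≡ q * a + q
    q[1+a]≡qa+q = trans (ℕₚ.*-suc q a) (ℕₚ.+-comm q (q * a))
    distance : ∣ q * suc a - (q * a + b) ∣ ≡ q ∸ b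
    distance = trans (cong (λ n → ∣ n - (q * a + b) ∣) q[1+a]≡qa+q)
      (trans (ℕₚ.∣m+n-m+o∣≡∣n-o∣ (q * a) q b) (ℕₚ.m≤n⇒∣n-m∣≡n∸m (ℕₚ.<⇒≤ b<q)))
    excess≡0 : q * a + b ∸ q * suc a ≡ 0
    excess≡0 = ℕₚ.m≤n⇒m∸n≡0 (subst (q * a + b ≤_) (sym q[1+a]≡qa+q) (ℕₚ.+-monoʳ-≤ (q * a) (ℕₚ.<⇒≤ b<q)))
  ... | inj₁ 1+a<n = contradiction near (ℕₚ.≤⇒≯ (begin
      q                                      ≡⟨ ℕₚ.m+n∸m≡n (q * a + b) q ⟨
      q * a + b + q ∸ (q * a + b)            ≤⟨ ℕₚ.∸-monoˡ-≤ (q * a + b) (begin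
        q * a + b + q      ≤⟨ ℕₚ.+-monoˡ-≤ q (ℕₚ.+-monoʳ-≤ (q * a) (ℕₚ.<⇒≤ b<q)) ⟩
        q * a + q + q      ≡⟨ two-more q a ⟩
        q * suc (suc a)    ≤⟨ ℕₚ.*-monoʳ-≤ q 1+a<n ⟩
        q * n              ∎) ⟩
      q * n ∸ (q * a + b)                    ≤⟨ ℕₚ.m∸n≤∣m-n∣ (q * n) (q * a + b) ⟩
      ∣ q * n - (q * a + b) ∣                ∎))
    where
    open ℕₚ.≤-Reasoning
    two-more : ∀ q a → q * a + q + q ≡ q * suc (suc a)
    two-more = solve-∀

  <2*⇒< : ∀ {a s} → a + s < 2 * a → s < a
  <2*⇒< {a} {s} h = ℕₚ.+-cancelˡ-< a s a (subst (a + s <_) (cong (a +_) (ℕₚ.+-identityʳ a)) h)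

  -- In the applications, b + x = b′ + x′ = b″ + x″ = q.
  clash₁ : ∀ {b b′ b″ x′} → b′ + b″ < b → b + (x′ + b″) < b′ + x′ → ⊥
  clash₁ {b} {b′} {b″} {x′} h k = ℕₚ.<-irrefl refl (begin-strict
    b + (x′ + b″)     <⟨ k ⟩
    b′ + x′           ≤⟨ ℕₚ.+-monoˡ-≤ x′ (ℕₚ.m≤m+n b′ b″) ⟩
    b′ + b″ + x′      <⟨ ℕₚ.+-monoˡ-< x′ h ⟩
    b + x′            ≤⟨ ℕₚ.+-monoʳ-≤ b (ℕₚ.m≤m+n x′ b″) ⟩
    b + (x′ + b″)     ∎)
    where open ℕₚ.≤-Reasoning

  clash₂ : ∀ {b b′ b″ x″} → b′ + b″ < b → b + (b′ + x″) < b″ + x″ → ⊥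
  clash₂ {b} {b′} {b″} {x″} h k = clash₁ {b} {b″} {b′} {x″} (subst (_< b) (ℕₚ.+-comm b′ b″) h)
    (subst (_< b″ + x″) (cong (b +_) (ℕₚ.+-comm b′ x″)) k)

  -- The distance bound gives x′ + x″ < q, hence b′ + b″ > q ≥ b.
  clash₃ : ∀ {q b b′ b″ x′ x″ y} → b′ + x′ ≡ q → b″ + x″ ≡ q → b ≤ q → b′ + b″ < b → y + (x′ + x″) < q → ⊥
  clash₃ {q} {b} {b′} {b″} {x′} {x″} {y} e e′ b≤q h k = ℕₚ.<-irrefl refl (begin-strict
    q + q                       ≡⟨ cong₂ _+_ e e′ ⟨
    b′ + x′ + (b″ + x″)         ≡⟨ shuffle b′ x′ b″ x″ ⟩
    b′ + b″ + (x′ + x″)         <⟨ ℕₚ.+-mono-< (ℕₚ.<-≤-trans h b≤q) (ℕₚ.≤-<-trans (ℕₚ.m≤n+m (x′ + x″) y) k) ⟩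
    q + q                       ∎)
    where
    open ℕₚ.≤-Reasoning
    shuffle : ∀ a b c d → a + b + (c + d) ≡ a + c + (b + d)
    shuffle = solve-∀

  -- Rules out a digit sum above 2q: both b and s are at most q.
  clash₄ : ∀ {q} b x s → b + x ≡ q → x + s < q → b + s ≤ 2 * q
  clash₄ {q} b x s e h = begin
    b + s       ≤⟨ ℕₚ.+-mono-≤ b≤q (ℕₚ.<⇒≤ (ℕₚ.≤-<-trans (ℕₚ.m≤n+m s x) h)) ⟩
    q + q       ≡⟨ cong (q +_) (ℕₚ.+-identityʳ q) ⟨
    2 * q       ∎
    where
    open ℕₚ.≤-Reasoning
    b≤q : b ≤ q
    b≤q = subst (b ≤_) e (ℕₚ.m≤m+n b x)

  -- For a centre qν with |ν| = 2n + 1, e is the excess of μ over it and δ the distance. Then q n +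
  -- e is the low degree and q - δ the gap; D, E, Δ are the closed forms to be matched.
  record Answer (q n e δ D E Δ : ℕ) : Set where
    constructor answer
    field
      low : e + q * n ≡ D
      gap : q ∸ δ ≡ Δ
      high : D + Δ ≡ E

  1+2*-injective : ∀ {m n} → suc (2 * m) ≡ suc (2 * n) → m ≡ n
  1+2*-injective e = ℕₚ.*-cancelˡ-≡ _ _ 2 (ℕₚ.suc-injective e)

  3+2*-injective : ∀ m {n} → 3 + 2 * m ≡ suc (2 * n) → suc m ≡ n
  3+2*-injective m e = 1+2*-injective (trans (cong suc (ℕₚ.*-suc 2 m)) e)

  2+2*≢odd : ∀ m n → 2 + 2 * m ≡ suc (2 * n) → ⊥
  2+2*≢odd m n e = ℕₚ.even≢odd (suc m) n (trans (ℕₚ.*-suc 2 m) e)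

  4+2*≢odd : ∀ m n → 4 + 2 * m ≡ suc (2 * n) → ⊥
  4+2*≢odd m n e = 2+2*≢odd (suc m) n (trans (cong (2 +_) (ℕₚ.*-suc 2 m)) e)

  -- The parity of |ν| - |α| is that of the number of `ceil` digits, which leaves four of the eight
  -- patterns. The inequality on b or x and the distance bound together exclude three of these. The
  -- odd cases mirror the even ones, with b and x, and hence `floor` and `ceil`, exchanged.
  module Cases {q a a′ a″ b b′ b″ x x′ x″ n : ℕ} (q≡ : b + x ≡ q) (q≡′ : b′ + x′ ≡ q) (q≡″ : b″ + x″ ≡ q) where

    private
      carry : ∀ c c′ c″ {s} → a + (a′ + a″) ≡ s → (c + a) + ((c′ + a′) + (c″ + a″)) ≡ suc (2 * n) →
        c + c′ + c″ + s ≡ suc (2 * n)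
      carry c c′ c″ refl e = trans (shuffle c c′ c″ a a′ a″) e
        where
        shuffle : ∀ c c′ c″ a a′ a″ → c + c′ + c″ + (a + (a′ + a″)) ≡ (c + a) + ((c′ + a′) + (c″ + a″))
        shuffle = solve-∀

      b≤q : b ≤ q
      b≤q = subst (b ≤_) q≡ (ℕₚ.m≤m+n b x)
      x≤q : x ≤ q
      x≤q = subst (x ≤_) q≡ (ℕₚ.m≤n+m x b)
      x+b : x + b ≡ q
      x+b = trans (ℕₚ.+-comm x b) q≡
      x′+b′ : x′ + b′ ≡ q
      x′+b′ = trans (ℕₚ.+-comm x′ b′) q≡′
      x″+b″ : x″ + b″ ≡ q
      x″+b″ = trans (ℕₚ.+-comm x″ b″) q≡″

      left-comm : ∀ a b c → a + (b + c) ≡ b + (a + c)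
      left-comm = solve-∀
      last-first : ∀ a b c → a + (b + c) ≡ c + (a + b)
      last-first = solve-∀

    even-one : ∀ {m ν ν′ ν″ δ δ′ δ″ e e′ e″} → a + (a′ + a″) ≡ 2 * m →
      Digit a b x ν δ e → Digit a′ b′ x′ ν′ δ′ e′ → Digit a″ b″ x″ ν″ δ″ e″ →
      ν + (ν′ + ν″) ≡ suc (2 * n) → δ + (δ′ + δ″) < q → b + (b′ + b″) < 2 * b →
      Answer q n (e + (e′ + e″)) (δ + (δ′ + δ″)) (m * q + (b′ + b″)) (m * q + b) (b ∸ b′ ∸ b″)
    even-one {m} even ceil floor floor odd near h = answer
      (trans (cong (b′ + b″ +_) (trans (ℕₚ.*-comm q n) (cong (_* q) (sym m≡n)))) (ℕₚ.+-comm (b′ + b″) (m * q)))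
      (trans (cong (_∸ (x + (b′ + b″))) (sym x+b)) (trans (ℕₚ.[m+n]∸[m+o]≡n∸o x b (b′ + b″)) (sym (ℕₚ.∸-+-assoc b b′ b″))))
      (trans (ℕₚ.+-assoc (m * q) _ _) (cong (m * q +_)
        (trans (cong (b′ + b″ +_) (ℕₚ.∸-+-assoc b b′ b″)) (ℕₚ.m+[n∸m]≡n (ℕₚ.<⇒≤ (<2*⇒< h))))))
      where
      m≡n : m ≡ n
      m≡n = 1+2*-injective (carry 1 0 0 even odd)
    even-one even floor ceil floor odd near h =
      ⊥-elim (clash₁ {b} {b′} {b″} {x′} (<2*⇒< h) (subst (b + (x′ + b″) <_) (sym q≡′) near))
    even-one even floor floor ceil odd near h =
      ⊥-elim (clash₂ {b} {b′} {b″} {x″} (<2*⇒< h) (subst (b + (b′ + x″) <_) (sym q≡″) near))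
    even-one even ceil ceil ceil odd near h =
      ⊥-elim (clash₃ {b = b} {b′} {b″} {x′} {x″} {x} q≡′ q≡″ b≤q (<2*⇒< h) near)
    even-one {m} even floor floor floor odd near h = ⊥-elim (ℕₚ.even≢odd m n (carry 0 0 0 even odd))
    even-one {m} even ceil ceil floor odd near h = ⊥-elim (2+2*≢odd m n (carry 1 1 0 even odd))
    even-one {m} even ceil floor ceil odd near h = ⊥-elim (2+2*≢odd m n (carry 1 0 1 even odd))
    even-one {m} even floor ceil ceil odd near h = ⊥-elim (2+2*≢odd m n (carry 0 1 1 even odd))

    even-all : ∀ {m ν ν′ ν″ δ δ′ δ″ e e′ e″} → a + (a′ + a″) ≡ 2 * m →
      Digit a b x ν δ e → Digit a′ b′ x′ ν′ δ′ e′ → Digit a″ b″ x″ ν″ δ″ e″ →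
      ν + (ν′ + ν″) ≡ suc (2 * n) → δ + (δ′ + δ″) < q → 2 * q < b + (b′ + b″) →
      Answer q n (e + (e′ + e″)) (δ + (δ′ + δ″)) (m * q + q) (m * q + (b + (b′ + b″) ∸ q)) (b + (b′ + b″) ∸ 2 * q)
    even-all {m} even ceil ceil ceil odd near h = answer
      (trans (cong (q *_) (sym 1+m≡n)) (trans (ℕₚ.*-comm q (suc m)) (ℕₚ.+-comm q (m * q))))
      (sym (trans (cong (_∸ 2 * q) Σb≡) (ℕₚ.m+n∸m≡n (2 * q) _)))
      (trans (ℕₚ.+-assoc (m * q) q _) (cong (m * q +_) (trans
        (cong (q +_) (trans (cong (λ r → Σb ∸ (q + r)) (ℕₚ.+-identityʳ q)) (sym (ℕₚ.∸-+-assoc Σb q q))))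
        (ℕₚ.m+[n∸m]≡n (ℕₚ.m+n≤o⇒m≤o∸n q (subst (_≤ Σb) (cong (q +_) (ℕₚ.+-identityʳ q)) (ℕₚ.<⇒≤ h)))))))
      where
      Σb = b + (b′ + b″)
      Σx = x + (x′ + x″)
      1+m≡n : suc m ≡ n
      1+m≡n = 3+2*-injective m (carry 1 1 1 even odd)
      shuffle : ∀ b b′ b″ x x′ x″ → b + (b′ + b″) + (x + (x′ + x″)) ≡ (b + x) + ((b′ + x′) + (b″ + x″))
      shuffle = solve-∀
      triple : ∀ q → q + (q + q) ≡ 2 * q + q
      triple = solve-∀
      -- Σb + Σx = 3q, so the part of Σb above 2q is the gap q - Σx.
      Σb≡ : Σb ≡ 2 * q + (q ∸ Σx)
      Σb≡ = ℕₚ.+-cancelʳ-≡ Σx _ _ (trans (trans (shuffle b b′ b″ x x′ x″) (trans (cong₂ _+_ q≡ (cong₂ _+_ q≡′ q≡″)) (triple q)))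
        (sym (trans (ℕₚ.+-assoc (2 * q) _ Σx) (cong (2 * q +_) (ℕₚ.m∸n+n≡m (ℕₚ.<⇒≤ near))))))
    even-all even ceil floor floor odd near h = contradiction (clash₄ b x (b′ + b″) q≡ near) (ℕₚ.<⇒≱ h)
    even-all even floor ceil floor odd near h = contradiction
      (subst (_≤ 2 * q) (left-comm b′ b b″) (clash₄ b′ x′ (b + b″) q≡′ (subst (_< q) (left-comm b x′ b″) near))) (ℕₚ.<⇒≱ h)
    even-all even floor floor ceil odd near h = contradiction
      (subst (_≤ 2 * q) (sym (last-first b b′ b″)) (clash₄ b″ x″ (b + b′) q≡″ (subst (_< q) (last-first b b′ x″) near))) (ℕₚ.<⇒≱ h)
    even-all {m} even floor floor floor odd near h = ⊥-elim (ℕₚ.even≢odd m n (carry 0 0 0 even odd))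
    even-all {m} even ceil ceil floor odd near h = ⊥-elim (2+2*≢odd m n (carry 1 1 0 even odd))
    even-all {m} even ceil floor ceil odd near h = ⊥-elim (2+2*≢odd m n (carry 1 0 1 even odd))
    even-all {m} even floor ceil ceil odd near h = ⊥-elim (2+2*≢odd m n (carry 0 1 1 even odd))

    odd-one : ∀ {m ν ν′ ν″ δ δ′ δ″ e e′ e″} → a + (a′ + a″) ≡ suc (2 * m) →
      Digit a b x ν δ e → Digit a′ b′ x′ ν′ δ′ e′ → Digit a″ b″ x″ ν″ δ″ e″ →
      ν + (ν′ + ν″) ≡ suc (2 * n) → δ + (δ′ + δ″) < q → x + (x′ + x″) < 2 * x →
      Answer q n (e + (e′ + e″)) (δ + (δ′ + δ″)) (suc m * q + b) (m * q + (b′ + b″)) (b′ + b″ ∸ b ∸ q)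
    odd-one {m} odd-a floor ceil ceil odd near h = answer
      (trans (cong₂ _+_ (ℕₚ.+-identityʳ b) (trans (ℕₚ.*-comm q n) (cong (_* q) (sym 1+m≡n)))) (ℕₚ.+-comm b (suc m * q)))
      (sym Δ≡)
      (trans (cong (suc m * q + b +_) Δ≡) (trans (regroup m q b _) (cong (m * q +_) (sym Σ≡))))
      where
      1+m≡n : suc m ≡ n
      1+m≡n = 3+2*-injective m (carry 0 1 1 odd-a odd)
      g = q ∸ (b + (x′ + x″))
      shuffle : ∀ b b′ b″ x′ x″ → b′ + b″ + (b + (x′ + x″)) ≡ (b′ + x′) + (b″ + x″) + b
      shuffle = solve-∀
      shuffle′ : ∀ q b g s → b + q + g + s ≡ q + (g + s) + b
      shuffle′ = solve-∀
      regroup : ∀ m q b g → suc m * q + b + g ≡ m * q + (b + q + g)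
      regroup = solve-∀
      -- As b′ + x′ = b″ + x″ = q, the sum b′ + b″ = 2q - x′ - x″ exceeds b + q by exactly the gap
      -- g.
      Σ≡ : b′ + b″ ≡ b + q + g
      Σ≡ = ℕₚ.+-cancelʳ-≡ (b + (x′ + x″)) _ _ (trans (trans (shuffle b b′ b″ x′ x″) (cong (_+ b) (cong₂ _+_ q≡′ q≡″)))
        (sym (trans (shuffle′ q b g (b + (x′ + x″))) (cong (λ r → q + r + b) (ℕₚ.m∸n+n≡m (ℕₚ.<⇒≤ near))))))
      Δ≡ : b′ + b″ ∸ b ∸ q ≡ g
      Δ≡ = trans (ℕₚ.∸-+-assoc (b′ + b″) b q) (trans (cong (_∸ (b + q)) Σ≡) (ℕₚ.m+n∸m≡n (b + q) g))
    odd-one odd-a ceil ceil floor odd near h =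
      ⊥-elim (clash₂ {x} {x′} {x″} {b″} (<2*⇒< h) (subst (x + (x′ + b″) <_) (sym x″+b″) near))
    odd-one odd-a ceil floor ceil odd near h =
      ⊥-elim (clash₁ {x} {x′} {x″} {b′} (<2*⇒< h) (subst (x + (b′ + x″) <_) (sym x′+b′) near))
    odd-one odd-a floor floor floor odd near h =
      ⊥-elim (clash₃ {b = x} {x′} {x″} {b′} {b″} {b} x′+b′ x″+b″ x≤q (<2*⇒< h) near)
    odd-one {m} odd-a ceil floor floor odd near h = ⊥-elim (2+2*≢odd m n (carry 1 0 0 odd-a odd))
    odd-one {m} odd-a floor ceil floor odd near h = ⊥-elim (2+2*≢odd m n (carry 0 1 0 odd-a odd))
    odd-one {m} odd-a floor floor ceil odd near h = ⊥-elim (2+2*≢odd m n (carry 0 0 1 odd-a odd))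
    odd-one {m} odd-a ceil ceil ceil odd near h = ⊥-elim (4+2*≢odd m n (carry 1 1 1 odd-a odd))

    odd-all : ∀ {m ν ν′ ν″ δ δ′ δ″ e e′ e″} → a + (a′ + a″) ≡ suc (2 * m) →
      Digit a b x ν δ e → Digit a′ b′ x′ ν′ δ′ e′ → Digit a″ b″ x″ ν″ δ″ e″ →
      ν + (ν′ + ν″) ≡ suc (2 * n) → δ + (δ′ + δ″) < q → 2 * q < x + (x′ + x″) →
      Answer q n (e + (e′ + e″)) (δ + (δ′ + δ″)) (m * q + (b + (b′ + b″))) (suc m * q) (q ∸ (b + (b′ + b″)))
    odd-all {m} odd-a floor floor floor odd near h = answer
      (trans (cong (b + (b′ + b″) +_) (trans (ℕₚ.*-comm q n) (cong (_* q) (sym m≡n)))) (ℕₚ.+-comm _ (m * q)))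
      refl
      (trans (ℕₚ.+-assoc (m * q) _ _) (trans (cong (m * q +_) (ℕₚ.m+[n∸m]≡n (ℕₚ.<⇒≤ near))) (ℕₚ.+-comm (m * q) q)))
      where
      m≡n : m ≡ n
      m≡n = 1+2*-injective (carry 0 0 0 odd-a odd)
    odd-all odd-a floor ceil ceil odd near h = contradiction (clash₄ x b (x′ + x″) x+b near) (ℕₚ.<⇒≱ h)
    odd-all odd-a ceil floor ceil odd near h = contradiction
      (subst (_≤ 2 * q) (left-comm x′ x x″) (clash₄ x′ b′ (x + x″) x′+b′ (subst (_< q) (left-comm x b′ x″) near))) (ℕₚ.<⇒≱ h)
    odd-all odd-a ceil ceil floor odd near h = contradiction
      (subst (_≤ 2 * q) (sym (last-first x x′ x″)) (clash₄ x″ b″ (x + x′) x″+b″ (subst (_< q) (last-first x x′ b″) near))) (ℕₚ.<⇒≱ h)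
    odd-all {m} odd-a ceil floor floor odd near h = ⊥-elim (2+2*≢odd m n (carry 1 0 0 odd-a odd))
    odd-all {m} odd-a floor ceil floor odd near h = ⊥-elim (2+2*≢odd m n (carry 0 1 0 odd-a odd))
    odd-all {m} odd-a floor floor ceil odd near h = ⊥-elim (2+2*≢odd m n (carry 0 0 1 odd-a odd))
    odd-all {m} odd-a ceil ceil ceil odd near h = ⊥-elim (4+2*≢odd m n (carry 1 1 1 odd-a odd))

open Arithmetic

-- Derivations and the interface to the polynomial ring.

record Derivation (R : CommutativeRing 0ℓ 0ℓ) : Set where
  open CommutativeRing R
  field
    ∂ : Carrier → Carrier
    ∂-cong : ∀ {P Q} → P ≈ Q → ∂ P ≈ ∂ Q
    ∂-+ : ∀ P Q → ∂ (P + Q) ≈ ∂ P + ∂ Q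
    ∂-* : ∀ P Q → ∂ (P * Q) ≈ ∂ P * Q + P * ∂ Q

-- The part of the structure of F_p[x,y] on which the theorem depends.
-- `part n` is the homogeneous component of degree n, `Fr` the substitution x ↦ x^p, y ↦ y^p,
-- and `π` its left inverse, which drops all monomials that are not p-th powers.
record Frame (p : ℕ) : Set₁ where
  field
    R : CommutativeRing 0ℓ 0ℓ
  open CommutativeRing R public
  open Algebra.Properties.Semiring.Mult semiring public using () renaming (_×_ to _·_)
  open Algebra.Properties.Semiring.Exp semiring public using (_^_)

  _∣_ : Carrier → Carrier → Set
  P ∣ Q = ∃ λ A → Q ≈ P * A

  field
    X Y : Carrier
    part : ℕ → Carrier → Carrier

  Hom : ℕ → Carrier → Set
  Hom d P = part d P ≈ P

  field
    char⇒ : p · 1# ≈ 0#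
    char⇐ : ∀ n → n · 1# ≈ 0# → p ℕᵈ.∣ n
    constant : ∀ {u} → Hom 0 u → u ≈ 0# ⊎ ∃ λ v → Hom 0 v × v * u ≈ 1#

    part-cong : ∀ n {P Q} → P ≈ Q → part n P ≈ part n Q
    part-+ : ∀ n P Q → part n (P + Q) ≈ part n P + part n Q
    part-* : ∀ d e P Q → part (d ℕ.+ e) (part d P * Q) ≈ part d P * part e Q
    part-*-< : ∀ {n d} → n ℕ.< d → ∀ P Q → part n (part d P * Q) ≈ 0#
    part-part : ∀ n P → part n (part n P) ≈ part n P
    Hom-1 : Hom 0 1#
    Hom-X : Hom 1 X
    Hom-Y : Hom 1 Y

    X-cancel : ∀ {P} → X * P ≈ 0# → P ≈ 0#
    Y-cancel : ∀ {P} → Y * P ≈ 0# → P ≈ 0#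
    X+Y-cancel : ∀ {P} → (X + Y) * P ≈ 0# → P ≈ 0#
    X∣Y* : ∀ {P} → X ∣ (Y * P) → X ∣ P
    Y∣X* : ∀ {P} → Y ∣ (X * P) → Y ∣ P
    modX : ∀ {d P} → Hom d P → ∃ λ u → Hom 0 u × X ∣ (P - u * Y ^ d)
    modY : ∀ {d P} → Hom d P → ∃ λ u → Hom 0 u × Y ∣ (P - u * X ^ d)

    derivX derivY : Derivation R
  open Derivation derivX public using () renaming (∂ to ∂x)
  open Derivation derivY public using () renaming (∂ to ∂y)
  field
    ∂x-X : ∂x X ≈ 1#
    ∂x-Y : ∂x Y ≈ 0#
    ∂y-X : ∂y X ≈ 0#
    ∂y-Y : ∂y Y ≈ 1#
    part-∂x : ∀ n P → part n (∂x P) ≈ ∂x (part (suc n) P)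
    part-∂y : ∀ n P → part n (∂y P) ≈ ∂y (part (suc n) P)
    euler : ∀ {d P} → Hom d P → X * ∂x P + Y * ∂y P ≈ d · P

    Fr π : Carrier → Carrier
    Fr-cong : ∀ {P Q} → P ≈ Q → Fr P ≈ Fr Q
    Fr-+ : ∀ P Q → Fr (P + Q) ≈ Fr P + Fr Q
    Fr-* : ∀ P Q → Fr (P * Q) ≈ Fr P * Fr Q
    Fr-1 : Fr 1# ≈ 1#
    Fr-X : Fr X ≈ X ^ p
    Fr-Y : Fr Y ≈ Y ^ p
    Fr-Hom : ∀ {d P} → Hom d P → Hom (p ℕ.* d) (Fr P)
    π-cong : ∀ {P Q} → P ≈ Q → π P ≈ π Q
    π-+ : ∀ P Q → π (P + Q) ≈ π P + π Q
    π-Fr : ∀ P Q → π (Fr P * Q) ≈ P * π Q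
    π-Hom : ∀ {d P} → Hom (p ℕ.* d) P → Hom d (π P)
    π-injective : ∀ {P} → ∂x P ≈ 0# → ∂y P ≈ 0# → π P ≈ 0# → P ≈ 0#

-- The element u m^d to which a form of degree d reduces modulo the linear form α i is
-- written with m = α (aux i).
aux : Fin 3 → Fin 3
aux 0F = 1F
aux 1F = 0F
aux 2F = 1F

-- Bases, peaks and gap bounds over the abstract ring.

module Theory (p : ℕ) (p-prime : Prime p) (𝔽 : Frame p) where
  open Frame 𝔽
  open IntegerSolver R
  open Algebra.Properties.Ring ring using (-‿distribˡ-*; -‿distribʳ-*; -0#≈0#)
  open Algebra.Properties.Semiring.Exp semiring using (^-homo-*; ^-congˡ; ^-congʳ; ^-assocʳ)
  open Algebra.Properties.Semiring.Mult semiring using (×-assoc-*; ×-congʳ)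
  open Relation.Binary.Reasoning.Setoid setoid

  x-y≈0⇒x≈y : ∀ {P Q} → P - Q ≈ 0# → P ≈ Q
  x-y≈0⇒x≈y {P} {Q} h = begin
    P            ≈⟨ solve 2 (λ P Q → P := (P :- Q) :+ Q) refl P Q ⟩
    (P - Q) + Q  ≈⟨ +-congʳ h ⟩
    0# + Q       ≈⟨ +-identityˡ Q ⟩
    Q            ∎

  x≈y⇒x-y≈0 : ∀ {P Q} → P ≈ Q → P - Q ≈ 0#
  x≈y⇒x-y≈0 {P} {Q} h = trans (+-congʳ h) (-‿inverseʳ Q)

  -- Divisibility

  ∣-resp : ∀ {M P Q} → P ≈ Q → M ∣ P → M ∣ Q
  ∣-resp P≈Q (A , h) = A , trans (sym P≈Q) h

  ∣-+ : ∀ {M P Q} → M ∣ P → M ∣ Q → M ∣ (P + Q)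
  ∣-+ (A , h) (B , k) = A + B , trans (+-cong h k) (sym (distribˡ _ A B))

  ∣-neg : ∀ {M P} → M ∣ P → M ∣ (- P)
  ∣-neg (A , h) = - A , trans (-‿cong h) (-‿distribʳ-* _ A)

  ∣-- : ∀ {M P Q} → M ∣ P → M ∣ Q → M ∣ (P - Q)
  ∣-- h k = ∣-+ h (∣-neg k)

  ∣-*ˡ : ∀ {M P} Q → M ∣ P → M ∣ (Q * P)
  ∣-*ˡ {M} {P} Q (A , h) = Q * A , trans (*-congˡ h) (solve 3 (λ Q M A → Q :* (M :* A) := M :* (Q :* A)) refl Q M A)

  ∣-*ʳ : ∀ {M P} Q → M ∣ P → M ∣ (P * Q)
  ∣-*ʳ {M} {P} Q (A , h) = A * Q , trans (*-congʳ h) (*-assoc M A Q)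

  ∣-refl : ∀ {M} → M ∣ M
  ∣-refl {M} = 1# , sym (*-identityʳ M)

  ∣-zero : ∀ {M P} → P ≈ 0# → M ∣ P
  ∣-zero {M} h = 0# , trans h (sym (zeroʳ M))

  1∣ : ∀ P → 1# ∣ P
  1∣ P = P , sym (*-identityˡ P)

  ∣-trans : ∀ {L M P} → L ∣ M → M ∣ P → L ∣ P
  ∣-trans {L} (A , h) (B , k) = A * B , trans k (trans (*-congʳ h) (*-assoc L A B))

  -- Homogeneous elements

  part-0 : ∀ n → part n 0# ≈ 0#
  part-0 n = begin
    part n 0#                              ≈⟨ solve 1 (λ z → z := (z :+ z) :- z) refl _ ⟩
    (part n 0# + part n 0#) - part n 0#    ≈⟨ +-congʳ (sym (part-+ n 0# 0#)) ⟩
    part n (0# + 0#) - part n 0#           ≈⟨ +-congʳ (part-cong n (+-identityˡ 0#)) ⟩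
    part n 0# - part n 0#                  ≈⟨ -‿inverseʳ _ ⟩
    0#                                     ∎

  Hom-resp : ∀ {d P Q} → P ≈ Q → Hom d P → Hom d Q
  Hom-resp {d} P≈Q h = trans (part-cong d (sym P≈Q)) (trans h P≈Q)

  Hom-0 : ∀ d → Hom d 0#
  Hom-0 = part-0

  Hom-+ : ∀ {d P Q} → Hom d P → Hom d Q → Hom d (P + Q)
  Hom-+ h k = trans (part-+ _ _ _) (+-cong h k)

  Hom-neg : ∀ {d P} → Hom d P → Hom d (- P)
  Hom-neg {d} {P} h = begin
    part d (- P)                           ≈⟨ solve 2 (λ a b → a := (a :+ b) :- b) refl _ (part d P) ⟩
    (part d (- P) + part d P) - part d P   ≈⟨ +-congʳ (sym (part-+ d (- P) P)) ⟩
    part d (- P + P) - part d P            ≈⟨ +-cong (part-cong d (-‿inverseˡ P)) (-‿cong h) ⟩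
    part d 0# - P                          ≈⟨ +-congʳ (part-0 d) ⟩
    0# - P                                 ≈⟨ +-identityˡ _ ⟩
    - P                                    ∎

  Hom-- : ∀ {d P Q} → Hom d P → Hom d Q → Hom d (P - Q)
  Hom-- h k = Hom-+ h (Hom-neg k)

  Hom-* : ∀ {d e P Q} → Hom d P → Hom e Q → Hom (d ℕ.+ e) (P * Q)
  Hom-* {d} {e} {P} {Q} h k = begin
    part (d ℕ.+ e) (P * Q)           ≈⟨ part-cong _ (*-congʳ (sym h)) ⟩
    part (d ℕ.+ e) (part d P * Q)    ≈⟨ part-* d e P Q ⟩
    part d P * part e Q              ≈⟨ *-cong h k ⟩
    P * Q                            ∎

  Hom-≡ : ∀ {d e P} → d ≡ e → Hom d P → Hom e P
  Hom-≡ ≡.refl h = h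

  Hom-^ : ∀ {P} → Hom 1 P → ∀ n → Hom n (P ^ n)
  Hom-^ h zero = Hom-1
  Hom-^ h (suc n) = Hom-* h (Hom-^ h n)

  Hom-· : ∀ n → Hom 0 (n · 1#)
  Hom-· zero = Hom-0 0
  Hom-· (suc n) = Hom-+ Hom-1 (Hom-· n)

  -- A multiple of a form of degree d has no component below degree d. Most degree arguments end
  -- here.
  vanish : ∀ {n d M P} → Hom d M → Hom n P → n ℕ.< d → M ∣ P → P ≈ 0#
  vanish {n} {d} {M} {P} homM homP n<d (A , h) = begin
    P                      ≈⟨ homP ⟨
    part n P               ≈⟨ part-cong n (trans h (*-congʳ (sym homM))) ⟩
    part n (part d M * A)  ≈⟨ part-*-< n<d M A ⟩
    0#                     ∎

  -- The given cofactor may be inhomogeneous; its component of degree e already works.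
  quotient : ∀ {d e M P} → Hom d M → Hom (d ℕ.+ e) P → M ∣ P → ∃ λ A → Hom e A × P ≈ M * A
  quotient {d} {e} {M} {P} homM homP (A , h) = part e A , part-part e A , (begin
    P                              ≈⟨ homP ⟨
    part (d ℕ.+ e) P               ≈⟨ part-cong _ (trans h (*-congʳ (sym homM))) ⟩
    part (d ℕ.+ e) (part d M * A)  ≈⟨ part-* d e M A ⟩
    part d M * part e A            ≈⟨ *-congʳ homM ⟩
    M * part e A                   ∎)

  1≉0 : ¬ (1# ≈ 0#)
  1≉0 h = ℕₚ.<⇒≱ (ℕ.nonTrivial⇒n>1 p {{prime⇒nonTrivial p-prime}})
    (ℕᵈ.∣⇒≤ (char⇐ 1 (trans (+-identityʳ 1#) h)))

  -- The three linear forms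

  α : Fin 3 → Carrier
  α 0F = X
  α 1F = Y
  α 2F = X + Y

  Hom-α : ∀ i → Hom 1 (α i)
  Hom-α 0F = Hom-X
  Hom-α 1F = Hom-Y
  Hom-α 2F = Hom-+ Hom-X Hom-Y

  α-cancel₀ : ∀ i {P} → α i * P ≈ 0# → P ≈ 0#
  α-cancel₀ 0F = X-cancel
  α-cancel₀ 1F = Y-cancel
  α-cancel₀ 2F = X+Y-cancel

  -- Cancellation is performed for products of the three linear forms, so regularity is tracked
  -- element by element.
  Regular : Carrier → Set
  Regular M = ∀ {P} → M * P ≈ 0# → P ≈ 0#

  Regular-1 : Regular 1#
  Regular-1 h = trans (sym (*-identityˡ _)) h

  Regular-* : ∀ {M N} → Regular M → Regular N → Regular (M * N)
  Regular-* regM regN h = regN (regM (trans (sym (*-assoc _ _ _)) h))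

  Regular-^ : ∀ {M} → Regular M → ∀ n → Regular (M ^ n)
  Regular-^ regM zero = Regular-1
  Regular-^ regM (suc n) = Regular-* regM (Regular-^ regM n)

  cancel : ∀ {M P Q} → Regular M → M * P ≈ M * Q → P ≈ Q
  cancel {M} {P} {Q} reg h = x-y≈0⇒x≈y (reg (trans
    (solve 3 (λ M P Q → M :* (P :- Q) := M :* P :- M :* Q) refl M P Q) (x≈y⇒x-y≈0 h)))

  α∣aux* : ∀ i {P} → α i ∣ (α (aux i) * P) → α i ∣ P
  α∣aux* 0F = X∣Y*
  α∣aux* 1F = Y∣X*
  -- From Y P = (X + Y) A one gets X A = Y (P - A); hence Y divides A and can be cancelled.
  α∣aux* 2F {P} (A , h) with Y∣X* {A} (P - A , (begin
      X * A                ≈⟨ solve 3 (λ X Y A → X :* A := (X :+ Y) :* A :- Y :* A) refl X Y A ⟩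
      (X + Y) * A - Y * A  ≈⟨ +-congʳ (sym h) ⟩
      Y * P - Y * A        ≈⟨ solve 3 (λ Y P A → Y :* P :- Y :* A := Y :* (P :- A)) refl Y P A ⟩
      Y * (P - A)          ∎))
  ... | B , A≈YB = B , cancel Y-cancel (begin
      Y * P                ≈⟨ h ⟩
      (X + Y) * A          ≈⟨ *-congˡ A≈YB ⟩
      (X + Y) * (Y * B)    ≈⟨ solve 3 (λ X Y B → (X :+ Y) :* (Y :* B) := Y :* ((X :+ Y) :* B)) refl X Y B ⟩
      Y * ((X + Y) * B)    ∎)

  α∣aux^* : ∀ i n {P} → α i ∣ (α (aux i) ^ n * P) → α i ∣ P
  α∣aux^* i zero h = ∣-resp (*-identityˡ _) h
  α∣aux^* i (suc n) h = α∣aux^* i n (α∣aux* i (∣-resp (*-assoc _ _ _) h))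

  -- Modulo a linear form one variable m is left, and a form of degree d becomes u m^d. For x + y
  -- the residue is found by induction on d: split off the term in y^d, then replace one factor x by
  -- -y.
  mod-α : ∀ i d {P} → Hom d P → ∃ λ u → Hom 0 u × α i ∣ (P - u * α (aux i) ^ d)
  mod-α 0F d = modX
  mod-α 1F d = modY
  mod-α 2F zero {P} h = P , h , ∣-zero (solve 1 (λ P → P :- P :* :1 := :0) refl P)
  mod-α 2F (suc d) {P} h with modX h
  ... | u , homu , X∣ with quotient {e = d} Hom-X (Hom-- h (Hom-* homu (Hom-^ Hom-Y (suc d)))) X∣
  ... | A , homA , P-≈ with mod-α 2F d homA
  ... | v , homv , (B , A-≈) = u - v , Hom-- homu homv , v * Y ^ d + X * B , (begin
      P - (u - v) * (Y * Y ^ d)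
        ≈⟨ solve 5 (λ P u v Y M → P :- (u :- v) :* (Y :* M) := (P :- u :* (Y :* M)) :+ v :* (Y :* M)) refl P u v Y (Y ^ d) ⟩
      (P - u * (Y * Y ^ d)) + v * (Y * Y ^ d)
        ≈⟨ +-congʳ P-≈ ⟩
      X * A + v * (Y * Y ^ d)
        ≈⟨ solve 5 (λ X A v Y M → X :* A :+ v :* (Y :* M) := X :* (A :- v :* M) :+ (X :+ Y) :* (v :* M)) refl X A v Y (Y ^ d) ⟩
      X * (A - v * Y ^ d) + (X + Y) * (v * Y ^ d)
        ≈⟨ +-congʳ (*-congˡ A-≈) ⟩
      X * ((X + Y) * B) + (X + Y) * (v * Y ^ d)
        ≈⟨ solve 4 (λ X Y B N → X :* ((X :+ Y) :* B) :+ (X :+ Y) :* N := (X :+ Y) :* (N :+ X :* B)) refl X Y B (v * Y ^ d) ⟩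
      (X + Y) * (v * Y ^ d + X * B) ∎)

  -- A certificate that P is a unit multiple of m^d modulo α i, hence a nonzerodivisor there.
  record Inv (i : Fin 3) (d : ℕ) (P : Carrier) : Set where
    constructor inv
    field
      unit : Carrier
      unit-Hom : Hom 0 unit
      ≡m^d : α i ∣ (unit * P - α (aux i) ^ d)

  -- Multiplication by `unit` turns P into m^d modulo α i, and m is regular there.
  Inv-∣ : ∀ {i d P Q} → Inv i d P → α i ∣ (P * Q) → α i ∣ Q
  Inv-∣ {i} {d} {P} {Q} (inv v _ h) k = α∣aux^* i d (∣-resp
    (solve 4 (λ v P M Q → v :* (P :* Q) :- (v :* P :- M) :* Q := M :* Q) refl v P (α (aux i) ^ d) Q)
    (∣-- (∣-*ˡ v k) (∣-*ʳ Q h)))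

  Inv-resp : ∀ {i d P Q} → P ≈ Q → Inv i d P → Inv i d Q
  Inv-resp P≈Q (inv v homv h) = inv v homv (∣-resp (+-congʳ (*-congˡ P≈Q)) h)

  Inv-^∣ : ∀ {i d P} n {Q} → Inv i d P → (α i ^ n) ∣ (P * Q) → (α i ^ n) ∣ Q
  Inv-^∣ zero _ h = 1∣ _
  Inv-^∣ {i} {d} {P} (suc n) {Q} P-inv (A , h) with Inv-∣ P-inv (α i ^ n * A , trans h (*-assoc _ _ _))
  ... | B , Q≈ with Inv-^∣ n {B} P-inv (A , cancel (α-cancel₀ i) (begin
      α i * (P * B)         ≈⟨ solve 3 (λ a P B → a :* (P :* B) := P :* (a :* B)) refl (α i) P B ⟩
      P * (α i * B)         ≈⟨ *-congˡ Q≈ ⟨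
      P * Q                 ≈⟨ h ⟩
      α i * α i ^ n * A     ≈⟨ *-assoc _ _ _ ⟩
      α i * (α i ^ n * A)   ∎))
  ... | C , B≈ = C , trans Q≈ (trans (*-congˡ B≈) (sym (*-assoc _ _ _)))

  Inv-* : ∀ {i d e P Q} → Inv i d P → Inv i e Q → Inv i (d ℕ.+ e) (P * Q)
  Inv-* {i} {d} {e} {P} {Q} (inv v homv h) (inv w homw k) = inv (v * w) (Hom-* homv homw) (∣-resp
    (begin
      (v * P - M) * (w * Q) + M * (w * Q - N)
        ≈⟨ solve 6 (λ v P w Q M N → (v :* P :- M) :* (w :* Q) :+ M :* (w :* Q :- N) := v :* w :* (P :* Q) :- M :* N)
             refl v P w Q M N ⟩
      v * w * (P * Q) - M * N
        ≈⟨ +-congˡ (-‿cong (^-homo-* (α (aux i)) d e)) ⟨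
      v * w * (P * Q) - α (aux i) ^ (d ℕ.+ e) ∎)
    (∣-+ (∣-*ʳ (w * Q) h) (∣-*ˡ M k)))
    where M = α (aux i) ^ d ; N = α (aux i) ^ e

  Inv-1 : ∀ i → Inv i 0 1#
  Inv-1 i = inv 1# Hom-1 (∣-zero (trans (+-congʳ (*-identityˡ 1#)) (-‿inverseʳ 1#)))

  Inv-^ : ∀ {i P} → Inv i 1 P → ∀ n → Inv i n (P ^ n)
  Inv-^ _ zero = Inv-1 _
  Inv-^ P-inv (suc n) = Inv-* P-inv (Inv-^ P-inv n)

  Inv-α : ∀ {i j} → i ≢ j → Inv i 1 (α j)
  Inv-α {0F} {0F} i≢j = contradiction ≡.refl i≢j
  Inv-α {0F} {1F} i≢j = inv 1# Hom-1 (∣-zero (solve 1 (λ y → :1 :* y :- y :* :1 := :0) refl Y))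
  Inv-α {0F} {2F} i≢j = inv 1# Hom-1 (1# ,
    solve 2 (λ x y → :1 :* (x :+ y) :- y :* :1 := x :* :1) refl X Y)
  Inv-α {1F} {0F} i≢j = inv 1# Hom-1 (∣-zero (solve 1 (λ y → :1 :* y :- y :* :1 := :0) refl X))
  Inv-α {1F} {1F} i≢j = contradiction ≡.refl i≢j
  Inv-α {1F} {2F} i≢j = inv 1# Hom-1 (1# ,
    solve 2 (λ x y → :1 :* (x :+ y) :- x :* :1 := y :* :1) refl X Y)
  Inv-α {2F} {0F} i≢j = inv (- 1#) (Hom-neg Hom-1) (- 1# ,
    solve 2 (λ x y → (:- :1) :* x :- y :* :1 := (x :+ y) :* (:- :1)) refl X Y)
  Inv-α {2F} {1F} i≢j = inv 1# Hom-1 (∣-zero (solve 1 (λ y → :1 :* y :- y :* :1 := :0) refl Y))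
  Inv-α {2F} {2F} i≢j = contradiction ≡.refl i≢j

  -- The residue is u m^d with u of degree 0, and such a u is zero or invertible.
  ∣⊎Inv : ∀ i {d P} → Hom d P → α i ∣ P ⊎ Inv i d P
  ∣⊎Inv i {d} {P} h with mod-α i d h
  ... | u , homu , k with constant homu
  ... | inj₁ u≈0 = inj₁ (∣-resp (begin
      P - u * M   ≈⟨ +-congˡ (-‿cong (trans (*-congʳ u≈0) (zeroˡ M))) ⟩
      P - 0#      ≈⟨ +-congˡ -0#≈0# ⟩
      P + 0#      ≈⟨ +-identityʳ P ⟩
      P           ∎) k)
    where M = α (aux i) ^ d
  ... | inj₂ (v , homv , vu≈1) = inj₂ (inv v homv (∣-resp (begin
      v * (P - u * M)      ≈⟨ solve 4 (λ v P u M → v :* (P :- u :* M) := v :* P :- v :* u :* M) refl v P u M ⟩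
      v * P - v * u * M    ≈⟨ +-congˡ (-‿cong (trans (*-congʳ vu≈1) (*-identityˡ M))) ⟩
      v * P - M            ∎) (∣-*ˡ v k)))
    where M = α (aux i) ^ d

  -- Division in one variable: modulo α i, Q is u m^(d+g) and v P is m^d, so t = u v m^g removes the
  -- residue of Q.
  eliminate : ∀ {i d P} g {Q} → Inv i d P → Hom (d ℕ.+ g) Q → ∃ λ t → Hom g t × α i ∣ (Q - t * P)
  eliminate {i} {d} {P} g {Q} (inv v homv h) homQ with mod-α i (d ℕ.+ g) homQ
  ... | u , homu , k = u * v * N , Hom-* (Hom-* homu homv) (Hom-^ (Hom-α (aux i)) g) , ∣-resp
    (begin
      (Q - u * m ^ (d ℕ.+ g)) - u * N * (v * P - M)
        ≈⟨ +-congʳ (+-congˡ (-‿cong (*-congˡ (^-homo-* m d g)))) ⟩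
      (Q - u * (M * N)) - u * N * (v * P - M)
        ≈⟨ solve 6 (λ Q u v P M N → (Q :- u :* (M :* N)) :- u :* N :* (v :* P :- M) := Q :- u :* v :* N :* P)
             refl Q u v P M N ⟩
      Q - u * v * N * P ∎)
    (∣-- k (∣-*ˡ (u * N) h))
    where m = α (aux i) ; M = m ^ d ; N = m ^ g

  -- The product x^a y^b (x+y)^c

  mon : Mult → Carrier
  mon μ = α 0F ^ μ 0F * (α 1F ^ μ 1F * α 2F ^ μ 2F)

  mon-cong : ∀ {μ ν} → (∀ i → μ i ≡ ν i) → mon μ ≈ mon ν
  mon-cong h = *-cong (^-congʳ _ (h 0F)) (*-cong (^-congʳ _ (h 1F)) (^-congʳ _ (h 2F)))

  mon-Hom : ∀ μ → Hom (size μ) (mon μ)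
  mon-Hom μ = Hom-≡ (≡.sym (ℕₚ.+-assoc (μ 0F) (μ 1F) (μ 2F)))
    (Hom-* (pw 0F) (Hom-* (pw 1F) (pw 2F)))
    where
    pw : ∀ i → Hom (μ i) (α i ^ μ i)
    pw i = Hom-^ (Hom-α i) (μ i)

  mon-Regular : ∀ μ → Regular (mon μ)
  mon-Regular μ = Regular-* (reg 0F) (Regular-* (reg 1F) (reg 2F))
    where
    reg : ∀ i → Regular (α i ^ μ i)
    reg i = Regular-^ (α-cancel₀ i) (μ i)

  α^∣mon : ∀ μ i → (α i ^ μ i) ∣ mon μ
  α^∣mon μ 0F = ∣-*ʳ _ ∣-refl
  α^∣mon μ 1F = ∣-*ˡ _ (∣-*ʳ _ ∣-refl)
  α^∣mon μ 2F = ∣-*ˡ _ (∣-*ˡ _ ∣-refl)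

  mon-Bump : ∀ i {μ μ′} → Bump i μ μ′ → mon μ′ ≈ α i * mon μ
  mon-Bump 0F (e , h) rewrite e | h 1F (λ ()) | h 2F (λ ()) = *-assoc _ _ _
  mon-Bump 1F {μ} (e , h) rewrite e | h 0F (λ ()) | h 2F (λ ()) =
    solve 4 (λ A b B C → A :* (b :* B :* C) := b :* (A :* (B :* C))) refl _ _ _ _
  mon-Bump 2F (e , h) rewrite e | h 0F (λ ()) | h 1F (λ ()) =
    solve 4 (λ A B c C → A :* (B :* (c :* C)) := c :* (A :* (B :* C))) refl _ _ _ _

  α^∣α^* : ∀ {i j} → i ≢ j → ∀ m n {P} → (α i ^ m) ∣ (α j ^ n * P) → (α i ^ m) ∣ P
  α^∣α^* i≢j m n = Inv-^∣ m (Inv-^ (Inv-α i≢j) n)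

  -- Distinct forms are regular modulo powers of each other, so the three powers can be split off in
  -- turn.
  mon-∣ : ∀ μ {P} → (∀ i → (α i ^ μ i) ∣ P) → mon μ ∣ P
  mon-∣ μ {P} h with h 0F
  ... | A , P≈ with α^∣α^* {1F} {0F} (λ ()) (μ 1F) (μ 0F) (∣-resp P≈ (h 1F))
  ... | B , A≈ with α^∣α^* {2F} {1F} (λ ()) (μ 2F) (μ 1F)
                      (∣-resp A≈ (α^∣α^* {2F} {0F} (λ ()) (μ 2F) (μ 0F) (∣-resp P≈ (h 2F))))
  ... | C , B≈ = C , trans P≈ (trans (*-congˡ (trans A≈ (*-congˡ B≈)))
    (solve 4 (λ a b c C → a :* (b :* (c :* C)) := a :* (b :* c) :* C) refl _ _ _ C))

  -- Bases of D(μ)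
  Pair : Set
  Pair = Carrier × Carrier

  _⟨_⟩ : Pair → Fin 3 → Carrier
  (F , G) ⟨ 0F ⟩ = F
  (F , G) ⟨ 1F ⟩ = G
  (F , G) ⟨ 2F ⟩ = F + G

  lincomb : Carrier → Pair → Carrier → Pair → Pair
  lincomb s (F , G) t (F′ , G′) = s * F + t * F′ , s * G + t * G′

  lincomb-⟨⟩ : ∀ s θ t η i → lincomb s θ t η ⟨ i ⟩ ≈ s * θ ⟨ i ⟩ + t * η ⟨ i ⟩
  lincomb-⟨⟩ s θ t η 0F = refl
  lincomb-⟨⟩ s θ t η 1F = refl
  lincomb-⟨⟩ s (F , G) t (F′ , G′) 2F =
    solve 6 (λ s F G t F′ G′ → (s :* F :+ t :* F′) :+ (s :* G :+ t :* G′) := s :* (F :+ G) :+ t :* (F′ :+ G′))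
      refl s F G t F′ G′

  _∙_ : Carrier → Pair → Pair
  t ∙ (F , G) = t * F , t * G

  ∙-⟨⟩ : ∀ t θ i → (t ∙ θ) ⟨ i ⟩ ≈ t * θ ⟨ i ⟩
  ∙-⟨⟩ t θ 0F = refl
  ∙-⟨⟩ t θ 1F = refl
  ∙-⟨⟩ t (F , G) 2F = sym (distribˡ t F G)

  det : Pair → Pair → Carrier
  det (F , G) (F′ , G′) = F * G′ - G * F′

  -- The values at α_i can serve as a column of the determinant; for x + y, add the first column to
  -- the second.
  det-∣ : ∀ i {M θ η} → M ∣ (θ ⟨ i ⟩) → M ∣ (η ⟨ i ⟩) → M ∣ det θ η
  det-∣ 0F {η = F′ , G′} h k = ∣-- (∣-*ʳ G′ h) (∣-*ˡ _ k)
  det-∣ 1F {η = F′ , G′} h k = ∣-- (∣-*ˡ _ k) (∣-*ʳ F′ h)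
  det-∣ 2F {θ = F , G} {F′ , G′} h k = ∣-resp
    (solve 4 (λ F G F′ G′ → F :* (F′ :+ G′) :- (F :+ G) :* F′ := F :* G′ :- G :* F′) refl F G F′ G′)
    (∣-- (∣-*ˡ F k) (∣-*ʳ F′ h))

  record _∈D_ (θ : Pair) (μ : Mult) : Set where
    constructor mkD
    field member : ∀ i → (α i ^ μ i) ∣ (θ ⟨ i ⟩)
  open _∈D_ public

  -- A homogeneous basis (θ , θ′) of D(μ) of degrees d ≤ d + g, certified by Saito's criterion.
  record Basis (μ : Mult) (θ : Pair) (d g : ℕ) : Set where
    field
      θ′ : Pair
      hom : ∀ i → Hom d (θ ⟨ i ⟩)
      hom′ : ∀ i → Hom (d ℕ.+ g) (θ′ ⟨ i ⟩)
      div : θ ∈D μ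
      div′ : θ′ ∈D μ
      det≈ : det θ θ′ ≈ mon μ
      total : d ℕ.+ (d ℕ.+ g) ≡ size μ
  open Basis

  -- θ lies in D(μ) but not in D(μ + e_i).
  record Tight (i : Fin 3) (μ : Mult) (θ : Pair) (d : ℕ) : Set where
    constructor tight
    field
      {e} : ℕ
      {A} : Carrier
      A-Inv : Inv i e A
      degree : μ i ℕ.+ e ≡ d
      factor : θ ⟨ i ⟩ ≈ α i ^ μ i * A

  -- θ is not divisible by α i; this is only used when α i ∣ θ(α i).
  Primitive : Fin 3 → Pair → ℕ → Set
  Primitive i θ d = Inv i d (θ ⟨ aux i ⟩)

  Basis-resp : ∀ {μ μ′ θ d g} → (∀ i → μ i ≡ μ′ i) → Basis μ θ d g → Basis μ′ θ d g
  Basis-resp {μ} {μ′} h b = record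
    { θ′ = θ′ b ; hom = hom b ; hom′ = hom′ b
    ; div = mkD λ i → ≡.subst (λ n → (α i ^ n) ∣ _) (h i) (member (div b) i)
    ; div′ = mkD λ i → ≡.subst (λ n → (α i ^ n) ∣ _) (h i) (member (div′ b) i)
    ; det≈ = trans (det≈ b) (mon-cong h)
    ; total = ≡.trans (total b) (size-cong h) }

  ∈D-Bump : ∀ i {μ μ′ η} → Bump i μ μ′ → η ∈D μ → (α i ^ suc (μ i)) ∣ (η ⟨ i ⟩) → η ∈D μ′
  ∈D-Bump i {μ} {μ′} {η} (e , h) (mkD m) k = mkD step
    where
    step : ∀ j → (α j ^ μ′ j) ∣ (η ⟨ j ⟩)
    step j with j Finₚ.≟ i
    ... | yes ≡.refl rewrite e = k
    ... | no j≢i rewrite h j j≢i = m j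

  ∈D-∙ : ∀ i {μ μ′ η} → Bump i μ μ′ → η ∈D μ → (α i ∙ η) ∈D μ′
  ∈D-∙ i {μ} {μ′} {η} b (mkD m) = ∈D-Bump i b
    (mkD λ j → ∣-resp (sym (∙-⟨⟩ _ η j)) (∣-*ˡ _ (m j)))
    (∣-resp (sym (∙-⟨⟩ _ η i)) (A , trans (*-congˡ h) (sym (*-assoc _ _ _))))
    where A = proj₁ (m i) ; h = proj₂ (m i)

  Hom-∙ : ∀ i {d η} → (∀ j → Hom d (η ⟨ j ⟩)) → ∀ j → Hom (suc d) ((α i ∙ η) ⟨ j ⟩)
  Hom-∙ i {η = η} h j = Hom-resp (sym (∙-⟨⟩ _ η j)) (Hom-* (Hom-α i) (h j))

  -- θ already lies in D(μ′), so the factor α i goes to θ′ alone; the determinant and `mon` both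
  -- gain α i.
  raise-in : ∀ i {μ μ′ θ d g} → Bump i μ μ′ → Basis μ θ d g → (α i ^ suc (μ i)) ∣ (θ ⟨ i ⟩) →
    Basis μ′ θ d (suc g)
  raise-in i {μ} {μ′} {θ@(F , G)} {d} {g} bump b h = record
    { θ′ = α i ∙ θ′ b
    ; hom = hom b
    ; hom′ = λ j → Hom-≡ (≡.sym (ℕₚ.+-suc d g)) (Hom-∙ i {η = θ′ b} (hom′ b) j)
    ; div = ∈D-Bump i bump (div b) h
    ; div′ = ∈D-∙ i bump (div′ b)
    ; det≈ = begin
        F * (α i * proj₂ (θ′ b)) - G * (α i * proj₁ (θ′ b))
          ≈⟨ solve 5 (λ F G a F′ G′ → F :* (a :* G′) :- G :* (a :* F′) := a :* (F :* G′ :- G :* F′))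
               refl F G (α i) (proj₁ (θ′ b)) (proj₂ (θ′ b)) ⟩
        α i * det θ (θ′ b)   ≈⟨ *-congˡ (det≈ b) ⟩
        α i * mon μ          ≈⟨ mon-Bump i bump ⟨
        mon μ′               ∎
    ; total = ≡.trans (≡.cong (d ℕ.+_) (ℕₚ.+-suc d g)) (≡.trans (ℕₚ.+-suc d _)
        (≡.trans (≡.cong suc (total b)) (≡.sym (Bump-size i bump)))) }

  record Reduction (μ : Mult) (θ θ′ : Pair) (D : ℕ) (t : Carrier) : Set where
    field
      η : Pair
      η-Hom : ∀ j → Hom D (η ⟨ j ⟩)
      η-def : ∀ j → η ⟨ j ⟩ ≈ θ′ ⟨ j ⟩ - t * θ ⟨ j ⟩
      η-∈D : η ∈D μ
      η-det : det θ η ≈ det θ θ′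
  open Reduction

  subtract : ∀ {μ θ d g t} (b : Basis μ θ d g) → Hom g t → Reduction μ θ (θ′ b) (d ℕ.+ g) t
  subtract {μ} {θ@(F , G)} {d} {g} {t} b homt = record
    { η = η₀
    ; η-Hom = λ j → Hom-resp (sym (η₀-def j)) (Hom-- (hom′ b j) (Hom-≡ (ℕₚ.+-comm g d) (Hom-* homt (hom b j))))
    ; η-def = η₀-def
    ; η-∈D = mkD λ j → ∣-resp (sym (η₀-def j)) (∣-- (member (div′ b) j) (∣-*ˡ t (member (div b) j)))
    ; η-det = solve 5 (λ F G F′ G′ t → F :* (:1 :* G′ :+ (:- t) :* G) :- G :* (:1 :* F′ :+ (:- t) :* F)
        := F :* G′ :- G :* F′) refl F G (proj₁ (θ′ b)) (proj₂ (θ′ b)) t }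
    where
    η₀ = lincomb 1# (θ′ b) (- t) θ
    η₀-def : ∀ j → η₀ ⟨ j ⟩ ≈ θ′ b ⟨ j ⟩ - t * θ ⟨ j ⟩
    η₀-def j = trans (lincomb-⟨⟩ 1# (θ′ b) (- t) θ j) (+-cong (*-identityˡ _) (sym (-‿distribˡ-* _ _)))

  -- After division by α_i^(μ_i), the value of θ at α_i is invertible modulo α_i. A multiple of θ
  -- therefore corrects θ′ to gain one more power.
  tight-reduction : ∀ i {μ θ d g} (b : Basis μ θ d g) → Tight i μ θ d →
    ∃₂ λ t (r : Reduction μ θ (θ′ b) (d ℕ.+ g) t) → (α i ^ suc (μ i)) ∣ (η r ⟨ i ⟩)
  tight-reduction i {μ} {θ} {_} {g} b (tight {e} {A} A-Inv ≡.refl factor) = t , r , (B , (begin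
      η r ⟨ i ⟩                      ≈⟨ η-def r i ⟩
      θ′ b ⟨ i ⟩ - t * θ ⟨ i ⟩       ≈⟨ +-cong (proj₂ (proj₂ q)) (-‿cong (*-congˡ factor)) ⟩
      M * A′ - t * (M * A)           ≈⟨ solve 4 (λ M A′ t A → M :* A′ :- t :* (M :* A) := M :* (A′ :- t :* A)) refl M A′ t A ⟩
      M * (A′ - t * A)               ≈⟨ *-congˡ (proj₂ (proj₂ (proj₂ s))) ⟩
      M * (α i * B)                  ≈⟨ solve 3 (λ M a B → M :* (a :* B) := a :* M :* B) refl M (α i) B ⟩
      α i * M * B                    ∎))
    where
    M = α i ^ μ i
    q = quotient (Hom-^ (Hom-α i) (μ i)) (Hom-≡ (ℕₚ.+-assoc (μ i) e g) (hom′ b i)) (member (div′ b) i)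
    A′ = proj₁ q
    s = eliminate g A-Inv (proj₁ (proj₂ q))
    t = proj₁ s
    B = proj₁ (proj₂ (proj₂ s))
    r = subtract b (proj₁ (proj₂ s))

  -- Here θ must absorb the factor α i, while θ′ enters D(μ′) by a correction that preserves its
  -- degree.
  raise-out : ∀ i {μ μ′ θ d g} → Bump i μ μ′ → Basis μ θ d (suc g) → Tight i μ θ d →
    Basis μ′ (α i ∙ θ) (suc d) g
  raise-out i {μ} {μ′} {θ@(F , G)} {d} {g} bump b T = record
    { θ′ = η r
    ; hom = Hom-∙ i {η = θ} (hom b)
    ; hom′ = λ j → Hom-≡ (ℕₚ.+-suc d g) (η-Hom r j)
    ; div = ∈D-∙ i bump (div b)
    ; div′ = ∈D-Bump i bump (η-∈D r) h
    ; det≈ = begin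
        α i * F * proj₂ (η r) - α i * G * proj₁ (η r)
          ≈⟨ solve 5 (λ F G a F′ G′ → a :* F :* G′ :- a :* G :* F′ := a :* (F :* G′ :- G :* F′))
               refl F G (α i) (proj₁ (η r)) (proj₂ (η r)) ⟩
        α i * det θ (η r)   ≈⟨ *-congˡ (trans (η-det r) (det≈ b)) ⟩
        α i * mon μ         ≈⟨ mon-Bump i bump ⟨
        mon μ′              ∎
    ; total = ≡.trans (≡.cong suc (≡.trans (≡.cong (d ℕ.+_) (≡.sym (ℕₚ.+-suc d g))) (total b)))
        (≡.sym (Bump-size i bump)) }
    where
    r = proj₁ (proj₂ (tight-reduction i b T))
    h = proj₂ (proj₂ (tight-reduction i b T))

  -- At gap 0 the corrected θ′ becomes the low element and α i θ the high one. The factor -1 undoes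
  -- the sign change of the determinant under this exchange.
  raise-swap : ∀ i {μ μ′ θ d} → Bump i μ μ′ → Basis μ θ d 0 → Tight i μ θ d → ∃ λ η → Basis μ′ η d 1
  raise-swap i {μ} {μ′} {θ@(F , G)} {d} bump b T = η r , record
    { θ′ = (- 1#) ∙ (α i ∙ θ)
    ; hom = λ j → Hom-≡ (ℕₚ.+-identityʳ d) (η-Hom r j)
    ; hom′ = λ j → Hom-≡ (ℕₚ.+-comm 1 d) (Hom-resp (sym (∙-⟨⟩ (- 1#) (α i ∙ θ) j))
        (Hom-* (Hom-neg Hom-1) (Hom-∙ i {η = θ} (hom b) j)))
    ; div = ∈D-Bump i bump (η-∈D r) h
    ; div′ = mkD λ j → ∣-resp (sym (∙-⟨⟩ (- 1#) (α i ∙ θ) j)) (∣-*ˡ (- 1#) (member (∈D-∙ i bump (div b)) j))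
    ; det≈ = begin
        proj₁ (η r) * (- 1# * (α i * G)) - proj₂ (η r) * (- 1# * (α i * F))
          ≈⟨ solve 5 (λ F G a F′ G′ → F′ :* ((:- :1) :* (a :* G)) :- G′ :* ((:- :1) :* (a :* F))
               := a :* (F :* G′ :- G :* F′)) refl F G (α i) (proj₁ (η r)) (proj₂ (η r)) ⟩
        α i * det θ (η r)   ≈⟨ *-congˡ (trans (η-det r) (det≈ b)) ⟩
        α i * mon μ         ≈⟨ mon-Bump i bump ⟨
        mon μ′              ∎
    ; total = ≡.trans (≡.cong (d ℕ.+_) (ℕₚ.+-suc d 0)) (≡.trans (ℕₚ.+-suc d _)
        (≡.trans (≡.cong suc (total b)) (≡.sym (Bump-size i bump)))) }
    where
    r = proj₁ (proj₂ (tight-reduction i b T))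
    h = proj₂ (proj₂ (tight-reduction i b T))

  -- α i and `α (aux i)` are linear coordinates, so the values of θ there determine both components.
  α∣all : ∀ i {M} θ → M ∣ (θ ⟨ i ⟩) → M ∣ (θ ⟨ aux i ⟩) → M ∣ proj₁ θ × M ∣ proj₂ θ
  α∣all 0F θ h k = h , k
  α∣all 1F θ h k = k , h
  α∣all 2F (F , G) h k = ∣-resp (solve 2 (λ F G → F :+ G :- G := F) refl F G) (∣-- h k) , k

  α-quotient : ∀ i {e} θ → (∀ j → Hom (suc e) (θ ⟨ j ⟩)) → α i ∣ (θ ⟨ i ⟩) → α i ∣ (θ ⟨ aux i ⟩) →
    ∃ λ ξ → (∀ j → Hom e (ξ ⟨ j ⟩)) × (∀ j → θ ⟨ j ⟩ ≈ α i * ξ ⟨ j ⟩)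
  α-quotient i θ homθ h k =
    let A , homA , F≈ = quotient (Hom-α i) (homθ 0F) (proj₁ (α∣all i θ h k))
        B , homB , G≈ = quotient (Hom-α i) (homθ 1F) (proj₂ (α∣all i θ h k))
    in (A , B) ,
       (λ { 0F → homA ; 1F → homB ; 2F → Hom-+ homA homB }) ,
       (λ { 0F → F≈ ; 1F → G≈ ; 2F → trans (+-cong F≈ G≈) (sym (distribˡ _ A B)) })

  -- Dividing by α i costs a power at i alone, because α i is regular modulo powers of the other
  -- forms.
  ∈D-quotient : ∀ i {μ′ μ θ ξ} → Bump i μ′ μ → (∀ j → θ ⟨ j ⟩ ≈ α i * ξ ⟨ j ⟩) → θ ∈D μ → ξ ∈D μ′
  ∈D-quotient i {μ′} {μ} {θ} {ξ} (e , h) θ≈ (mkD m) = mkD step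
    where
    step : ∀ j → (α j ^ μ′ j) ∣ (ξ ⟨ j ⟩)
    step j with j Finₚ.≟ i
    ... | yes ≡.refl = proj₁ k , cancel (α-cancel₀ i) (trans (sym (θ≈ i)) (trans (proj₂ k) (*-assoc _ _ _)))
      where k = ≡.subst (λ n → (α i ^ n) ∣ (θ ⟨ i ⟩)) e (m i)
    ... | no j≢i = Inv-^∣ (μ′ j) (Inv-α j≢i)
      (∣-resp (θ≈ j) (≡.subst (λ n → (α j ^ n) ∣ (θ ⟨ j ⟩)) (h j j≢i) (m j)))

  ∈D-weaken : ∀ i {μ′ μ θ} → Bump i μ′ μ → θ ∈D μ → θ ∈D μ′
  ∈D-weaken i {μ′} {μ} {θ} (e , h) (mkD m) = mkD step
    where
    step : ∀ j → (α j ^ μ′ j) ∣ (θ ⟨ j ⟩)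
    step j with j Finₚ.≟ i
    ... | yes ≡.refl with ≡.subst (λ n → (α i ^ n) ∣ (θ ⟨ i ⟩)) e (m i)
    ... | A , k = α i * A , trans k (solve 3 (λ a M A → a :* M :* A := M :* (a :* A)) refl (α i) _ A)
    step j | no j≢i = ≡.subst (λ n → (α j ^ n) ∣ (θ ⟨ j ⟩)) (h j j≢i) (m j)

  α∣member : ∀ i {μ′ μ θ} → Bump i μ′ μ → θ ∈D μ → α i ∣ (θ ⟨ i ⟩)
  α∣member i {θ = θ} (e , _) (mkD m) with ≡.subst (λ n → (α i ^ n) ∣ (θ ⟨ i ⟩)) e (m i)
  ... | A , k = _ * A , trans k (*-assoc _ _ _)

  -- When α i divides all of θ, dividing θ by it removes the factor from the determinant; θ′ stays.
  lower-in : ∀ i {μ′ μ θ d g} → Bump i μ′ μ → Basis μ θ (suc d) g → α i ∣ (θ ⟨ aux i ⟩) →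
    ∃ λ ξ → (∀ j → θ ⟨ j ⟩ ≈ α i * ξ ⟨ j ⟩) × Basis μ′ ξ d (suc g)
  lower-in i {μ′} {μ} {θ@(F , G)} {d} {g} bump b h = ξ , θ≈ , record
    { θ′ = θ′ b
    ; hom = proj₁ (proj₂ q)
    ; hom′ = λ j → Hom-≡ (≡.sym (ℕₚ.+-suc d g)) (hom′ b j)
    ; div = ∈D-quotient i bump θ≈ (div b)
    ; div′ = ∈D-weaken i bump (div′ b)
    ; det≈ = cancel (α-cancel₀ i) (begin
        α i * (proj₁ ξ * proj₂ (θ′ b) - proj₂ ξ * proj₁ (θ′ b))
          ≈⟨ solve 5 (λ F G a F′ G′ → a :* (F :* G′ :- G :* F′) := a :* F :* G′ :- a :* G :* F′)
               refl (proj₁ ξ) (proj₂ ξ) (α i) (proj₁ (θ′ b)) (proj₂ (θ′ b)) ⟩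
        α i * proj₁ ξ * proj₂ (θ′ b) - α i * proj₂ ξ * proj₁ (θ′ b)
          ≈⟨ +-cong (*-congʳ (θ≈ 0F)) (-‿cong (*-congʳ (θ≈ 1F))) ⟨
        det θ (θ′ b)   ≈⟨ det≈ b ⟩
        mon μ          ≈⟨ mon-Bump i bump ⟩
        α i * mon μ′   ∎)
    ; total = ℕₚ.suc-injective (≡.trans (≡.cong (λ n → suc (d ℕ.+ n)) (ℕₚ.+-suc d g))
        (≡.trans (total b) (Bump-size i bump))) }
    where
    q = α-quotient i θ (hom b) (α∣member i bump (div b)) h
    ξ = proj₁ q
    θ≈ = proj₂ (proj₂ q)

  -- When α i does not divide θ, a multiple of θ can be subtracted from θ′ to make the difference
  -- divisible by α i. The quotient is the new high element and θ is kept.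
  lower-out : ∀ i {μ′ μ θ d g} → Bump i μ′ μ → Basis μ θ d (suc g) → Primitive i θ d → Basis μ′ θ d g
  lower-out i {μ′} {μ} {θ@(F , G)} {d} {g} bump b prim = record
    { θ′ = ξ
    ; hom = hom b
    ; hom′ = proj₁ (proj₂ q)
    ; div = ∈D-weaken i bump (div b)
    ; div′ = ∈D-quotient i bump η≈ (η-∈D r)
    ; det≈ = cancel (α-cancel₀ i) (begin
        α i * (F * proj₂ ξ - G * proj₁ ξ)
          ≈⟨ solve 5 (λ F G a F′ G′ → a :* (F :* G′ :- G :* F′) := F :* (a :* G′) :- G :* (a :* F′))
               refl F G (α i) (proj₁ ξ) (proj₂ ξ) ⟩
        F * (α i * proj₂ ξ) - G * (α i * proj₁ ξ)
          ≈⟨ +-cong (*-congˡ (η≈ 1F)) (-‿cong (*-congˡ (η≈ 0F))) ⟨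
        det θ (η r)    ≈⟨ trans (η-det r) (det≈ b) ⟩
        mon μ          ≈⟨ mon-Bump i bump ⟩
        α i * mon μ′   ∎)
    ; total = ℕₚ.suc-injective (≡.trans (≡.sym (ℕₚ.+-suc d (d ℕ.+ g)))
        (≡.trans (≡.cong (d ℕ.+_) (≡.sym (ℕₚ.+-suc d g))) (≡.trans (total b) (Bump-size i bump)))) }
    where
    s = eliminate (suc g) prim (hom′ b (aux i))
    r = subtract b (proj₁ (proj₂ s))
    q = α-quotient i (η r) (λ j → Hom-≡ (ℕₚ.+-suc d g) (η-Hom r j))
          (α∣member i bump (η-∈D r)) (∣-resp (sym (η-def r (aux i))) (proj₂ (proj₂ s)))
    ξ = proj₁ q
    η≈ = proj₂ (proj₂ q)

  -- Cramer's rule: the numerators det(η, θ′) and det(θ, η) are divisible by each α_i^(μ_i), hence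
  -- by `mon μ` = det(θ, θ′). This is the generating half of Saito's criterion.
  span : ∀ {μ θ d g η} (b : Basis μ θ d g) → η ∈D μ → ∃₂ λ s t →
    (η ⟨ 0F ⟩ ≈ s * θ ⟨ 0F ⟩ + t * θ′ b ⟨ 0F ⟩) × (η ⟨ 1F ⟩ ≈ s * θ ⟨ 1F ⟩ + t * θ′ b ⟨ 1F ⟩)
  span {μ} {θ@(F , G)} {η = η@(U , V)} b m = s , t ,
    cancel (mon-Regular μ) (trans (*-congʳ (sym (det≈ b))) (trans
      (solve 6 (λ F G F′ G′ U V → (F :* G′ :- G :* F′) :* U := (U :* G′ :- V :* F′) :* F :+ (F :* V :- G :* U) :* F′)
        refl F G F′ G′ U V) (combine F F′))) ,
    cancel (mon-Regular μ) (trans (*-congʳ (sym (det≈ b))) (trans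
      (solve 6 (λ F G F′ G′ U V → (F :* G′ :- G :* F′) :* V := (U :* G′ :- V :* F′) :* G :+ (F :* V :- G :* U) :* G′)
        refl F G F′ G′ U V) (combine G G′)))
    where
    F′ = proj₁ (θ′ b) ; G′ = proj₂ (θ′ b)
    q = mon-∣ μ {det η (θ′ b)} λ i → det-∣ i {θ = η} {θ′ b} (member m i) (member (div′ b) i)
    r = mon-∣ μ {det θ η} λ i → det-∣ i {θ = θ} {η} (member (div b) i) (member m i)
    s = proj₁ q
    t = proj₁ r
    combine : ∀ P P′ → (U * G′ - V * F′) * P + (F * V - G * U) * P′ ≈ mon μ * (s * P + t * P′)
    combine P P′ = trans (+-cong (*-congʳ (proj₂ q)) (*-congʳ (proj₂ r)))
      (solve 5 (λ M s t P P′ → M :* s :* P :+ M :* t :* P′ := M :* (s :* P :+ t :* P′)) refl (mon μ) s t P P′)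

  independent : ∀ {μ θ d g} (b : Basis μ θ d g) {s t s′ t′} →
    s * θ ⟨ 0F ⟩ + t * θ′ b ⟨ 0F ⟩ ≈ s′ * θ ⟨ 0F ⟩ + t′ * θ′ b ⟨ 0F ⟩ →
    s * θ ⟨ 1F ⟩ + t * θ′ b ⟨ 1F ⟩ ≈ s′ * θ ⟨ 1F ⟩ + t′ * θ′ b ⟨ 1F ⟩ → s ≈ s′ × t ≈ t′
  independent {μ} {θ@(F , G)} b {s} {t} {s′} {t′} h k =
    cancel (mon-Regular μ) (trans (cramer₁ s t)
      (trans (+-cong (*-congʳ h) (-‿cong (*-congʳ k))) (sym (cramer₁ s′ t′)))) ,
    cancel (mon-Regular μ) (trans (cramer₂ s t)
      (trans (+-cong (*-congʳ k) (-‿cong (*-congʳ h))) (sym (cramer₂ s′ t′))))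
    where
    F′ = proj₁ (θ′ b) ; G′ = proj₂ (θ′ b)
    cramer₁ : ∀ s t → mon μ * s ≈ (s * F + t * F′) * G′ - (s * G + t * G′) * F′
    cramer₁ s t = trans (*-congʳ (sym (det≈ b))) (solve 6 (λ F G F′ G′ s t → (F :* G′ :- G :* F′) :* s
      := (s :* F :+ t :* F′) :* G′ :- (s :* G :+ t :* G′) :* F′) refl F G F′ G′ s t)
    cramer₂ : ∀ s t → mon μ * t ≈ (s * G + t * G′) * F - (s * F + t * F′) * G
    cramer₂ s t = trans (*-congʳ (sym (det≈ b))) (solve 6 (λ F G F′ G′ s t → (F :* G′ :- G :* F′) :* t
      := (s :* G :+ t :* G′) :* F :- (s :* F :+ t :* F′) :* G) refl F G F′ G′ s t)

  -- A primitive basis element has coprime components: the cofactor (F′ , G′) plays the role of Bézout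
  -- coefficients up to the factor mon μ, which is then removed form by form.
  coprime : ∀ {μ θ d g} (b : Basis μ θ d g) → (∀ i {n} → μ i ≡ suc n → Primitive i θ d) →
    ∀ {U V} → θ ⟨ 0F ⟩ * U ≈ θ ⟨ 1F ⟩ * V → ∃ λ Z → V ≈ θ ⟨ 0F ⟩ * Z × U ≈ θ ⟨ 1F ⟩ * Z
  coprime {μ} {θ@(F , G)} {d} b prim {U} {V} h = Z , reduce F V FZ , reduce G U GZ
    where
    F′ = proj₁ (θ′ b) ; G′ = proj₂ (θ′ b)
    Z₀ = G′ * V - F′ * U
    FZ : F * Z₀ ≈ mon μ * V
    FZ = begin
      F * (G′ * V - F′ * U)
        ≈⟨ solve 5 (λ F F′ G′ U V → F :* (G′ :* V :- F′ :* U) := F :* G′ :* V :- F′ :* (F :* U)) refl F F′ G′ U V ⟩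
      F * G′ * V - F′ * (F * U)    ≈⟨ +-congˡ (-‿cong (*-congˡ h)) ⟩
      F * G′ * V - F′ * (G * V)
        ≈⟨ solve 5 (λ F G F′ G′ V → F :* G′ :* V :- F′ :* (G :* V) := (F :* G′ :- G :* F′) :* V) refl F G F′ G′ V ⟩
      (F * G′ - G * F′) * V        ≈⟨ *-congʳ (det≈ b) ⟩
      mon μ * V                    ∎
    GZ : G * Z₀ ≈ mon μ * U
    GZ = begin
      G * (G′ * V - F′ * U)
        ≈⟨ solve 5 (λ G F′ G′ U V → G :* (G′ :* V :- F′ :* U) := G′ :* (G :* V) :- G :* F′ :* U) refl G F′ G′ U V ⟩
      G′ * (G * V) - G * F′ * U    ≈⟨ +-congʳ (*-congˡ h) ⟨
      G′ * (F * U) - G * F′ * U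
        ≈⟨ solve 5 (λ F G F′ G′ U → G′ :* (F :* U) :- G :* F′ :* U := (F :* G′ :- G :* F′) :* U) refl F G F′ G′ U ⟩
      (F * G′ - G * F′) * U        ≈⟨ *-congʳ (det≈ b) ⟩
      mon μ * U                    ∎
    mon∣ : ∀ i → mon μ ∣ (θ ⟨ aux i ⟩ * Z₀)
    mon∣ 0F = U , GZ
    mon∣ 1F = V , FZ
    mon∣ 2F = U , GZ
    power : ∀ i n → μ i ≡ n → (α i ^ n) ∣ Z₀
    power i zero _ = 1∣ Z₀
    power i (suc n) e = Inv-^∣ (suc n) (prim i e)
      (≡.subst (λ m → (α i ^ m) ∣ (θ ⟨ aux i ⟩ * Z₀)) e (∣-trans (α^∣mon μ i) (mon∣ i)))
    q = mon-∣ μ {Z₀} λ i → power i (μ i) ≡.refl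
    Z = proj₁ q
    reduce : ∀ P W → P * Z₀ ≈ mon μ * W → W ≈ P * Z
    reduce P W k = cancel (mon-Regular μ) (begin
      mon μ * W          ≈⟨ k ⟨
      P * Z₀             ≈⟨ *-congˡ (proj₂ q) ⟩
      P * (mon μ * Z)    ≈⟨ solve 3 (λ P M Z → P :* (M :* Z) := M :* (P :* Z)) refl P (mon μ) Z ⟩
      mon μ * (P * Z)    ∎)

  -- Existence of homogeneous bases

  -- If μ_i > d, then θ(α_i) = 0 by degree. Otherwise the dichotomy applies to the cofactor of
  -- α_i^(μ_i).
  ∣⊎Tight : ∀ i {μ θ d} → θ ∈D μ → Hom d (θ ⟨ i ⟩) → (α i ^ suc (μ i)) ∣ (θ ⟨ i ⟩) ⊎ Tight i μ θ d
  ∣⊎Tight i {μ} {θ} {d} m homθ with μ i ℕₚ.≤? d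
  ... | no μi≰d = inj₁ (∣-zero (vanish (Hom-^ (Hom-α i) (μ i)) homθ (ℕₚ.≰⇒> μi≰d) (member m i)))
  ... | yes μi≤d = split (∣⊎Inv i (proj₁ (proj₂ q)))
    where
    q = quotient {e = d ℕ.∸ μ i} (Hom-^ (Hom-α i) (μ i)) (Hom-≡ (≡.sym (ℕₚ.m+[n∸m]≡n μi≤d)) homθ) (member m i)
    A = proj₁ q
    split : α i ∣ A ⊎ Inv i (d ℕ.∸ μ i) A → (α i ^ suc (μ i)) ∣ (θ ⟨ i ⟩) ⊎ Tight i μ θ d
    split (inj₁ (B , h)) = inj₁ (B , (begin
      θ ⟨ i ⟩                  ≈⟨ proj₂ (proj₂ q) ⟩
      α i ^ μ i * A            ≈⟨ *-congˡ h ⟩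
      α i ^ μ i * (α i * B)    ≈⟨ solve 3 (λ M a B → M :* (a :* B) := a :* M :* B) refl _ (α i) B ⟩
      α i * α i ^ μ i * B      ∎))
    split (inj₂ A-Inv) = inj₂ (tight A-Inv (ℕₚ.m+[n∸m]≡n μi≤d) (proj₂ (proj₂ q)))

  SomeBasis : Mult → Set
  SomeBasis μ = ∃ λ θ → ∃₂ λ d g → Basis μ θ d g

  raise : ∀ i {μ μ′} → Bump i μ μ′ → SomeBasis μ → SomeBasis μ′
  raise i {μ} {μ′} bump (θ , d , g , b) = choose g b (∣⊎Tight i (div b) (hom b i))
    where
    choose : ∀ g → Basis μ θ d g → (α i ^ suc (μ i)) ∣ (θ ⟨ i ⟩) ⊎ Tight i μ θ d → SomeBasis μ′
    choose g b (inj₁ h) = θ , d , suc g , raise-in i bump b h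
    choose zero b (inj₂ T) = let η , b′ = raise-swap i bump b T in η , d , 1 , b′
    choose (suc g) b (inj₂ T) = α i ∙ θ , suc d , g , raise-out i bump b T

  standard : ∀ {μ} → (∀ i → μ i ≡ 0) → Basis μ (1# , 0#) 0 0
  standard {μ} h = Basis-resp {λ _ → 0} (λ i → ≡.sym (h i)) (record
    { θ′ = 0# , 1#
    ; hom = λ { 0F → Hom-1 ; 1F → Hom-0 0 ; 2F → Hom-+ Hom-1 (Hom-0 0) }
    ; hom′ = λ { 0F → Hom-0 0 ; 1F → Hom-1 ; 2F → Hom-+ (Hom-0 0) Hom-1 }
    ; div = mkD λ i → 1∣ _
    ; div′ = mkD λ i → 1∣ _
    ; det≈ = solve 0 (:1 :* :1 :- :0 :* :0
        := :1 :* (:1 :* :1)) refl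
    ; total = ≡.refl })

  basis : ∀ μ → SomeBasis μ
  basis μ = go (size μ) μ ≡.refl
    where
    go : ∀ n μ → size μ ≡ n → SomeBasis μ
    go n μ s with zero⊎suc μ
    ... | inj₁ μ≡0 = _ , _ , _ , standard μ≡0
    go n μ s | inj₂ (i , m , e) with predecessor i e
    go zero μ s | inj₂ (i , m , e) | μ′ , bump = contradiction (≡.trans (≡.sym s) (Bump-size i bump)) λ ()
    go (suc n) μ s | inj₂ (i , m , e) | μ′ , bump =
      raise i bump (go n μ′ (ℕₚ.suc-injective (≡.trans (≡.sym (Bump-size i bump)) s)))

  -- Climbing to a peak

  Nonvanishing : Pair → Set
  Nonvanishing θ = ∀ i → ¬ (θ ⟨ i ⟩ ≈ 0#)

  nonzero : ∀ {μ θ d g} → Basis μ θ d g → θ ⟨ 0F ⟩ ≈ 0# → ¬ (θ ⟨ 1F ⟩ ≈ 0#)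
  nonzero {μ} {θ = F , G} b F≈0 G≈0 = 1≉0 (mon-Regular μ (begin
    mon μ * 1#                                     ≈⟨ *-identityʳ _ ⟩
    mon μ                                          ≈⟨ det≈ b ⟨
    F * proj₂ (θ′ b) - G * proj₁ (θ′ b)            ≈⟨ +-cong (*-congʳ F≈0) (-‿cong (*-congʳ G≈0)) ⟩
    0# * proj₂ (θ′ b) - 0# * proj₁ (θ′ b)
      ≈⟨ solve 2 (λ a b → :0 :* a :- :0 :* b := :0) refl _ _ ⟩
    0#                                             ∎))

  -- If θ(α i) = 0, then θ has a component divisible by the other two powers, and balancedness
  -- makes the degree of θ too small for that.
  balanced⇒nonvanishing : ∀ {μ θ d g} → Balanced μ → 1 ℕ.≤ g → Basis μ θ d g → Nonvanishing θ
  balanced⇒nonvanishing {μ} {θ@(F , G)} {d} {suc g} bal _ b = λ where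
      0F F≈0 → nonzero b F≈0 (component 0F 1F λ where
        0F ne → contradiction ≡.refl ne
        1F _ → member (div b) 1F
        2F _ → ∣-resp (trans (+-congʳ F≈0) (+-identityˡ G)) (member (div b) 2F))
      1F G≈0 → nonzero b (component 1F 0F λ where
        0F _ → member (div b) 0F
        1F ne → contradiction ≡.refl ne
        2F _ → ∣-resp (trans (+-congˡ G≈0) (+-identityʳ F)) (member (div b) 2F)) G≈0
      2F H≈0 → let G≈0 = component 2F 1F λ where
                     0F _ → ∣-resp (G≈-F H≈0) (∣-neg (member (div b) 0F))
                     1F _ → member (div b) 1F
                     2F ne → contradiction ≡.refl ne
               in nonzero b (trans (sym (+-identityʳ F)) (trans (+-congˡ (sym G≈0)) H≈0)) G≈0
    where
    G≈-F : F + G ≈ 0# → - F ≈ G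
    G≈-F h = begin
      - F              ≈⟨ +-identityʳ _ ⟨
      - F + 0#         ≈⟨ +-congˡ h ⟨
      - F + (F + G)    ≈⟨ solve 2 (λ F G → :- F :+ (F :+ G) := G) refl F G ⟩
      G                ∎
    component : ∀ i j → (∀ k → k ≢ i → (α k ^ μ k) ∣ (θ ⟨ j ⟩)) → θ ⟨ j ⟩ ≈ 0#
    component i j h = vanish (mon-Hom (without i μ)) (hom b j) (balanced-degree i bal (total b)) (mon-∣ (without i μ) powers)
      where
      powers : ∀ k → (α k ^ without i μ k) ∣ (θ ⟨ j ⟩)
      powers k with k Finₚ.≟ i
      ... | yes ≡.refl rewrite updateAt-updates i {const 0} μ = 1∣ _
      ... | no k≢i rewrite updateAt-minimal k i {const 0} μ k≢i = h k k≢i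

  exponent≤degree : ∀ {μ θ d g} → Basis μ θ d g → Nonvanishing θ → ∀ i → μ i ℕ.≤ d
  exponent≤degree {μ} b nv i = ℕₚ.≮⇒≥ λ d<μi →
    nv i (vanish (Hom-^ (Hom-α i) (μ i)) (hom b i) d<μi (member (div b) i))

  -- Local maximality of a positive gap in direction i: tightness makes raising μ_i shrink the gap,
  -- primitivity makes lowering it do so.
  record Extremal (i : Fin 3) (μ : Mult) (θ : Pair) (d : ℕ) : Set where
    constructor extremal
    field
      is-tight : Tight i μ θ d
      is-primitive : ∀ {n} → μ i ≡ suc n → Primitive i θ d
  open Extremal

  -- Each step of the climb adds 1 to the gap, so the gain covers the distance travelled. The degree
  -- bound is kept for the induction on the degree.
  record Peak (μ : Mult) (d g : ℕ) : Set where
    field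
      {top} : Mult
      {θ} : Pair
      {d*} {g*} : ℕ
      base : Basis top θ d* g*
      nonvanishing : Nonvanishing θ
      is-extremal : ∀ i → Extremal i top θ d*
      d*≤d : d* ℕ.≤ d
      gap : g ℕ.+ dist μ top ℕ.≤ g*
  open Peak

  -- Termination: 4d - |μ| drops by 1 when an entry is raised and by 3 when one is lowered, since θ
  -- is then divided as well. It stays nonnegative because nonvanishing forces μ_i ≤ d.
  climb : ∀ {μ θ d g} → Basis μ θ d g → Nonvanishing θ → Peak μ d g
  climb {d = d} b nv = go (suc (4 ℕ.* d)) b nv (ℕₚ.m≤m+n _ _)
    where
    step : ∀ {i μ μ′ d d′ g} → dist μ μ′ ≡ 1 → d′ ℕ.≤ d → Peak μ′ d′ (suc g) → Peak μ d g
    step {i} {μ} {μ′} {d} {d′} {g} δ≡1 d′≤d P = record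
      { base = base P ; nonvanishing = nonvanishing P ; is-extremal = is-extremal P
      ; d*≤d = ℕₚ.≤-trans (d*≤d P) d′≤d
      ; gap = dist-step {μ} {μ′} {top P} {g} δ≡1 (gap P) }

    go : ∀ fuel {μ θ d g} → Basis μ θ d g → Nonvanishing θ → 4 ℕ.* d ℕ.< fuel ℕ.+ size μ → Peak μ d g

    search : ∀ fuel i {μ θ d g} → Basis μ θ d g → Nonvanishing θ → 4 ℕ.* d ℕ.< suc fuel ℕ.+ size μ →
      Peak μ d g ⊎ Extremal i μ θ d
    search fuel i {μ} {θ} {d} {g} b nv h = up (∣⊎Tight i (div b) (hom b i))
      where
      down : Tight i μ θ d → ∀ m d {g} → μ i ≡ suc m → Basis μ θ d g → 4 ℕ.* d ℕ.< suc fuel ℕ.+ size μ →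
        α i ∣ (θ ⟨ aux i ⟩) → Peak μ d g
      -- A form of degree 0 divisible by α i is zero, against nonvanishing.
      down T m zero e b h k = contradiction
        (vanish (Hom-α i) (hom b (aux i)) (s≤s z≤n) k) (nv (aux i))
      down T m (suc d) e b h k =
        let μ′ , bump = predecessor i e
            ξ , θ≈ , b′ = lower-in i bump b k
        in step {i} (≡.trans (dist-sym μ μ′) (dist-Bump i bump)) (ℕₚ.n≤1+n d)
             (go fuel b′ (λ j ξ≈0 → nv j (trans (θ≈ j) (trans (*-congˡ ξ≈0) (zeroʳ _))))
               (smaller (≡.subst (λ n → 4 ℕ.* suc d ℕ.< suc fuel ℕ.+ n) (Bump-size i bump) h)))
        where
        smaller : ∀ {s} → 4 ℕ.* suc d ℕ.< suc fuel ℕ.+ suc s → 4 ℕ.* d ℕ.< fuel ℕ.+ s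
        smaller {s} h rewrite ℕₚ.*-suc 4 d | ℕₚ.+-suc fuel s = ℕₚ.m+n≤o⇒n≤o 2 (ℕₚ.≤-pred (ℕₚ.≤-pred h))
      decide : Tight i μ θ d → ∀ n → μ i ≡ n → Peak μ d g ⊎ Extremal i μ θ d
      decide T zero e = inj₂ (extremal T λ e′ → contradiction (≡.trans (≡.sym e) e′) λ ())
      decide T (suc m) e with ∣⊎Inv i (hom b (aux i))
      ... | inj₁ k = inj₁ (down T m d e b h k)
      ... | inj₂ prim = inj₂ (extremal T λ _ → prim)
      up : (α i ^ suc (μ i)) ∣ (θ ⟨ i ⟩) ⊎ Tight i μ θ d → Peak μ d g ⊎ Extremal i μ θ d
      up (inj₁ k) = let μ′ , bump = successor i μ in
        inj₁ (step {i} (dist-Bump i bump) ℕₚ.≤-refl (go fuel (raise-in i bump b k) nv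
          (≡.subst (4 ℕ.* d ℕ.<_) (≡.sym (≡.trans (≡.cong (fuel ℕ.+_) (Bump-size i bump)) (ℕₚ.+-suc fuel _))) h)))
      up (inj₂ T) = decide T (μ i) ≡.refl

    go zero b nv h = contradiction (size≤4* (exponent≤degree b nv)) (ℕₚ.<⇒≱ h)
    go (suc fuel) {μ} {g = g} b nv h with search fuel 0F b nv h | search fuel 1F b nv h | search fuel 2F b nv h
    ... | inj₁ P | _ | _ = P
    ... | inj₂ _ | inj₁ P | _ = P
    ... | inj₂ _ | inj₂ _ | inj₁ P = P
    ... | inj₂ x | inj₂ y | inj₂ z = record
      { base = b ; nonvanishing = nv
      ; is-extremal = λ { 0F → x ; 1F → y ; 2F → z }
      ; d*≤d = ℕₚ.≤-refl
      ; gap = ℕₚ.≤-reflexive (≡.trans (≡.cong (g ℕ.+_) (dist-refl μ)) (ℕₚ.+-identityʳ g)) }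

  -- Descending from a peak

  -- Changing entry i must not spoil extremality in the other directions, as these are traversed
  -- afterwards.
  record Moved (i : Fin 3) (μ μ′ : Mult) (θ : Pair) (d d″ g″ : ℕ) : Set where
    constructor moved
    field
      {θ″} : Pair
      new-basis : Basis μ′ θ″ d″ g″
      preserved : ∀ j → j ≢ i → Extremal j μ θ d → Extremal j μ′ θ″ d″

  Extremal-resp : ∀ {j μ μ′ θ d} → μ′ j ≡ μ j → Extremal j μ θ d → Extremal j μ′ θ d
  Extremal-resp {j} {θ = θ} e (extremal (tight A-Inv degree factor) prim) = extremal
    (tight A-Inv (≡.trans (≡.cong (ℕ._+ _) e) degree) (trans factor (*-congʳ (^-congʳ (α j) (≡.sym e)))))
    λ e′ → prim (≡.trans (≡.sym e) e′)

  Moved-trans : ∀ {i μ μ′ μ″ θ d d′ g′ d″ g″} (M : Moved i μ μ′ θ d d′ g′) →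
    Moved i μ′ μ″ (Moved.θ″ M) d′ d″ g″ → Moved i μ μ″ θ d d″ g″
  Moved-trans (moved b h) (moved b′ h′) = moved b′ λ j j≢i x → h′ j j≢i (h j j≢i x)

  -- Certificates at j ≠ i pass from θ to α i θ, as α i is invertible modulo α j.
  Moved-raise : ∀ i {μ μ′ θ d g} → Bump i μ μ′ → Basis μ θ d (suc g) → Tight i μ θ d →
    Moved i μ μ′ θ d (suc d) g
  Moved-raise i {μ} {μ′} {θ} {d} bump@(_ , off) b T = moved (raise-out i bump b T)
    λ where
      j j≢i (extremal (tight {e} {A} A-Inv degree factor) prim) → extremal
        (tight (Inv-* (Inv-α j≢i) A-Inv)
          (≡.trans (ℕₚ.+-suc (μ′ j) e) (≡.cong suc (≡.trans (≡.cong (ℕ._+ e) (off j j≢i)) degree)))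
          (begin
            (α i ∙ θ) ⟨ j ⟩           ≈⟨ ∙-⟨⟩ (α i) θ j ⟩
            α i * θ ⟨ j ⟩             ≈⟨ *-congˡ factor ⟩
            α i * (α j ^ μ j * A)     ≈⟨ solve 3 (λ a M A → a :* (M :* A) := M :* (a :* A)) refl (α i) _ A ⟩
            α j ^ μ j * (α i * A)     ≈⟨ *-congʳ (^-congʳ (α j) (off j j≢i)) ⟨
            α j ^ μ′ j * (α i * A)    ∎))
        λ e → Inv-resp (sym (∙-⟨⟩ (α i) θ (aux j))) (Inv-* (Inv-α j≢i) (prim (≡.trans (≡.sym (off j j≢i)) e)))

  Tight-raise : ∀ i {μ μ′ θ d} → Bump i μ μ′ → Tight i μ θ d → Tight i μ′ (α i ∙ θ) (suc d)
  Tight-raise i {μ} {μ′} {θ} (e , _) (tight {A = A} A-Inv degree factor) = tight A-Inv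
    (≡.trans (≡.cong (ℕ._+ _) e) (≡.cong suc degree)) (begin
      (α i ∙ θ) ⟨ i ⟩         ≈⟨ ∙-⟨⟩ (α i) θ i ⟩
      α i * θ ⟨ i ⟩           ≈⟨ *-congˡ factor ⟩
      α i * (α i ^ μ i * A)   ≈⟨ *-assoc _ _ _ ⟨
      α i ^ suc (μ i) * A     ≈⟨ *-congʳ (^-congʳ (α i) e) ⟨
      α i ^ μ′ i * A          ∎)

  ≗⇒Moved : ∀ i {μ μ′ θ d g} → μ′ i ≡ μ i → AgreeOff i μ μ′ → Basis μ θ d g → Moved i μ μ′ θ d d g
  ≗⇒Moved i {μ} {μ′} e off b = moved (Basis-resp same b) λ j j≢i x → Extremal-resp (off j j≢i) x
    where
    same : ∀ j → μ j ≡ μ′ j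
    same j with j Finₚ.≟ i
    ... | yes ≡.refl = ≡.sym e
    ... | no j≢i = ≡.sym (off j j≢i)

  raise-many : ∀ n i {μ μ′ θ d g} → μ′ i ≡ n ℕ.+ μ i → AgreeOff i μ μ′ →
    Basis μ θ d (n ℕ.+ g) → Tight i μ θ d → Moved i μ μ′ θ d (n ℕ.+ d) g
  raise-many zero i e off b T = ≗⇒Moved i e off b
  raise-many (suc n) i {μ} {μ′} {θ} {d} {g} e off b T = let μ₁ , bump@(e₁ , off₁) = successor i μ in
    ≡.subst (λ d″ → Moved i μ μ′ θ d d″ g) (ℕₚ.+-suc n d)
      (Moved-trans (Moved-raise i bump b T)
        (raise-many n i (≡.trans e (≡.trans (≡.sym (ℕₚ.+-suc n (μ i))) (≡.cong (n ℕ.+_) (≡.sym e₁))))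
          (λ j j≢i → ≡.trans (off j j≢i) (≡.sym (off₁ j j≢i)))
          (raise-out i bump b T) (Tight-raise i bump T)))

  lower-many : ∀ n i {μ μ′ θ d g} → μ i ≡ n ℕ.+ μ′ i → AgreeOff i μ μ′ →
    Basis μ θ d (n ℕ.+ g) → (∀ {m} → μ i ≡ suc m → Primitive i θ d) → Moved i μ μ′ θ d d g
  lower-many zero i e off b prim = ≗⇒Moved i (≡.sym e) off b
  lower-many (suc n) i {μ} {μ′} {θ} {d} {g} e off b prim = let μ₁ , bump@(e₁ , off₁) = predecessor i e in
    Moved-trans (moved (lower-out i bump b (prim e)) λ j j≢i x → Extremal-resp (≡.sym (off₁ j j≢i)) x)
      (lower-many n i (ℕₚ.suc-injective (≡.trans (≡.sym e₁) e))
        (λ j j≢i → ≡.trans (off j j≢i) (off₁ j j≢i))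
        (lower-out i bump b (prim e)) λ _ → prim e)

  move : ∀ i {μ μ′ θ d g} → AgreeOff i μ μ′ → Basis μ θ d g → Extremal i μ θ d →
    ℕ.∣ μ i - μ′ i ∣ ℕ.≤ g → Moved i μ μ′ θ d (μ′ i ℕ.∸ μ i ℕ.+ d) (g ℕ.∸ ℕ.∣ μ i - μ′ i ∣)
  move i {μ} {μ′} {θ} {d} {g} off b x h with ℕₚ.≤-total (μ i) (μ′ i)
  ... | inj₁ μ≤μ′ rewrite ℕₚ.m≤n⇒∣m-n∣≡n∸m μ≤μ′ = raise-many (μ′ i ℕ.∸ μ i) i
    (≡.sym (ℕₚ.m∸n+n≡m μ≤μ′)) off (≡.subst (Basis μ θ d) (≡.sym (ℕₚ.m+[n∸m]≡n h)) b) (is-tight x)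
  ... | inj₂ μ′≤μ rewrite ℕₚ.m≤n⇒∣n-m∣≡n∸m μ′≤μ | ℕₚ.m≤n⇒m∸n≡0 μ′≤μ = lower-many (μ i ℕ.∸ μ′ i) i
    (≡.sym (ℕₚ.m∸n+n≡m μ′≤μ)) off (≡.subst (Basis μ θ d) (≡.sym (ℕₚ.m+[n∸m]≡n h)) b) (is-primitive x)

  -- The entries are adjusted one after another. Raising multiplies the low element and adds to its
  -- degree, lowering leaves it alone, and each unit of distance costs one unit of gap.
  cone : ∀ {μ μ′ θ d g} → Basis μ θ d g → (∀ i → Extremal i μ θ d) → dist μ μ′ ℕ.≤ g →
    ∃ λ θ″ → Basis μ′ θ″ (excess μ μ′ ℕ.+ d) (g ℕ.∸ dist μ μ′)
  cone {μ} {μ′} {θ} {d} {g} b x h = _ , ≡.subst₂ (Basis μ′ _) degree-eq gap-eq b₃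
    where
    a = ℕ.∣ μ 0F - μ′ 0F ∣ ; a′ = ℕ.∣ μ 1F - μ′ 1F ∣ ; a″ = ℕ.∣ μ 2F - μ′ 2F ∣
    μ₁ μ₂ : Mult
    μ₁ = λ { 0F → μ′ 0F ; 1F → μ 1F ; 2F → μ 2F }
    μ₂ = λ { 0F → μ′ 0F ; 1F → μ′ 1F ; 2F → μ 2F }
    bound₂ : a ℕ.+ a′ ℕ.≤ g
    bound₂ = ℕₚ.≤-trans (ℕₚ.m≤m+n _ a″) h
    M₁ : Moved 0F μ μ₁ θ d (μ′ 0F ℕ.∸ μ 0F ℕ.+ d) (g ℕ.∸ a)
    M₁ = move 0F (λ { 0F ne → contradiction ≡.refl ne ; 1F _ → ≡.refl ; 2F _ → ≡.refl }) b (x 0F)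
      (ℕₚ.≤-trans (ℕₚ.m≤m+n a a′) bound₂)
    M₂ : Moved 1F μ₁ μ₂ (Moved.θ″ M₁) _ _ (g ℕ.∸ a ℕ.∸ a′)
    M₂ = move 1F (λ { 0F _ → ≡.refl ; 1F ne → contradiction ≡.refl ne ; 2F _ → ≡.refl })
      (Moved.new-basis M₁) (Moved.preserved M₁ 1F (λ ()) (x 1F))
      (ℕₚ.m+n≤o⇒m≤o∸n a′ (≡.subst (ℕ._≤ g) (ℕₚ.+-comm a a′) bound₂))
    M₃ : Moved 2F μ₂ μ′ (Moved.θ″ M₂) _ _ (g ℕ.∸ a ℕ.∸ a′ ℕ.∸ a″)
    M₃ = move 2F (λ { 0F _ → ≡.refl ; 1F _ → ≡.refl ; 2F ne → contradiction ≡.refl ne })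
      (Moved.new-basis M₂) (Moved.preserved M₂ 2F (λ ()) (Moved.preserved M₁ 2F (λ ()) (x 2F)))
      (≡.subst (a″ ℕ.≤_) (≡.sym (ℕₚ.∸-+-assoc g a a′))
        (ℕₚ.m+n≤o⇒m≤o∸n a″ (≡.subst (ℕ._≤ g) (ℕₚ.+-comm _ a″) h)))
    b₃ = Moved.new-basis M₃
    degree-eq : μ′ 2F ℕ.∸ μ 2F ℕ.+ (μ′ 1F ℕ.∸ μ 1F ℕ.+ (μ′ 0F ℕ.∸ μ 0F ℕ.+ d)) ≡ excess μ μ′ ℕ.+ d
    degree-eq = reverse (μ′ 0F ℕ.∸ μ 0F) (μ′ 1F ℕ.∸ μ 1F) (μ′ 2F ℕ.∸ μ 2F) d
      where
      reverse : ∀ a b c d → c ℕ.+ (b ℕ.+ (a ℕ.+ d)) ≡ a ℕ.+ b ℕ.+ c ℕ.+ d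
      reverse = solve-∀
    gap-eq : g ℕ.∸ a ℕ.∸ a′ ℕ.∸ a″ ≡ g ℕ.∸ dist μ μ′
    gap-eq = ≡.trans (≡.cong (ℕ._∸ a″) (ℕₚ.∸-+-assoc g a a′)) (ℕₚ.∸-+-assoc g (a ℕ.+ a′) a″)

  -- Calculus of derivations and the Frobenius map in characteristic p.

  module _ (D : Derivation R) where
    open Derivation D

    ∂-0 : ∂ 0# ≈ 0#
    ∂-0 = begin
      ∂ 0#                      ≈⟨ solve 1 (λ z → z := z :+ z :- z) refl _ ⟩
      ∂ 0# + ∂ 0# - ∂ 0#        ≈⟨ +-congʳ (∂-+ 0# 0#) ⟨
      ∂ (0# + 0#) - ∂ 0#        ≈⟨ +-congʳ (∂-cong (+-identityˡ 0#)) ⟩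
      ∂ 0# - ∂ 0#               ≈⟨ -‿inverseʳ _ ⟩
      0#                        ∎

    ∂-1 : ∂ 1# ≈ 0#
    ∂-1 = begin
      ∂ 1#                               ≈⟨ solve 1 (λ z → z := (z :* :1 :+ :1 :* z) :- z) refl _ ⟩
      (∂ 1# * 1# + 1# * ∂ 1#) - ∂ 1#     ≈⟨ +-congʳ (∂-* 1# 1#) ⟨
      ∂ (1# * 1#) - ∂ 1#                 ≈⟨ +-congʳ (∂-cong (*-identityˡ 1#)) ⟩
      ∂ 1# - ∂ 1#                        ≈⟨ -‿inverseʳ _ ⟩
      0#                                 ∎

    ∂-neg : ∀ P → ∂ (- P) ≈ - ∂ P
    ∂-neg P = begin
      ∂ (- P)                      ≈⟨ solve 2 (λ a b → a := (a :+ b) :- b) refl _ (∂ P) ⟩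
      (∂ (- P) + ∂ P) - ∂ P        ≈⟨ +-congʳ (∂-+ (- P) P) ⟨
      ∂ (- P + P) - ∂ P            ≈⟨ +-congʳ (trans (∂-cong (-‿inverseˡ P)) ∂-0) ⟩
      0# - ∂ P                     ≈⟨ +-identityˡ _ ⟩
      - ∂ P                        ∎

    -- Multiplied by P, the power rule needs no case distinction on the exponent.
    ∂-^ : ∀ P n → P * ∂ (P ^ n) ≈ n · 1# * ∂ P * P ^ n
    ∂-^ P zero = trans (*-congˡ ∂-1) (solve 2 (λ P a → P :* :0 := :0 :* a :* :1) refl P (∂ P))
    ∂-^ P (suc n) = begin
      P * ∂ (P * P ^ n)                             ≈⟨ *-congˡ (∂-* P (P ^ n)) ⟩
      P * (∂ P * P ^ n + P * ∂ (P ^ n))             ≈⟨ *-congˡ (+-congˡ (∂-^ P n)) ⟩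
      P * (∂ P * P ^ n + n · 1# * ∂ P * P ^ n)
        ≈⟨ solve 4 (λ P a M k → P :* (a :* M :+ k :* a :* M) := (:1 :+ k) :* a :* (P :* M))
             refl P (∂ P) (P ^ n) (n · 1#) ⟩
      (1# + n · 1#) * ∂ P * (P * P ^ n)             ∎

    ∂-factor : ∀ M n A → M * ∂ (M ^ n * A) ≈ M ^ n * (n · 1# * ∂ M * A + M * ∂ A)
    ∂-factor M n A = begin
      M * ∂ (M ^ n * A)                          ≈⟨ *-congˡ (∂-* (M ^ n) A) ⟩
      M * (∂ (M ^ n) * A + M ^ n * ∂ A)
        ≈⟨ solve 5 (λ M a A N b → M :* (a :* A :+ N :* b) := (M :* a) :* A :+ N :* (M :* b)) refl M _ A (M ^ n) (∂ A) ⟩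
      (M * ∂ (M ^ n)) * A + M ^ n * (M * ∂ A)    ≈⟨ +-congʳ (*-congʳ (∂-^ M n)) ⟩
      (n · 1# * ∂ M * M ^ n) * A + M ^ n * (M * ∂ A)
        ≈⟨ solve 6 (λ k a N A M b → k :* a :* N :* A :+ N :* (M :* b) := N :* (k :* a :* A :+ M :* b))
             refl (n · 1#) (∂ M) (M ^ n) A M (∂ A) ⟩
      M ^ n * (n · 1# * ∂ M * A + M * ∂ A)       ∎

    ∂-∣ : ∀ {M} n {Q} → (M ^ n) ∣ Q → (M ^ n) ∣ (M * ∂ Q)
    ∂-∣ {M} n (A , h) = _ , trans (*-congˡ (∂-cong h)) (∂-factor M n A)

    ∂-∣-constant : ∀ {M} n {Q} → Regular M → ∂ M ≈ 0# → (M ^ n) ∣ Q → (M ^ n) ∣ ∂ Q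
    ∂-∣-constant {M} n {Q} reg ∂M≈0 (A , h) = ∂ A , cancel reg (begin
      M * ∂ Q                                    ≈⟨ trans (*-congˡ (∂-cong h)) (∂-factor M n A) ⟩
      M ^ n * (n · 1# * ∂ M * A + M * ∂ A)       ≈⟨ *-congˡ (+-congʳ (*-congʳ (*-congˡ ∂M≈0))) ⟩
      M ^ n * (n · 1# * 0# * A + M * ∂ A)
        ≈⟨ solve 5 (λ N k A M b → N :* (k :* :0 :* A :+ M :* b) := M :* (N :* b)) refl (M ^ n) (n · 1#) A M (∂ A) ⟩
      M * (M ^ n * ∂ A)                          ∎)

    -- M ∂(M^n A) = M^n (n A + M ∂A) when ∂M = 1. If this vanishes, n A = -M ∂A.
    kernel-∣ : ∀ {M} n {A} → Regular M → ∂ M ≈ 1# → ∂ (M ^ n * A) ≈ 0# → M ∣ (A * n · 1#)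
    kernel-∣ {M} n {A} reg ∂M≈1 h = - ∂ A , x-y≈0⇒x≈y (Regular-^ reg n (begin
      M ^ n * (A * n · 1# - M * (- ∂ A))
        ≈⟨ solve 5 (λ N A k M b → N :* (A :* k :- M :* (:- b)) := N :* (k :* :1 :* A :+ M :* b)) refl (M ^ n) A (n · 1#) M (∂ A) ⟩
      M ^ n * (n · 1# * 1# * A + M * ∂ A)        ≈⟨ *-congˡ (+-congʳ (*-congʳ (*-congˡ ∂M≈1))) ⟨
      M ^ n * (n · 1# * ∂ M * A + M * ∂ A)       ≈⟨ ∂-factor M n A ⟨
      M * ∂ (M ^ n * A)                          ≈⟨ trans (*-congˡ h) (zeroʳ M) ⟩
      0#                                         ∎))

    ∂-^p : ∀ {P} → Regular P → ∂ (P ^ p) ≈ 0#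
    ∂-^p {P} reg = reg (trans (∂-^ P p) (trans (*-congʳ (*-congʳ char⇒))
      (solve 2 (λ a b → :0 :* a :* b := :0) refl (∂ P) (P ^ p))))

    -- If ∂ kills M^n A, then M divides n A, and n is invertible for 0 < n < p.
    p-th-power : ∀ i {P} → ∂ (α i) ≈ 1# → ∂ P ≈ 0# → α i ∣ P → (α i ^ p) ∣ P
    p-th-power i {P} ∂α≈1 ∂P≈0 h = go p ℕₚ.≤-refl
      where
      raise-power : ∀ n → suc n ℕ.< p → (α i ^ suc n) ∣ P → (α i ^ suc (suc n)) ∣ P
      raise-power n n<p (A , P≈) with constant (Hom-· (suc n))
      ... | inj₁ n≈0 = contradiction (ℕᵈ.∣⇒≤ (char⇐ (suc n) n≈0)) (ℕₚ.<⇒≱ n<p)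
      ... | inj₂ (v , _ , vn≈1) = B , trans P≈ (trans (*-congˡ A≈)
          (solve 3 (λ N a B → N :* (a :* B) := a :* N :* B) refl _ (α i) B))
        where
        q = ∣-*ˡ v (kernel-∣ (suc n) (α-cancel₀ i) ∂α≈1 (trans (∂-cong (sym P≈)) ∂P≈0))
        B = proj₁ q
        A≈ : A ≈ α i * B
        A≈ = begin
          A                          ≈⟨ *-identityˡ A ⟨
          1# * A                     ≈⟨ *-congʳ vn≈1 ⟨
          v * suc n · 1# * A         ≈⟨ solve 3 (λ v k A → v :* k :* A := v :* (A :* k)) refl v (suc n · 1#) A ⟩
          v * (A * suc n · 1#)       ≈⟨ proj₂ q ⟩
          α i * B                    ∎
      go : ∀ n → n ℕ.≤ p → (α i ^ n) ∣ P
      go zero _ = 1∣ P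
      go (suc zero) _ = proj₁ h , trans (proj₂ h) (*-congʳ (sym (*-identityʳ _)))
      go (suc (suc n)) n<p = raise-power n n<p (go (suc n) (ℕₚ.<⇒≤ n<p))

  ^-∣ : ∀ {M P Q} → M ∣ (P - Q) → ∀ n → M ∣ (P ^ n - Q ^ n)
  ^-∣ h zero = ∣-zero (-‿inverseʳ 1#)
  ^-∣ {M} {P} {Q} h (suc n) = ∣-resp
    (solve 4 (λ P Q N L → P :* (N :- L) :+ (P :- Q) :* L := P :* N :- Q :* L) refl P Q (P ^ n) (Q ^ n))
    (∣-+ (∣-*ˡ P (^-∣ h n)) (∣-*ʳ (Q ^ n) h))

  ∣^ : ∀ {M} n → .{{ℕ.NonZero n}} → M ∣ (M ^ n)
  ∣^ (suc n) = ∣-*ʳ _ ∣-refl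

  -- The difference is a form of degree p killed by both derivations and vanishing on the axes,
  -- hence divisible by x^p y^p.
  freshman : (X + Y) ^ p ≈ X ^ p + Y ^ p
  freshman = x-y≈0⇒x≈y (vanish (mon-Hom ν) homE p<2p (mon-∣ ν λ where
      0F → p-th-power derivX 0F ∂x-X (∂E derivX) (∣-resp (solve 3 (λ a b c → (a :- c) :- b := a :- (b :+ c)) refl _ _ _)
        (∣-- (^-∣ {X} (1# , solve 2 (λ X Y → X :+ Y :- Y := X :* :1) refl X Y) p) (∣^ p {{prime⇒nonZero p-prime}})))
      1F → p-th-power derivY 1F ∂y-Y (∂E derivY) (∣-resp (solve 3 (λ a b c → (a :- c) :- b := a :- (c :+ b)) refl _ _ _)
        (∣-- (^-∣ {Y} (1# , solve 2 (λ X Y → X :+ Y :- X := Y :* :1) refl X Y) p) (∣^ p {{prime⇒nonZero p-prime}})))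
      2F → 1∣ _))
    where
    ν : Mult
    ν = λ { 0F → p ; 1F → p ; 2F → 0 }
    E = (X + Y) ^ p - (X ^ p + Y ^ p)
    homE : Hom p E
    homE = Hom-- (Hom-^ (Hom-α 2F) p) (Hom-+ (Hom-^ Hom-X p) (Hom-^ Hom-Y p))
    p<2p : p ℕ.< p ℕ.+ p ℕ.+ 0
    p<2p = ≡.subst (p ℕ.<_) (≡.sym (ℕₚ.+-identityʳ _)) (ℕₚ.m<m+n p (ℕ.>-nonZero⁻¹ p {{prime⇒nonZero p-prime}}))
    ∂E : ∀ D → Derivation.∂ D E ≈ 0#
    ∂E D = begin
      ∂ E                                            ≈⟨ ∂-+ _ _ ⟩
      ∂ ((X + Y) ^ p) + ∂ (- (X ^ p + Y ^ p))        ≈⟨ +-congˡ (trans (∂-neg D _) (-‿cong (∂-+ _ _))) ⟩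
      ∂ ((X + Y) ^ p) - (∂ (X ^ p) + ∂ (Y ^ p))
        ≈⟨ +-cong (∂-^p D (α-cancel₀ 2F)) (-‿cong (+-cong (∂-^p D X-cancel) (∂-^p D Y-cancel))) ⟩
      0# - (0# + 0#)                                 ≈⟨ solve 0 (:0 :- (:0 :+ :0) := :0) refl ⟩
      0#                                             ∎
      where open Derivation D

  -- Frobenius

  Fr-α : ∀ i → Fr (α i) ≈ α i ^ p
  Fr-α 0F = Fr-X
  Fr-α 1F = Fr-Y
  Fr-α 2F = trans (Fr-+ X Y) (trans (+-cong Fr-X Fr-Y) (sym freshman))

  Fr-^ : ∀ P n → Fr (P ^ n) ≈ Fr P ^ n
  Fr-^ P zero = Fr-1
  Fr-^ P (suc n) = trans (Fr-* P (P ^ n)) (*-congˡ (Fr-^ P n))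

  Fr-α^ : ∀ i n → Fr (α i ^ n) ≈ α i ^ (p ℕ.* n)
  Fr-α^ i n = trans (Fr-^ (α i) n) (trans (^-congˡ n (Fr-α i)) (^-assocʳ (α i) p n))

  Fr-mon : ∀ μ → Fr (mon μ) ≈ mon (scale p μ)
  Fr-mon μ = trans (Fr-* _ _) (*-cong (Fr-α^ 0F (μ 0F))
    (trans (Fr-* _ _) (*-cong (Fr-α^ 1F (μ 1F)) (Fr-α^ 2F (μ 2F)))))

  Fr-∣ : ∀ i n {P} → (α i ^ n) ∣ P → (α i ^ (p ℕ.* n)) ∣ Fr P
  Fr-∣ i n (A , h) = Fr A , trans (Fr-cong h) (trans (Fr-* _ A) (*-congʳ (Fr-α^ i n)))

  -- The projection formula π(Fr P · Q) = P · π Q pulls the factor Fr(α_i^n) out as α_i^n.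
  π-∣ : ∀ i n {P} → (α i ^ (p ℕ.* n)) ∣ P → (α i ^ n) ∣ π P
  π-∣ i n (A , h) = π A , trans (π-cong (trans h (*-congʳ (sym (Fr-α^ i n))))) (π-Fr (α i ^ n) A)

  FrPair : Pair → Pair
  FrPair (F , G) = Fr F , Fr G

  FrPair-⟨⟩ : ∀ θ i → FrPair θ ⟨ i ⟩ ≈ Fr (θ ⟨ i ⟩)
  FrPair-⟨⟩ θ 0F = refl
  FrPair-⟨⟩ θ 1F = refl
  FrPair-⟨⟩ (F , G) 2F = sym (Fr-+ F G)

  -- `Fr` sends each α_i to its p-th power, for x + y by `freshman`. It therefore carries membership
  -- and the determinant from μ to pμ.
  frobenius : ∀ {μ θ d g} → Basis μ θ d g → Basis (scale p μ) (FrPair θ) (p ℕ.* d) (p ℕ.* g)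
  frobenius {μ} {θ@(F , G)} {d} {g} b = record
    { θ′ = FrPair (θ′ b)
    ; hom = λ i → Hom-resp (sym (FrPair-⟨⟩ θ i)) (Fr-Hom (hom b i))
    ; hom′ = λ i → Hom-≡ (ℕₚ.*-distribˡ-+ p d g) (Hom-resp (sym (FrPair-⟨⟩ (θ′ b) i)) (Fr-Hom (hom′ b i)))
    ; div = mkD λ i → ∣-resp (sym (FrPair-⟨⟩ θ i)) (Fr-∣ i (μ i) (member (div b) i))
    ; div′ = mkD λ i → ∣-resp (sym (FrPair-⟨⟩ (θ′ b) i)) (Fr-∣ i (μ i) (member (div′ b) i))
    ; det≈ = begin
        Fr F * Fr G′ - Fr G * Fr F′                                ≈⟨ +-cong (Fr-* F G′) (-‿cong (Fr-* G F′)) ⟨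
        Fr (F * G′) - Fr (G * F′)
          -- Compatibility of `Fr` with subtraction is derived from additivity by adding G F′ back.
          ≈⟨ +-congʳ (Fr-cong (solve 2 (λ a b → a := (a :- b) :+ b) refl _ (G * F′))) ⟩
        Fr ((F * G′ - G * F′) + G * F′) - Fr (G * F′)              ≈⟨ +-congʳ (Fr-+ _ _) ⟩
        Fr (F * G′ - G * F′) + Fr (G * F′) - Fr (G * F′)
          ≈⟨ solve 2 (λ a b → a :+ b :- b := a) refl _ _ ⟩
        Fr (F * G′ - G * F′)                                       ≈⟨ Fr-cong (det≈ b) ⟩
        Fr (mon μ)                                                 ≈⟨ Fr-mon μ ⟩
        mon (scale p μ)                                            ∎
    ; total = ≡.trans (≡.sym (≡.trans (ℕₚ.*-distribˡ-+ p d _) (≡.cong (p ℕ.* d ℕ.+_) (ℕₚ.*-distribˡ-+ p d g))))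
        (≡.trans (≡.cong (p ℕ.*_) (total b)) (size-scale p μ)) }
    where
    F′ = proj₁ (θ′ b) ; G′ = proj₂ (θ′ b)

  frobenius^ : ∀ k {μ θ d g} → Basis μ θ d g →
    ∃ λ η → Basis (scale (p ℕ.^ k) μ) η (p ℕ.^ k ℕ.* d) (p ℕ.^ k ℕ.* g)
  frobenius^ zero {μ} {d = d} {g} b = _ , Basis-resp (λ i → ≡.sym (ℕₚ.+-identityʳ (μ i)))
    (≡.subst₂ (Basis μ _) (≡.sym (ℕₚ.+-identityʳ d)) (≡.sym (ℕₚ.+-identityʳ g)) b)
  frobenius^ (suc k) {μ} {d = d} {g} b = let η , b′ = frobenius^ k b in
    FrPair η , Basis-resp (λ i → ≡.sym (ℕₚ.*-assoc p (p ℕ.^ k) (μ i)))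
      (≡.subst₂ (Basis _ _) (≡.sym (ℕₚ.*-assoc p (p ℕ.^ k) d)) (≡.sym (ℕₚ.*-assoc p (p ℕ.^ k) g)) (frobenius b′))

  -- Peaks of gap at least two

  rotate : ∀ j i → i ≡ j ⊎ i ≡ next j ⊎ i ≡ next (next j)
  rotate 0F 0F = inj₁ ≡.refl
  rotate 0F 1F = inj₂ (inj₁ ≡.refl)
  rotate 0F 2F = inj₂ (inj₂ ≡.refl)
  rotate 1F 0F = inj₂ (inj₂ ≡.refl)
  rotate 1F 1F = inj₁ ≡.refl
  rotate 1F 2F = inj₂ (inj₁ ≡.refl)
  rotate 2F 0F = inj₂ (inj₁ ≡.refl)
  rotate 2F 1F = inj₂ (inj₂ ≡.refl)
  rotate 2F 2F = inj₁ ≡.refl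

  module _ (D : Derivation R)
    (part-∂ : ∀ n P → part n (Derivation.∂ D P) ≈ Derivation.∂ D (part (suc n) P)) where
    open Derivation D

    Hom-∂ : ∀ {d P} → Hom (suc d) P → Hom d (∂ P)
    Hom-∂ {d} h = trans (part-∂ d _) (∂-cong h)

    -- The Wronskian F ∂G − G ∂F is divisible by mon μ up to the two linear forms not killed by ∂,
    -- and its degree is too small for that.
    wronskian : ∀ j → ∂ (α j) ≈ 0# →
      ∀ {μ θ d g} → Basis μ θ (suc d) (suc (suc g)) → θ ⟨ 0F ⟩ * ∂ (θ ⟨ 1F ⟩) ≈ θ ⟨ 1F ⟩ * ∂ (θ ⟨ 0F ⟩)
    wronskian j ∂αj≈0 {μ} {θ@(F , G)} {d} {g} b =
      x-y≈0⇒x≈y (α-cancel₀ (next (next j)) (α-cancel₀ (next j)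
        (vanish {M = mon μ} (mon-Hom μ) (Hom-* (Hom-α (next j)) (Hom-* (Hom-α (next (next j))) homW)) small (mon-∣ μ powers))))
      where
      ∂θ : Pair
      ∂θ = ∂ F , ∂ G
      ∂θ-⟨⟩ : ∀ i → ∂θ ⟨ i ⟩ ≈ ∂ (θ ⟨ i ⟩)
      ∂θ-⟨⟩ 0F = refl
      ∂θ-⟨⟩ 1F = refl
      ∂θ-⟨⟩ 2F = sym (∂-+ F G)
      W = det θ ∂θ
      homW : Hom (suc d ℕ.+ d) W
      homW = Hom-- (Hom-* (hom b 0F) (Hom-∂ (hom b 1F))) (Hom-* (hom b 1F) (Hom-∂ (hom b 0F)))
      αW : ∀ i → (α i ^ μ i) ∣ (α i * W)
      αW i = ∣-resp (solve 5 (λ F G a F′ G′ → F :* (a :* G′) :- G :* (a :* F′) := a :* (F :* G′ :- G :* F′))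
          refl F G (α i) (∂ F) (∂ G))
        (det-∣ i {θ = θ} {α i ∙ ∂θ} (member (div b) i)
          (∣-resp (sym (trans (∙-⟨⟩ (α i) ∂θ i) (*-congˡ (∂θ-⟨⟩ i)))) (∂-∣ D (μ i) (member (div b) i))))
      powers : ∀ i → (α i ^ μ i) ∣ (α (next j) * (α (next (next j)) * W))
      powers i with rotate j i
      ... | inj₁ ≡.refl = ∣-*ˡ _ (∣-*ˡ _ (det-∣ j {θ = θ} {∂θ} (member (div b) j)
        (∣-resp (sym (∂θ-⟨⟩ j)) (∂-∣-constant D (μ j) (α-cancel₀ j) ∂αj≈0 (member (div b) j)))))
      ... | inj₂ (inj₁ ≡.refl) = ∣-resp (solve 3 (λ a b W → b :* (a :* W) := a :* (b :* W)) refl _ _ W)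
        (∣-*ˡ (α (next (next j))) (αW (next j)))
      ... | inj₂ (inj₂ ≡.refl) = ∣-*ˡ _ (αW (next (next j)))
      small : 1 ℕ.+ (1 ℕ.+ (suc d ℕ.+ d)) ℕ.< size μ
      small = ≡.subst (1 ℕ.+ (1 ℕ.+ (suc d ℕ.+ d)) ℕ.<_) (total b) (wronskian-degree d g)

    -- Coprimality turns F ∂G = G ∂F into ∂F = F Z and ∂G = G Z, which is impossible for nonzero
    -- derivatives by degree.
    wronskian⇒∂≈0 : ∀ {μ θ d g} → Basis μ θ (suc d) g → (∀ i → Extremal i μ θ (suc d)) →
      θ ⟨ 0F ⟩ * ∂ (θ ⟨ 1F ⟩) ≈ θ ⟨ 1F ⟩ * ∂ (θ ⟨ 0F ⟩) → ∀ i → ∂ (θ ⟨ i ⟩) ≈ 0#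
    wronskian⇒∂≈0 {θ = θ@(F , G)} {d} b x h = λ where
        0F → ∂F≈0
        1F → ∂G≈0
        2F → trans (∂-+ F G) (trans (+-cong ∂F≈0 ∂G≈0) (+-identityˡ 0#))
      where
      q = coprime b (λ i → Extremal.is-primitive (x i)) h
      ∂F≈0 : ∂ F ≈ 0#
      ∂F≈0 = vanish (hom b 0F) (Hom-∂ (hom b 0F)) ℕₚ.≤-refl (proj₁ q , proj₁ (proj₂ q))
      ∂G≈0 : ∂ G ≈ 0#
      ∂G≈0 = vanish (hom b 1F) (Hom-∂ (hom b 1F)) ℕₚ.≤-refl (proj₁ q , proj₂ (proj₂ q))

  -- ξ is some element of D(ν), not claimed to belong to a basis. Its first component is what
  -- `minimal-degree` compares degrees with.
  record Descent (μ : Mult) (d : ℕ) : Set where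
    field
      ν : Mult
      μ≡pν : ∀ i → μ i ≡ p ℕ.* ν i
      d₁ : ℕ
      d≡pd₁ : d ≡ p ℕ.* d₁
      ξ : Pair
      ξ-Hom : Hom d₁ (ξ ⟨ 0F ⟩)
      ξ-∈D : ξ ∈D ν
      ξ≉0 : ¬ (ξ ⟨ 0F ⟩ ≈ 0#)

  descend : ∀ {μ θ d g} → Basis μ θ (suc d) (suc (suc g)) → Nonvanishing θ →
    (∀ i → Extremal i μ θ (suc d)) → Descent μ (suc d)
  descend {μ} {θ@(F , G)} {d} b nv x = record
    { ν = ν
    ; μ≡pν = μ≡pν
    ; d₁ = ℕᵈ.quotient p∣d
    ; d≡pd₁ = d≡pd₁
    ; ξ = ξ₀
    ; ξ-Hom = π-Hom (Hom-≡ d≡pd₁ (hom b 0F))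
    ; ξ-∈D = mkD λ i → ∣-resp (sym (ξ₀-⟨⟩ i))
        (π-∣ i (ν i) (≡.subst (λ n → (α i ^ n) ∣ (θ ⟨ i ⟩)) (μ≡pν i) (member (div b) i)))
    ; ξ≉0 = λ h → nv 0F (π-injective (∂xθ≈0 0F) (∂yθ≈0 0F) h) }
    where
    ∂xθ≈0 : ∀ i → ∂x (θ ⟨ i ⟩) ≈ 0#
    ∂xθ≈0 = wronskian⇒∂≈0 derivX part-∂x b x (wronskian derivX part-∂x 1F ∂x-Y b)
    ∂yθ≈0 : ∀ i → ∂y (θ ⟨ i ⟩) ≈ 0#
    ∂yθ≈0 = wronskian⇒∂≈0 derivY part-∂y b x (wronskian derivY part-∂y 0F ∂y-X b)
    -- θ(α_i) = α_i^(μ_i) A has derivative 0, so α_i divides μ_i A. As A is invertible modulo α_i,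
    -- the constant μ_i is divisible by α_i and vanishes in the ring.
    p∣exponent : ∀ D i → Derivation.∂ D (α i) ≈ 1# → Derivation.∂ D (θ ⟨ i ⟩) ≈ 0# → p ℕᵈ.∣ μ i
    p∣exponent D i ∂α≈1 ∂θ≈0 = char⇐ (μ i) (vanish (Hom-α i) (Hom-· (μ i)) (s≤s z≤n)
      (Inv-∣ (Tight.A-Inv T) (kernel-∣ D (μ i) (α-cancel₀ i) ∂α≈1
        (trans (Derivation.∂-cong D (sym (Tight.factor T))) ∂θ≈0))))
      where T = Extremal.is-tight (x i)
    p∣μ : ∀ i → p ℕᵈ.∣ μ i
    p∣μ 0F = p∣exponent derivX 0F ∂x-X (∂xθ≈0 0F)
    p∣μ 1F = p∣exponent derivY 1F ∂y-Y (∂yθ≈0 1F)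
    p∣μ 2F = p∣exponent derivX 2F
      (trans (Derivation.∂-+ derivX X Y) (trans (+-cong ∂x-X ∂x-Y) (+-identityʳ 1#))) (∂xθ≈0 2F)
    -- By Euler's formula the degree times F is x ∂xF + y ∂yF = 0; an invertible degree would force
    -- F = 0.
    p∣d : p ℕᵈ.∣ suc d
    p∣d = split (constant (Hom-· (suc d)))
      where
      dF≈0 : suc d · 1# * F ≈ 0#
      dF≈0 = begin
        suc d · 1# * F          ≈⟨ ×-assoc-* (suc d) 1# F ⟩
        suc d · (1# * F)        ≈⟨ ×-congʳ (suc d) (*-identityˡ F) ⟩
        suc d · F               ≈⟨ euler (hom b 0F) ⟨
        X * ∂x F + Y * ∂y F     ≈⟨ +-cong (*-congˡ (∂xθ≈0 0F)) (*-congˡ (∂yθ≈0 0F)) ⟩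
        X * 0# + Y * 0#         ≈⟨ trans (+-cong (zeroʳ X) (zeroʳ Y)) (+-identityˡ 0#) ⟩
        0#                      ∎
      split : suc d · 1# ≈ 0# ⊎ (∃ λ v → Hom 0 v × v * suc d · 1# ≈ 1#) → p ℕᵈ.∣ suc d
      split (inj₁ d≈0) = char⇐ (suc d) d≈0
      split (inj₂ (v , _ , vd≈1)) = contradiction (begin
        F                         ≈⟨ *-identityˡ F ⟨
        1# * F                    ≈⟨ *-congʳ vd≈1 ⟨
        v * suc d · 1# * F        ≈⟨ *-assoc v _ F ⟩
        v * (suc d · 1# * F)      ≈⟨ trans (*-congˡ dF≈0) (zeroʳ v) ⟩
        0#                        ∎) (nv 0F)
    ν : Mult
    ν i = ℕᵈ.quotient (p∣μ i)
    μ≡pν : ∀ i → μ i ≡ p ℕ.* ν i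
    μ≡pν i = ≡.trans (ℕᵈ._∣_.equality (p∣μ i)) (ℕₚ.*-comm _ p)
    d≡pd₁ : suc d ≡ p ℕ.* ℕᵈ.quotient p∣d
    d≡pd₁ = ≡.trans (ℕᵈ._∣_.equality p∣d) (ℕₚ.*-comm _ p)
    ξ₀ : Pair
    ξ₀ = π F , π G
    ξ₀-⟨⟩ : ∀ i → ξ₀ ⟨ i ⟩ ≈ π (θ ⟨ i ⟩)
    ξ₀-⟨⟩ 0F = refl
    ξ₀-⟨⟩ 1F = refl
    ξ₀-⟨⟩ 2F = sym (π-+ F G)

  -- The gap bound by induction on the degree.

  minimal-degree : ∀ {μ θ d g η e} → Basis μ θ d g → η ∈D μ → Hom e (η ⟨ 0F ⟩) → ¬ (η ⟨ 0F ⟩ ≈ 0#) → d ℕ.≤ e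
  minimal-degree {μ} {θ} {d} {g} {η} {e} b m homη η≉0 = ℕₚ.≮⇒≥ λ e<d → η≉0 (let s , t , h , _ = span b m in begin
    η ⟨ 0F ⟩                                                 ≈⟨ homη ⟨
    part e (η ⟨ 0F ⟩)                                        ≈⟨ part-cong e h ⟩
    part e (s * θ ⟨ 0F ⟩ + t * θ′ b ⟨ 0F ⟩)                  ≈⟨ part-+ e _ _ ⟩
    part e (s * θ ⟨ 0F ⟩) + part e (t * θ′ b ⟨ 0F ⟩)
      -- Both basis elements have degree above e, so no multiple of them has a component there.
      ≈⟨ +-cong (low (hom b 0F) e<d s) (low (hom′ b 0F) (ℕₚ.<-≤-trans e<d (ℕₚ.m≤m+n d g)) t) ⟩
    0# + 0#                                                  ≈⟨ +-identityˡ 0# ⟩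
    0#                                                       ∎)
    where
    low : ∀ {n P} → Hom n P → e ℕ.< n → ∀ s → part e (s * P) ≈ 0#
    low {n} {P} homP e<n s = begin
      part e (s * P)             ≈⟨ part-cong e (trans (*-comm s P) (*-congʳ (sym homP))) ⟩
      part e (part n P * s)      ≈⟨ part-*-< e<n P s ⟩
      0#                         ∎

  -- A bound n on the low degree drives the mutual induction. Climbing does not raise this degree,
  -- and undoing Frobenius divides it by p, so n falls once per descent.
  gap-bound : ∀ n {μ θ d g} → d ℕ.≤ n → Basis μ θ d g → Nonvanishing θ → 2 ℕ.≤ g → GapBound p μ g
  peak-gap-bound : ∀ n {μ θ d g} → d ℕ.≤ n → Basis μ θ d g → Nonvanishing θ → (∀ i → Extremal i μ θ d) →
    2 ℕ.≤ g → GapBound p μ g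
  descent-gap-bound : ∀ n {μ θ d g} → d ℕ.≤ n → Basis μ θ (suc d) (suc (suc g)) → Nonvanishing θ →
    Descent μ (suc d) → GapBound p μ (suc (suc g))

  gap-bound n {μ} d≤n b nv 2≤g = let P = climb b nv in GapBound-transfer {μ = μ} {Peak.top P} (Peak.gap P)
    (peak-gap-bound n (ℕₚ.≤-trans (Peak.d*≤d P) d≤n) (Peak.base P) (Peak.nonvanishing P) (Peak.is-extremal P)
      (ℕₚ.≤-trans 2≤g (ℕₚ.≤-trans (ℕₚ.m≤m+n _ _) (Peak.gap P))))

  peak-gap-bound n {d = zero} d≤n b nv x 2≤g = contradiction
    (ℕₚ.≤-trans 2≤g (≡.subst (ℕ._≤ 0) (≡.sym (total b)) (size≤4* (exponent≤degree b nv)))) λ ()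
  peak-gap-bound (suc n) (s≤s d≤n) b nv x (s≤s (s≤s z≤n)) = descent-gap-bound n d≤n b nv (descend b nv x)

  descent-gap-bound n {μ} {θ} {d} {g} d≤n b nv D =
    by-gap (proj₁ multiple) (proj₁ (proj₂ multiple)) (proj₂ (proj₂ multiple))
    where
    open Descent D
    instance
      p≢0 = prime⇒nonZero p-prime
    multiple = gap-multiple p d₁ {suc (suc g)} {size ν} (≡.trans
      (≡.cong (λ d → d ℕ.+ (d ℕ.+ suc (suc g))) (≡.sym d≡pd₁))
      (≡.trans (total b) (≡.trans (size-cong μ≡pν) (≡.sym (size-scale p ν)))))
    ν-bound : ∀ i → ν i ℕ.≤ d₁
    ν-bound i = ℕₚ.*-cancelˡ-≤ p (≡.subst₂ ℕ._≤_ (μ≡pν i) d≡pd₁ (exponent≤degree b nv i))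
    d₁≤n : d₁ ℕ.≤ n
    d₁≤n = ℕₚ.≤-trans (ℕₚ.≤-pred (≡.subst (d₁ ℕ.<_) (≡.sym d≡pd₁) (shrink d₁ d≡pd₁))) d≤n
      where
      shrink : ∀ m → suc d ≡ p ℕ.* m → m ℕ.< p ℕ.* m
      shrink zero e = contradiction (≡.trans e (ℕₚ.*-zeroʳ p)) λ ()
      shrink (suc m) _ = ≡.subst (suc m ℕ.<_) (ℕₚ.*-comm (suc m) p) (ℕₚ.m<m*n (suc m) p (ℕ.nonTrivial⇒n>1 p {{prime⇒nonTrivial p-prime}}))
    by-gap : ∀ h → suc (suc g) ≡ p ℕ.* h → d₁ ℕ.+ (d₁ ℕ.+ h) ≡ size ν → GapBound p μ (suc (suc g))
    by-gap zero e t = contradiction (≡.trans e (ℕₚ.*-zeroʳ p)) λ ()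
    -- |ν| = 2d₁ + 1 is odd and ν is balanced, so pν itself is the centre, at level 1.
    by-gap (suc zero) e t = ≡.subst (GapBound p μ) (≡.sym e)
      (GapBound-base {ν = ν} (bounded⇒balanced {ν} ν-bound t) (1+2n-odd {d₁} t) μ≡pν)
    -- The low degree of D(ν) is at most that of ξ, so its gap is at least h ≥ 2 and the induction
    -- applies.
    by-gap h@(suc (suc _)) e t =
      let φ , e₁ , g₁ , b₁ = basis ν
          e₁≤d₁ = minimal-degree b₁ ξ-∈D ξ-Hom ξ≉0
          h≤g₁ = larger-gap e₁≤d₁ (total b₁) t
          2≤g₁ = ℕₚ.≤-trans (s≤s (s≤s z≤n)) h≤g₁
          nv₁ = balanced⇒nonvanishing (bounded⇒balanced {ν} ν-bound t) (ℕₚ.<⇒≤ 2≤g₁) b₁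
      in ≡.subst (GapBound p μ) (≡.sym e)
           (GapBound-scale {ν = ν} μ≡pν h≤g₁ (gap-bound n (ℕₚ.≤-trans e₁≤d₁ d₁≤n) b₁ nv₁ 2≤g₁))

  -- A gap of 2 or more would put μ strictly inside a ball around an odd balanced centre, which is a
  -- good level.
  small-gap : ∀ {μ θ d g} → Balanced μ → (∀ m → ¬ GoodLevel p μ (suc m)) → Basis μ θ d g → g ℕ.≤ 1
  small-gap {μ} {d = d} {g} bal no-good b = ℕₚ.≮⇒≥ λ 2≤g →
    refute (ℕₚ.<⇒≤ 2≤g) (gap-bound d ℕₚ.≤-refl b (balanced⇒nonvanishing bal (ℕₚ.<⇒≤ 2≤g) b) 2≤g)
    where
    refute : 1 ℕ.≤ g → ¬ GapBound p μ g
    refute 1≤g (bounded-by m ν ν-bal ν-odd near) =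
      no-good m (goodLevel {p} {μ} {ν} (suc m) ν-bal ν-odd (ℕₚ.≤-trans (ℕₚ.+-monoˡ-≤ _ 1≤g) near))

  -- If the peak found by climbing from p^k ν were not p^k ν itself, its centre would give a good level
  -- of μ larger than k.
  near-centre : ∀ {μ ν} k → (∀ m → GoodLevel p μ (suc m) → suc m ℕ.≤ suc k) →
    Balanced ν → ∀ n → size ν ≡ suc (2 ℕ.* n) → (let q = p ℕ.^ suc k) → dist μ (scale q ν) ℕ.< q →
    ∃ λ η → Basis μ η (excess (scale q ν) μ ℕ.+ q ℕ.* n) (q ℕ.∸ dist (scale q ν) μ)
  near-centre {μ} {ν} k maximal bal n odd near =
    from-basis (proj₂ (proj₂ (proj₂ (basis ν))))
    where
    q = p ℕ.^ suc k
    centre = scale q ν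
    instance
      p≢0 = prime⇒nonZero p-prime
    2≤q : 2 ℕ.≤ q
    2≤q = ℕₚ.≤-trans (ℕ.nonTrivial⇒n>1 p {{prime⇒nonTrivial p-prime}})
      (ℕₚ.≤-trans (ℕₚ.≤-reflexive (≡.sym (ℕₚ.*-identityʳ p))) (ℕₚ.*-monoʳ-≤ p (ℕₚ.m^n>0 p k)))
    from-basis : ∀ {θ d g} → Basis ν θ d g →
      ∃ λ η → Basis μ η (excess centre μ ℕ.+ q ℕ.* n) (q ℕ.∸ dist centre μ)
    -- The odd size of ν excludes gap 0; Frobenius then makes the gap at the centre at least q.
    from-basis {d = d} {zero} b = contradiction
      (≡.trans (total b) odd) (ℕₚ.even≢odd d n)
    from-basis {d = d} {g@(suc _)} b = from-peak (climb b₁ nv)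
      where
      b₁ = proj₂ (frobenius^ (suc k) b)
      q≤qg : q ℕ.≤ q ℕ.* g
      q≤qg = ℕₚ.m≤m*n q g
      nv = balanced⇒nonvanishing (scale-balanced q {ν} bal) (ℕₚ.≤-trans (ℕₚ.<⇒≤ 2≤q) q≤qg) b₁
      from-peak : Peak centre (q ℕ.* d) (q ℕ.* g) → ∃ λ η → Basis μ η (excess centre μ ℕ.+ q ℕ.* n) (q ℕ.∸ dist centre μ)
      from-peak P = from-bound (gap-bound (d* P) ℕₚ.≤-refl (base P) (nonvanishing P)
          (ℕₚ.≤-trans 2≤q (ℕₚ.≤-trans (ℕₚ.m≤m+n q _) q+D≤g*)))
        where
        open Peak
        q+D≤g* : q ℕ.+ dist centre (top P) ℕ.≤ g* P
        q+D≤g* = ℕₚ.≤-trans (ℕₚ.+-monoˡ-≤ _ q≤qg) (gap P)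
        from-bound : GapBound p (top P) (g* P) → ∃ λ η → Basis μ η (excess centre μ ℕ.+ q ℕ.* n) (q ℕ.∸ dist centre μ)
        from-bound (bounded-by m ξ ξ-bal ξ-odd near′) = let η , b₂ = cone (base P) (is-extremal P) top≤g* in
          η , ≡.subst₂ (Basis μ η) (≡.cong₂ ℕ._+_ (excess-cong {ξ = μ} (λ i → ≡.sym (centre≗top i))) d*≡qn)
            (≡.cong₂ ℕ._∸_ g*≡q (≡.sym dist≡)) b₂
          where
          m≤k : suc m ℕ.≤ suc k
          m≤k = maximal m (goodLevel {p} {μ} {ξ} (suc m) ξ-bal ξ-odd
            (dist-chain μ centre (top P) (scale (p ℕ.^ suc m) ξ) near q+D≤g* near′))
          -- The gap at the peak is at least q plus the distance from the centre, and at most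
          -- p^(m+1) ≤ q. Hence the distance is 0 and the gap is q.
          squeezed = squeeze q+D≤g* (ℕₚ.≤-trans (ℕₚ.m≤m+n (g* P) _) (ℕₚ.≤-trans near′ (ℕₚ.^-monoʳ-≤ p m≤k)))
          g*≡q = proj₂ squeezed
          centre≗top = dist≡0⇒≗ centre (top P) (proj₁ squeezed)
          dist≡ : dist centre μ ≡ dist (top P) μ
          dist≡ = dist-cong {ν = μ} centre≗top (λ _ → ≡.refl)
          d*≡qn : d* P ≡ q ℕ.* n
          d*≡qn = centre-degree q n (≡.trans (≡.cong (λ g → d* P ℕ.+ (d* P ℕ.+ g)) (≡.sym g*≡q))
            (≡.trans (total (base P)) (≡.trans (size-cong (λ i → ≡.sym (centre≗top i)))
              (≡.trans (≡.sym (size-scale q ν)) (≡.cong (q ℕ.*_) odd)))))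
          top≤g* : dist (top P) μ ℕ.≤ g* P
          top≤g* = ℕₚ.≤-trans (ℕₚ.≤-reflexive (≡.trans (≡.sym dist≡) (dist-sym centre μ)))
            (ℕₚ.≤-trans (ℕₚ.<⇒≤ near) (ℕₚ.≤-reflexive (≡.sym g*≡q)))

-- Realisation of the interface by polynomials over F_p.

module PolynomialFrame (p : ℕ) (p-prime : Prime p) where
  open Polynomials
  open import Data.Nat.Base using (_+_; _*_; _≤_; _<_)
  open ≡ using (refl; sym; trans; cong; cong₂; subst; module ≡-Reasoning)
  open ℕᵈ using (_∣_; _∣?_; divides; ∣m+n∣m⇒∣n; m∣m*n; n∣m*n; n∣m⇒m%n≡0; _∣0)
  open Div using (_/_; _%_)

  private instance
    p≢0 : NonZero p
    p≢0 = prime⇒nonZero p-prime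

  open Congruence p
  open PolynomialRing p
  private
    module S = CommutativeRing polynomialRing
  open Algebra.Properties.Semiring.Exp S.semiring using (_^_)
  open Algebra.Properties.Semiring.Mult S.semiring using () renaming (_×_ to _·_)
  open IntegerSolver polynomialRing

  Cong-0⇒∣ : ∀ {n} → Cong p n 0 → p ∣ n
  Cong-0⇒∣ {n} (k , l , e) = ∣m+n∣m⇒∣n (divides l (trans (ℕₚ.+-comm (k * p) n) e)) (n∣m*n k)

  ∣⇒Cong-0 : ∀ {n} → p ∣ n → Cong p n 0
  ∣⇒Cong-0 (divides q refl) = 0 , q , ℕₚ.+-identityʳ _

  operator-⊕ : ∀ w f g P Q → operator w f g (P ⊕ Q) ≈ (operator w f g P ⊕ operator w f g Q)
  operator-⊕ w f g P Q = ≡⇒≈ λ φ → cong (eval φ) (Listₚ.map-++ _ P Q)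

  const-poly : ℕ → Poly
  const-poly c = (c , 0 , 0) ∷ []

  eval-const : ∀ φ c P → eval φ (const-poly c ⊗ P) ≡ c * eval φ P
  eval-const φ c P = trans (eval-⊗ φ (const-poly c) P) (ℕₚ.+-identityʳ _)

  eval-· : ∀ φ n P → eval φ (n · P) ≡ n * eval φ P
  eval-· φ zero P = refl
  eval-· φ (suc n) P = trans (eval-++ φ P (n · P)) (cong (eval φ P +_) (eval-· φ n P))

  eval-X : ∀ φ P → eval φ (polyX ⊗ P) ≡ eval (λ i j → φ (suc i) j) P
  eval-X φ P = trans (eval-⊗ φ polyX P) (trans (ℕₚ.+-identityʳ _) (ℕₚ.*-identityˡ _))

  eval-Y : ∀ φ P → eval φ (polyY ⊗ P) ≡ eval (λ i j → φ i (suc j)) P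
  eval-Y φ P = trans (eval-⊗ φ polyY P) (trans (ℕₚ.+-identityʳ _) (ℕₚ.*-identityˡ _))

  eval-X^ : ∀ φ n → eval φ (polyX ^ n) ≡ φ n 0
  eval-X^ φ zero = trans (ℕₚ.+-identityʳ _) (ℕₚ.*-identityˡ _)
  eval-X^ φ (suc n) = trans (eval-X φ (polyX ^ n)) (eval-X^ (λ i j → φ (suc i) j) n)

  eval-Y^ : ∀ φ n → eval φ (polyY ^ n) ≡ φ 0 n
  eval-Y^ φ zero = trans (ℕₚ.+-identityʳ _) (ℕₚ.*-identityˡ _)
  eval-Y^ φ (suc n) = trans (eval-Y φ (polyY ^ n)) (eval-Y^ (λ i j → φ i (suc j)) n)

  -- Degree

  part : ℕ → Poly → Poly
  part n = operator (λ i j → χ (i + j) n) (λ i j → i) (λ i j → j)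

  eval-part : ∀ φ n P → eval φ (part n P) ≡ eval (λ i j → χ (i + j) n * φ i j) P
  eval-part φ n P = eval-operator φ _ _ _ P

  Homo : ℕ → Poly → Set
  Homo d P = part d P ≈ P

  eval-Homo : ∀ φ {d P} → Homo d P → Cong p (eval φ P) (eval (λ i j → χ (i + j) d * φ i j) P)
  eval-Homo φ {d} {P} h = subst (Cong p (eval φ P)) (eval-part φ d P) (Cong-sym (eval-≈ h φ))

  -- On a form of degree d a weight matters only where i + j = d, so agreement of two weights there
  -- suffices.
  Homo-≈ : ∀ {d P Q} (ψ ω : (ℕ → ℕ → ℕ) → ℕ → ℕ → ℕ) → Homo d P →
    (∀ φ → eval φ Q ≡ eval (ψ φ) P) → (∀ φ i j → χ (i + j) d * ψ φ i j ≡ χ (i + j) d * ω φ i j) →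
    ∀ {Q′} → (∀ φ → eval φ Q′ ≡ eval (ω φ) P) → Q ≈ Q′
  Homo-≈ {d} {P} ψ ω h Q-eval ψ≗ω Q′-eval = mk≈ λ φ →
    Cong-trans (≡⇒Cong (Q-eval φ)) (Cong-trans (eval-Homo (ψ φ) h)
      (Cong-trans (≡⇒Cong (eval-cong (ψ≗ω φ) P))
        (Cong-trans (Cong-sym (eval-Homo (ω φ) h)) (≡⇒Cong (sym (Q′-eval φ))))))

  χ-+ : ∀ d m e → χ (d + m) (d + e) ≡ χ m e
  χ-+ zero m e = refl
  χ-+ (suc d) m e = χ-+ d m e

  -- Under the indicator factor an equation may be proved assuming m = n.
  χ-guard : ∀ m n {x y : ℕ} → (m ≡ n → x ≡ y) → χ m n * x ≡ χ m n * y
  χ-guard m n h with m ℕₚ.≟ n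
  ... | yes m≡n = cong (χ m n *_) (h m≡n)
  ... | no m≢n rewrite χ-≢ m≢n = refl

  shuffle₄ : ∀ i k j l → i + k + (j + l) ≡ i + j + (k + l)
  shuffle₄ = solve-∀

  eval-part-⊗ : ∀ φ n d P Q → eval φ (part n (part d P ⊗ Q)) ≡
    eval (λ i j → χ (i + j) d * eval (λ k l → χ (i + k + (j + l)) n * φ (i + k) (j + l)) Q) P
  eval-part-⊗ φ n d P Q = trans (eval-part φ n (part d P ⊗ Q)) (trans (eval-⊗ _ (part d P) Q) (eval-part _ d P))

  part-⊗ : ∀ d e P Q → part (d + e) (part d P ⊗ Q) ≈ (part d P ⊗ part e Q)
  part-⊗ d e P Q = ≡⇒≈ λ φ → begin
    eval φ (part (d + e) (part d P ⊗ Q))      ≡⟨ eval-part-⊗ φ (d + e) d P Q ⟩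
    eval (λ i j → χ (i + j) d * eval (λ k l → χ (i + k + (j + l)) (d + e) * φ (i + k) (j + l)) Q) P
      ≡⟨ eval-cong (λ i j → χ-guard (i + j) d λ { refl → eval-cong (λ k l → cong (_* φ (i + k) (j + l))
           (trans (cong (λ m → χ m (i + j + e)) (shuffle₄ i k j l)) (χ-+ (i + j) (k + l) e))) Q }) P ⟩
    eval (λ i j → χ (i + j) d * eval (λ k l → χ (k + l) e * φ (i + k) (j + l)) Q) P
      ≡⟨ trans (eval-⊗ φ (part d P) (part e Q)) (trans (eval-part _ d P)
           (eval-cong (λ i j → cong (χ (i + j) d *_) (eval-part _ e Q)) P)) ⟨
    eval φ (part d P ⊗ part e Q)              ∎
    where open ≡-Reasoning

  part-⊗-< : ∀ {n d} → n < d → ∀ P Q → part n (part d P ⊗ Q) ≈ []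
  part-⊗-< {n} {d} n<d P Q = ≡⇒≈ λ φ → trans (eval-part-⊗ φ n d P Q) (trans
    (eval-cong {ψ = λ _ _ → 0} (λ i j → trans (χ-guard (i + j) d λ { refl → trans (eval-cong {ψ = λ _ _ → 0} (λ k l →
      cong (_* φ (i + k) (j + l)) (χ-≢ λ e → ℕₚ.<⇒≱ n<d (subst (i + j ≤_) (trans (sym (shuffle₄ i k j l)) e) (ℕₚ.m≤m+n _ _)))) Q)
      (eval-zero Q) }) (ℕₚ.*-zeroʳ (χ (i + j) d))) P) (eval-zero P))

  part-part : ∀ n P → part n (part n P) ≈ part n P
  part-part n P = ≡⇒≈ λ φ → trans (eval-part φ n (part n P)) (trans (eval-part _ n P) (trans
    (eval-cong (λ i j → χ-guard (i + j) n λ { refl → trans (cong (_* φ i j) (χ-refl (i + j))) (ℕₚ.*-identityˡ _) }) P)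
    (sym (eval-part φ n P))))

  Homo⇒Homogeneous : ∀ {d P} → Homo d P → Homogeneous p d P
  Homo⇒Homogeneous {d} {P} h a b a+b≢d = subst (λ n → Cong p n 0) (sym (coeff≡eval P a b))
    (Cong-trans (eval-Homo (δ a b) h) (≡⇒Cong (trans (eval-cong {ψ = λ _ _ → 0} vanishes P) (eval-zero P))))
    where
    vanishes : ∀ i j → χ (i + j) d * δ a b i j ≡ 0
    vanishes i j with i ℕₚ.≟ a | j ℕₚ.≟ b
    ... | yes refl | yes refl rewrite χ-≢ a+b≢d = refl
    ... | no i≢a | _ rewrite χ-≢ i≢a = ℕₚ.*-zeroʳ (χ (i + j) d)
    ... | yes refl | no j≢b rewrite χ-≢ j≢b | ℕₚ.*-zeroʳ (χ i i) = ℕₚ.*-zeroʳ (χ (i + j) d)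

  -- Constants

  inverse : ∀ {c} → ¬ p ∣ c → ∃ λ e → Cong p (e * c) 1
  inverse {c} p∤c = from-Bézout (coprime-Bézout coprime)
    where
    coprime : Coprime p c
    coprime {i} (i∣p , i∣c) with prime⇒irreducible p-prime i∣p
    ... | inj₁ i≡1 = i≡1
    ... | inj₂ refl = contradiction i∣c p∤c
    from-Bézout : Bézout.Identity 1 p c → ∃ λ e → Cong p (e * c) 1
    from-Bézout (Bézout.-+ x y e) = y , 0 , x , trans (ℕₚ.+-identityʳ _) (sym e)
    -- In this sign case y c = x p - 1, so y is -1/c modulo p; the factor p - 1 corrects the sign.
    from-Bézout (Bézout.+- x y e) = y * pred p , x , y * c , (begin
      y * pred p * c + x * p          ≡⟨ cong (y * pred p * c +_) e ⟨
      y * pred p * c + (1 + y * c)    ≡⟨ rearrange y (pred p) c ⟩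
      1 + y * c * suc (pred p)        ≡⟨ cong (λ n → 1 + y * c * n) (ℕₚ.suc-pred p) ⟩
      1 + y * c * p                   ∎)
      where
      open ≡-Reasoning
      rearrange : ∀ y q c → y * q * c + (1 + y * c) ≡ 1 + y * c * suc q
      rearrange = solve-∀

  Homo-const : ∀ c → Homo 0 (const-poly c)
  Homo-const c = ≡⇒≈ λ φ → cong (λ n → n * φ 0 0 + 0) (ℕₚ.*-identityʳ c)

  eval-Homo-0 : ∀ φ {u} → Homo 0 u → Cong p (eval φ u) (φ 0 0 * eval (δ 0 0) u)
  eval-Homo-0 φ {u} h = Cong-trans (eval-Homo φ h) (≡⇒Cong (trans (eval-cong select u) (eval-* (φ 0 0) (δ 0 0) u)))
    where
    select : ∀ i j → χ (i + j) 0 * φ i j ≡ φ 0 0 * δ 0 0 i j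
    select zero zero = ℕₚ.*-comm 1 (φ 0 0)
    select zero (suc j) = sym (ℕₚ.*-zeroʳ (φ 0 0))
    select (suc i) j = sym (ℕₚ.*-zeroʳ (φ 0 0))

  constant : ∀ {u} → Homo 0 u → u ≈ [] ⊎ ∃ λ v → Homo 0 v × (v ⊗ u) ≈ one
  constant {u} h with p ∣? eval (δ 0 0) u
  ... | yes p∣c = inj₁ (mk≈ λ φ → Cong-trans (eval-Homo-0 φ h)
    (Cong-trans (Cong-*ˡ (φ 0 0) (∣⇒Cong-0 p∣c)) (≡⇒Cong (ℕₚ.*-zeroʳ (φ 0 0)))))
  ... | no p∤c = inj₂ (const-poly (proj₁ (inverse p∤c)) , Homo-const _ , mk≈ λ φ →
    Cong-trans (≡⇒Cong (eval-const φ e u)) (Cong-trans (Cong-*ˡ e (eval-Homo-0 φ h))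
      (Cong-trans (≡⇒Cong (rearrange e (φ 0 0) c)) (Cong-trans (Cong-*ˡ (φ 0 0) (proj₂ (inverse p∤c)))
        (≡⇒Cong (trans (ℕₚ.*-comm (φ 0 0) 1) (sym (ℕₚ.+-identityʳ _))))))))
    where
    c = eval (δ 0 0) u
    e = proj₁ (inverse p∤c)
    rearrange : ∀ e f c → e * (f * c) ≡ f * (e * c)
    rearrange = solve-∀

  char⇐ : ∀ n → (n · one) ≈ [] → p ∣ n
  char⇐ n h = Cong-0⇒∣ (subst (λ m → Cong p m 0) (trans (eval-· _ n one) (ℕₚ.*-identityʳ n)) (eval-≈ h (λ _ _ → 1)))

  char⇒ : (p · one) ≈ []
  char⇒ = mk≈ λ φ → Cong-trans (≡⇒Cong (eval-· φ p one)) (Cong-p*0 _)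

  -- Splitting off the terms divisible by x

  is-suc : ℕ → ℕ
  is-suc zero = 0
  is-suc (suc _) = 1

  x-quotient x-remainder : Poly → Poly
  x-quotient = operator (λ i j → is-suc i) (λ i j → pred i) (λ i j → j)
  x-remainder = operator (λ i j → χ i 0) (λ i j → i) (λ i j → j)

  x-split : ∀ P → P ≈ ((polyX ⊗ x-quotient P) ⊕ x-remainder P)
  x-split P = ≡⇒≈ λ φ → sym (trans (eval-++ φ (polyX ⊗ x-quotient P) (x-remainder P)) (trans
    (cong₂ _+_ (trans (eval-X φ (x-quotient P)) (eval-operator _ _ _ _ P)) (eval-operator φ _ _ _ P))
    (trans (sym (eval-+ _ _ P)) (eval-cong (λ { zero j → ℕₚ.*-identityˡ _
                                               ; (suc i) j → trans (ℕₚ.+-identityʳ _) (ℕₚ.*-identityˡ _) }) P))))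

  x-quotient-X : ∀ P → x-quotient (polyX ⊗ P) ≈ P
  x-quotient-X P = ≡⇒≈ λ φ → trans (eval-operator φ _ _ _ (polyX ⊗ P)) (trans (eval-X _ P)
    (eval-cong (λ i j → ℕₚ.*-identityˡ _) P))

  x-remainder-X : ∀ P → x-remainder (polyX ⊗ P) ≈ []
  x-remainder-X P = ≡⇒≈ λ φ → trans (eval-operator φ _ _ _ (polyX ⊗ P)) (trans (eval-X _ P) (eval-zero P))

  x-remainder-Y : ∀ P → x-remainder (polyY ⊗ P) ≈ (polyY ⊗ x-remainder P)
  x-remainder-Y P = ≡⇒≈ λ φ → trans (eval-operator φ _ _ _ (polyY ⊗ P)) (trans (eval-Y _ P)
    (sym (trans (eval-Y φ (x-remainder P)) (eval-operator _ _ _ _ P))))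

  X-cancel : ∀ {P} → (polyX ⊗ P) ≈ [] → P ≈ []
  X-cancel {P} h = S.trans (S.sym (x-quotient-X P)) (operator-cong _ _ _ h)

  -- The symmetry exchanging x and y

  swap : Poly → Poly
  swap = operator (λ _ _ → 1) (λ i j → j) (λ i j → i)

  swap-cong : ∀ {P Q} → P ≈ Q → swap P ≈ swap Q
  swap-cong = operator-cong _ _ _

  eval-swap-poly : ∀ φ P → eval φ (swap P) ≡ eval (λ i j → φ j i) P
  eval-swap-poly φ P = trans (eval-operator φ _ _ _ P) (eval-cong (λ i j → ℕₚ.*-identityˡ _) P)

  swap-swap : ∀ P → swap (swap P) ≈ P
  swap-swap P = ≡⇒≈ λ φ → trans (eval-swap-poly φ (swap P)) (eval-swap-poly _ P)

  swap-⊗ : ∀ P Q → swap (P ⊗ Q) ≈ (swap P ⊗ swap Q)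
  swap-⊗ P Q = ≡⇒≈ λ φ → trans (eval-swap-poly φ (P ⊗ Q)) (trans (eval-⊗ _ P Q) (sym
    (trans (eval-⊗ φ (swap P) (swap Q)) (trans (eval-swap-poly _ P) (eval-cong (λ i j → eval-swap-poly _ Q) P)))))

  swap-⊕ : ∀ P Q → swap (P ⊕ Q) ≈ (swap P ⊕ swap Q)
  swap-⊕ = operator-⊕ _ _ _

  swap-part : ∀ n P → swap (part n P) ≈ part n (swap P)
  swap-part n P = ≡⇒≈ λ φ → trans (eval-swap-poly φ (part n P)) (trans (eval-part _ n P) (sym
    (trans (eval-part φ n (swap P)) (trans (eval-swap-poly _ P)
      (eval-cong (λ i j → cong (λ m → χ m n * φ j i) (ℕₚ.+-comm j i)) P)))))

  swap-Homo : ∀ {d P} → Homo d P → Homo d (swap P)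
  swap-Homo {d} {P} h = S.trans (S.sym (swap-part d P)) (swap-cong h)

  swap-Y^ : ∀ n → swap (polyY ^ n) ≈ (polyX ^ n)
  swap-Y^ n = ≡⇒≈ λ φ → trans (eval-swap-poly φ (polyY ^ n)) (trans (eval-Y^ _ n) (sym (eval-X^ φ n)))

  Y-cancel : ∀ {P} → (polyY ⊗ P) ≈ [] → P ≈ []
  Y-cancel {P} h = S.trans (S.sym (swap-swap P)) (swap-cong
    (X-cancel (S.trans (S.sym (swap-⊗ polyY P)) (swap-cong h))))

  X∣Y* : ∀ {P} → (∃ λ A → (polyY ⊗ P) ≈ (polyX ⊗ A)) → ∃ λ A → P ≈ (polyX ⊗ A)
  X∣Y* {P} (A , h) = x-quotient P , S.trans (x-split P) (S.trans (S.+-congˡ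
    (Y-cancel (S.trans (S.sym (x-remainder-Y P)) (S.trans (operator-cong _ _ _ h) (x-remainder-X A)))))
    (S.+-identityʳ _))

  Y∣X* : ∀ {P} → (∃ λ A → (polyX ⊗ P) ≈ (polyY ⊗ A)) → ∃ λ A → P ≈ (polyY ⊗ A)
  Y∣X* {P} (A , h) = let B , k = X∣Y* {swap P} (swap A , S.trans (S.sym (swap-⊗ polyX P))
                                   (S.trans (swap-cong h) (swap-⊗ polyY A)))
    in swap B , S.trans (S.sym (swap-swap P)) (S.trans (swap-cong k) (swap-⊗ polyX B))

  -- The coefficient of (x + y) P at (a+1, b+1) is the sum of those of P at (a, b+1) and (a+1, b).
  -- Induction on a therefore kills all coefficients, starting from the column a = 0.
  X+Y-cancel : ∀ {P} → ((polyX ⊕ polyY) ⊗ P) ≈ [] → P ≈ []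
  X+Y-cancel {P} h = PolyEq⇒≈ λ a b → subst (λ n → Cong p n 0) (sym (coeff≡eval P a b)) (go a b)
    where
    sum : ∀ φ → Cong p (eval (λ i j → φ (suc i) j) P + eval (λ i j → φ i (suc j)) P) 0
    sum φ = subst (λ n → Cong p n 0)
      (trans (eval-≡ φ) (cong₂ _+_ (eval-X φ P) (eval-Y φ P))) (eval-≈ h φ)
      where
      eval-≡ : ∀ φ → eval φ ((polyX ⊕ polyY) ⊗ P) ≡ eval φ (polyX ⊗ P) + eval φ (polyY ⊗ P)
      eval-≡ φ = trans (eval-⊗ φ (polyX ⊕ polyY) P) (sym (cong₂ _+_
        (trans (eval-⊗ φ polyX P) (ℕₚ.+-identityʳ _)) (eval-⊗ φ polyY P)))
    go : ∀ a b → Cong p (eval (δ a b) P) 0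
    go zero b = subst (λ n → Cong p (n + eval (δ 0 b) P) 0) (eval-zero P) (sum (δ 0 (suc b)))
    go (suc a) b = Cong-trans (Cong-+ (Cong-sym (go a (suc b))) (≡⇒Cong refl)) (sum (δ (suc a) (suc b)))

  -- Modulo x only the term in y^d survives; u is its coefficient.
  modX : ∀ {d P} → Homo d P → ∃ λ u → Homo 0 u × ∃ λ A → (P S.- (u ⊗ (polyY ^ d))) ≈ (polyX ⊗ A)
  modX {d} {P} h = const-poly c , Homo-const c , x-quotient P , (begin
    P S.- (const-poly c ⊗ (polyY ^ d))        ≈⟨ S.+-cong (x-split P) (S.-‿cong (S.sym remainder)) ⟩
    ((polyX ⊗ x-quotient P) ⊕ x-remainder P) S.- x-remainder P
      ≈⟨ solve 2 (λ a b → (a :+ b) :- b := a) S.refl (polyX ⊗ x-quotient P) (x-remainder P) ⟩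
    (polyX ⊗ x-quotient P)                    ∎)
    where
    open import Relation.Binary.Reasoning.Setoid S.setoid
    c = eval (δ 0 d) P
    select : ∀ φ i j → χ (i + j) d * (χ i 0 * φ i j) ≡ χ (i + j) d * (φ 0 d * δ 0 d i j)
    select φ zero j with j ℕₚ.≟ d
    ... | yes refl rewrite χ-refl j = cong (1 *_) (ℕₚ.*-comm 1 (φ 0 j))
    ... | no j≢d rewrite χ-≢ j≢d = refl
    select φ (suc i) j = cong (χ (suc i + j) d *_) (sym (ℕₚ.*-zeroʳ (φ 0 d)))
    remainder : x-remainder P ≈ (const-poly c ⊗ (polyY ^ d))
    remainder = Homo-≈ (λ φ i j → χ i 0 * φ i j) (λ φ i j → φ 0 d * δ 0 d i j) h
      (λ φ → eval-operator φ _ _ _ P) select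
      (λ φ → trans (eval-const φ c (polyY ^ d)) (trans (cong (c *_) (eval-Y^ φ d))
        (trans (ℕₚ.*-comm c _) (sym (eval-* (φ 0 d) (δ 0 d) P)))))

  modY : ∀ {d P} → Homo d P → ∃ λ u → Homo 0 u × ∃ λ A → (P S.- (u ⊗ (polyX ^ d))) ≈ (polyY ⊗ A)
  modY {d} {P} h = let u , homu , A , k = modX {d} {swap P} (swap-Homo h) in swap u , swap-Homo {0} {u} homu , swap A , (begin
    P S.- (swap u ⊗ (polyX ^ d))
      ≈⟨ S.+-congʳ (S.trans (S.sym (swap-swap P)) (swap-cong (difference (swap P) (u ⊗ (polyY ^ d)) k))) ⟩
    swap ((polyX ⊗ A) ⊕ (u ⊗ (polyY ^ d))) S.- (swap u ⊗ (polyX ^ d))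
      ≈⟨ S.+-congʳ (S.trans (swap-⊕ (polyX ⊗ A) _) (S.+-cong (swap-⊗ polyX A)
           (S.trans (swap-⊗ u (polyY ^ d)) (S.*-congˡ {swap u} (swap-Y^ d))))) ⟩
    ((polyY ⊗ swap A) ⊕ (swap u ⊗ (polyX ^ d))) S.- (swap u ⊗ (polyX ^ d))
      ≈⟨ solve 2 (λ a b → (a :+ b) :- b := a) S.refl (polyY ⊗ swap A) _ ⟩
    (polyY ⊗ swap A)                                    ∎)
    where
    open import Relation.Binary.Reasoning.Setoid S.setoid
    difference : ∀ P Q {R} → (P S.- Q) ≈ R → P ≈ (R ⊕ Q)
    difference P Q k = S.trans (solve 2 (λ a b → a := (a :- b) :+ b) S.refl P Q) (S.+-congʳ k)

  -- Derivations

  derive-x : Poly → Poly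
  derive-x = operator (λ i j → i) (λ i j → pred i) (λ i j → j)

  eval-derive-x : ∀ φ P → eval φ (derive-x P) ≡ eval (λ i j → i * φ (pred i) j) P
  eval-derive-x φ P = eval-operator φ _ _ _ P

  derive-x-⊗ : ∀ P Q → derive-x (P ⊗ Q) ≈ ((derive-x P ⊗ Q) ⊕ (P ⊗ derive-x Q))
  derive-x-⊗ P Q = ≡⇒≈ λ φ → begin
    eval φ (derive-x (P ⊗ Q))
      ≡⟨ trans (eval-derive-x φ (P ⊗ Q)) (eval-⊗ _ P Q) ⟩
    eval (λ i j → eval (λ k l → (i + k) * φ (pred (i + k)) (j + l)) Q) P
      ≡⟨ eval-cong (λ i j → trans (eval-cong (λ k l → leibniz i k (λ n → φ n (j + l))) Q) (eval-+ _ _ Q)) P ⟩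
    eval (λ i j → eval (λ k l → i * φ (pred i + k) (j + l)) Q + eval (λ k l → k * φ (i + pred k) (j + l)) Q) P
      ≡⟨ eval-+ _ _ P ⟩
    eval (λ i j → eval (λ k l → i * φ (pred i + k) (j + l)) Q) P
      + eval (λ i j → eval (λ k l → k * φ (i + pred k) (j + l)) Q) P
      ≡⟨ trans (eval-++ φ (derive-x P ⊗ Q) (P ⊗ derive-x Q)) (cong₂ _+_
           (trans (eval-⊗ φ (derive-x P) Q) (trans (eval-derive-x _ P)
             (eval-cong (λ i j → sym (eval-* i (λ k l → φ (pred i + k) (j + l)) Q)) P)))
           (trans (eval-⊗ φ P (derive-x Q)) (eval-cong (λ i j → eval-derive-x _ Q) P))) ⟨
    eval φ ((derive-x P ⊗ Q) ⊕ (P ⊗ derive-x Q)) ∎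
    where
    open ≡-Reasoning
    -- `pred` is wrong only at 0, where the factor i or k kills the term.
    leibniz : ∀ i k (f : ℕ → ℕ) → (i + k) * f (pred (i + k)) ≡ i * f (pred i + k) + k * f (i + pred k)
    leibniz zero k f = refl
    leibniz (suc i) zero f rewrite ℕₚ.+-identityʳ i = sym (ℕₚ.+-identityʳ _)
    leibniz (suc i) (suc k) f = trans (ℕₚ.*-distribʳ-+ (f (i + suc k)) (suc i) (suc k))
      (cong (λ n → suc i * f (i + suc k) + suc k * f n) (ℕₚ.+-suc i k))

  derivX : Derivation polynomialRing
  derivX = record
    { ∂ = derive-x ; ∂-cong = operator-cong _ _ _ ; ∂-+ = operator-⊕ _ _ _ ; ∂-* = derive-x-⊗ }

  -- Conjugation by `swap` lets the rules for the x-derivative be reused.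
  derive-y : Poly → Poly
  derive-y P = swap (derive-x (swap P))

  eval-derive-y : ∀ φ P → eval φ (derive-y P) ≡ eval (λ i j → j * φ i (pred j)) P
  eval-derive-y φ P = trans (eval-swap-poly φ (derive-x (swap P))) (trans (eval-derive-x _ (swap P)) (eval-swap-poly _ P))

  derivY : Derivation polynomialRing
  derivY = record
    { ∂ = derive-y
    ; ∂-cong = λ h → swap-cong (operator-cong _ _ _ (swap-cong h))
    ; ∂-+ = λ P Q → S.trans (swap-cong (S.trans (operator-cong _ _ _ (swap-⊕ P Q)) (operator-⊕ _ _ _ (swap P) (swap Q))))
        (swap-⊕ (derive-x (swap P)) (derive-x (swap Q)))
    ; ∂-* = λ P Q → S.trans (swap-cong (S.trans (operator-cong _ _ _ (swap-⊗ P Q)) (derive-x-⊗ (swap P) (swap Q))))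
        (S.trans (swap-⊕ (derive-x (swap P) ⊗ swap Q) (swap P ⊗ derive-x (swap Q)))
          (S.+-cong (S.trans (swap-⊗ (derive-x (swap P)) (swap Q)) (S.*-congˡ {derive-y P} (swap-swap Q)))
            (S.trans (swap-⊗ (swap P) (derive-x (swap Q))) (S.*-congʳ {derive-y Q} (swap-swap P))))) }

  part-derive-x : ∀ n P → part n (derive-x P) ≈ derive-x (part (suc n) P)
  part-derive-x n P = ≡⇒≈ λ φ → trans (eval-part φ n (derive-x P)) (trans (eval-derive-x _ P) (sym
    (trans (eval-derive-x φ (part (suc n) P)) (trans (eval-part _ (suc n) P) (eval-cong (λ where
      zero j → ℕₚ.*-zeroʳ (χ j (suc n))
      (suc i) j → rearrange (χ (i + j) n) (suc i) (φ i j)) P)))))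
    where
    rearrange : ∀ a b c → a * (b * c) ≡ b * (a * c)
    rearrange = solve-∀

  part-derive-y : ∀ n P → part n (derive-y P) ≈ derive-y (part (suc n) P)
  part-derive-y n P = S.trans (S.sym (swap-part n (derive-x (swap P)))) (swap-cong
    (S.trans (part-derive-x n (swap P)) (operator-cong _ _ _ (S.sym (swap-part (suc n) P)))))

  euler : ∀ {d P} → Homo d P → ((polyX ⊗ derive-x P) ⊕ (polyY ⊗ derive-y P)) ≈ (d · P)
  euler {d} {P} h = Homo-≈ (λ φ i j → (i + j) * φ i j) (λ φ i j → d * φ i j) h
    (λ φ → trans (eval-++ φ (polyX ⊗ derive-x P) (polyY ⊗ derive-y P)) (trans (cong₂ _+_
        (trans (eval-X φ (derive-x P)) (trans (eval-derive-x _ P) (eval-cong (λ i j → restore i (λ n → φ n j)) P)))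
        (trans (eval-Y φ (derive-y P)) (trans (eval-derive-y _ P) (eval-cong (λ i j → restore j (φ i)) P))))
      (trans (sym (eval-+ _ _ P)) (eval-cong (λ i j → sym (ℕₚ.*-distribʳ-+ (φ i j) i j)) P))))
    (λ φ i j → χ-guard (i + j) d λ e → cong (_* φ i j) e)
    (λ φ → trans (eval-· φ d P) (sym (eval-* d φ P)))
    where
    restore : ∀ i (f : ℕ → ℕ) → i * f (suc (pred i)) ≡ i * f i
    restore zero f = refl
    restore (suc i) f = refl

  -- Frobenius and its left inverse

  -- Over F_p this substitution is the p-th power map; as a monomial operator it is additive by
  -- construction.
  Fr : Poly → Poly
  Fr = operator (λ _ _ → 1) (λ i j → p * i) (λ i j → p * j)

  eval-Fr : ∀ φ P → eval φ (Fr P) ≡ eval (λ i j → φ (p * i) (p * j)) P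
  eval-Fr φ P = trans (eval-operator φ _ _ _ P) (eval-cong (λ i j → ℕₚ.*-identityˡ _) P)

  Fr-⊗ : ∀ P Q → Fr (P ⊗ Q) ≈ (Fr P ⊗ Fr Q)
  Fr-⊗ P Q = ≡⇒≈ λ φ → trans (eval-Fr φ (P ⊗ Q)) (trans (eval-⊗ _ P Q) (trans
    (eval-cong (λ i j → eval-cong (λ k l → cong₂ φ (ℕₚ.*-distribˡ-+ p i k) (ℕₚ.*-distribˡ-+ p j l)) Q) P)
    (sym (trans (eval-⊗ φ (Fr P) (Fr Q)) (trans (eval-Fr _ P) (eval-cong (λ i j → eval-Fr _ Q) P))))))

  Fr-1 : Fr one ≈ one
  Fr-1 = ≡⇒≈ λ φ → cong (λ n → φ n n + 0 + 0) (ℕₚ.*-zeroʳ p)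

  Fr-X : Fr polyX ≈ (polyX ^ p)
  Fr-X = ≡⇒≈ λ φ → trans (eval-Fr φ polyX) (trans (ℕₚ.+-identityʳ _) (trans (ℕₚ.*-identityˡ _)
    (trans (cong₂ φ (ℕₚ.*-identityʳ p) (ℕₚ.*-zeroʳ p)) (sym (eval-X^ φ p)))))

  Fr-Y : Fr polyY ≈ (polyY ^ p)
  Fr-Y = ≡⇒≈ λ φ → trans (eval-Fr φ polyY) (trans (ℕₚ.+-identityʳ _) (trans (ℕₚ.*-identityˡ _)
    (trans (cong₂ φ (ℕₚ.*-zeroʳ p) (ℕₚ.*-identityʳ p)) (sym (eval-Y^ φ p)))))

  Fr-Homo : ∀ {d P} → Homo d P → Homo (p * d) (Fr P)
  Fr-Homo {d} {P} h = Homo-≈ (λ φ i j → χ (p * i + p * j) (p * d) * φ (p * i) (p * j)) (λ φ i j → φ (p * i) (p * j)) h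
    (λ φ → trans (eval-part φ (p * d) (Fr P)) (eval-Fr _ P))
    (λ φ i j → χ-guard (i + j) d λ { refl → trans (cong (_* φ (p * i) (p * j))
      (trans (cong (λ n → χ n (p * (i + j))) (sym (ℕₚ.*-distribˡ-+ p i j))) (χ-refl (p * (i + j))))) (ℕₚ.*-identityˡ _) })
    (λ φ → eval-Fr φ P)

  π : Poly → Poly
  π = operator (λ i j → χ (i % p) 0 * χ (j % p) 0) (λ i j → i / p) (λ i j → j / p)

  eval-π : ∀ φ P → eval φ (π P) ≡ eval (λ i j → χ (i % p) 0 * χ (j % p) 0 * φ (i / p) (j / p)) P
  eval-π φ P = eval-operator φ _ _ _ P

  -- Adding p i to an exponent leaves its remainder modulo p unchanged and shifts its quotient by i.
  π-Fr : ∀ P Q → π (Fr P ⊗ Q) ≈ (P ⊗ π Q)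
  π-Fr P Q = ≡⇒≈ λ φ → trans (eval-π φ (Fr P ⊗ Q)) (trans (eval-⊗ _ (Fr P) Q) (trans (eval-Fr _ P) (trans
    (eval-cong (λ i j → eval-cong (λ k l → cong₂ _*_
        (cong₂ (λ a b → χ a 0 * χ b 0) (rem i k) (rem j l)) (cong₂ φ (quo i k) (quo j l))) Q) P)
    (sym (trans (eval-⊗ φ P (π Q)) (eval-cong (λ i j → eval-π _ Q) P))))))
    where
    rem : ∀ i k → (p * i + k) % p ≡ k % p
    rem i k = trans (cong (_% p) (trans (ℕₚ.+-comm (p * i) k) (cong (k +_) (ℕₚ.*-comm p i)))) (Div.[m+kn]%n≡m%n k i p)
    quo : ∀ i k → (p * i + k) / p ≡ i + k / p
    quo i k = trans (Div.+-distrib-/-∣ˡ k (m∣m*n i)) (cong (_+ k / p) (trans (cong (_/ p) (ℕₚ.*-comm p i)) (Div.m*n/n≡m i p)))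

  exact : ∀ i → i % p ≡ 0 → i ≡ p * (i / p)
  exact i e = trans (Div.m≡m%n+[m/n]*n i p) (trans (cong (_+ i / p * p) e) (ℕₚ.*-comm (i / p) p))

  π-Homo : ∀ {d P} → Homo (p * d) P → Homo d (π P)
  π-Homo {d} {P} h = Homo-≈
    (λ φ i j → χ (i % p) 0 * χ (j % p) 0 * (χ (i / p + j / p) d * φ (i / p) (j / p)))
    (λ φ i j → χ (i % p) 0 * χ (j % p) 0 * φ (i / p) (j / p)) h
    (λ φ → trans (eval-part φ d (π P)) (eval-π _ P))
    (λ φ i j → χ-guard (i + j) (p * d) λ e → trans (ℕₚ.*-assoc (χ (i % p) 0) _ _) (trans
      (χ-guard (i % p) 0 λ i≡0 → χ-guard (j % p) 0 λ j≡0 → trans (cong (_* φ (i / p) (j / p))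
        (trans (cong (λ n → χ n d) (ℕₚ.*-cancelˡ-≡ _ _ p (trans (ℕₚ.*-distribˡ-+ p (i / p) (j / p))
          (trans (sym (cong₂ _+_ (exact i i≡0) (exact j j≡0))) e)))) (χ-refl d))) (ℕₚ.*-identityˡ _))
      (sym (ℕₚ.*-assoc (χ (i % p) 0) _ _))))
    (λ φ → eval-π φ P)

  coefficient-π : ∀ a b P → eval (δ a b) (π P) ≡ eval (δ (p * a) (p * b)) P
  coefficient-π a b P = trans (eval-π (δ a b) P) (eval-cong (λ i j → trans
    (rearrange (χ (i % p) 0) (χ (j % p) 0) (χ (i / p) a) (χ (j / p) b)) (cong₂ _*_ (digits i a) (digits j b))) P)
    where
    rearrange : ∀ x y z w → x * y * (z * w) ≡ (x * z) * (y * w)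
    rearrange = solve-∀
    digits : ∀ i a → χ (i % p) 0 * χ (i / p) a ≡ χ i (p * a)
    digits i a with i ℕₚ.≟ p * a
    ... | yes refl = trans (cong₂ _*_ (cong (λ n → χ n 0) (n∣m⇒m%n≡0 (p * a) p (m∣m*n a)))
        (trans (cong (λ n → χ n a) (trans (cong (_/ p) (ℕₚ.*-comm p a)) (Div.m*n/n≡m a p))) (χ-refl a)))
      (sym (χ-refl (p * a)))
    ... | no i≢pa rewrite χ-≢ i≢pa = trans (χ-guard (i % p) 0 {y = 0} λ e →
        χ-≢ {i / p} {a} λ { refl → i≢pa (exact i e) }) (ℕₚ.*-zeroʳ (χ (i % p) 0))

  coefficient-derive-x : ∀ a b P → eval (δ a b) (derive-x P) ≡ suc a * eval (δ (suc a) b) P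
  coefficient-derive-x a b P = trans (eval-derive-x (δ a b) P) (trans (eval-cong select P) (eval-* (suc a) (δ (suc a) b) P))
    where
    select : ∀ i j → i * δ a b (pred i) j ≡ suc a * δ (suc a) b i j
    select zero j = sym (ℕₚ.*-zeroʳ (suc a))
    select (suc i) j with i ℕₚ.≟ a
    ... | yes refl = refl
    ... | no i≢a rewrite χ-≢ i≢a = trans (ℕₚ.*-zeroʳ (suc i)) (sym (ℕₚ.*-zeroʳ (suc a)))

  coefficient-derive-y : ∀ a b P → eval (δ a b) (derive-y P) ≡ suc b * eval (δ a (suc b)) P
  coefficient-derive-y a b P = begin
    eval (δ a b) (derive-y P)                      ≡⟨ eval-swap-poly (δ a b) (derive-x (swap P)) ⟩
    eval (λ i j → δ a b j i) (derive-x (swap P))   ≡⟨ eval-cong (λ i j → ℕₚ.*-comm (χ j a) (χ i b)) (derive-x (swap P)) ⟩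
    eval (δ b a) (derive-x (swap P))               ≡⟨ coefficient-derive-x b a (swap P) ⟩
    suc b * eval (δ (suc b) a) (swap P)            ≡⟨ cong (suc b *_) (eval-swap-poly (δ (suc b) a) P) ⟩
    suc b * eval (λ i j → δ (suc b) a j i) P
      ≡⟨ cong (suc b *_) (eval-cong (λ i j → ℕₚ.*-comm (χ j (suc b)) (χ i a)) P) ⟩
    suc b * eval (δ a (suc b)) P                   ∎
    where open ≡-Reasoning

  -- The coefficient at (a, b) is killed by ∂x if p does not divide a, by ∂y if p does not divide b,
  -- and is a coefficient of π P otherwise.
  π-injective : ∀ {P} → derive-x P ≈ [] → derive-y P ≈ [] → π P ≈ [] → P ≈ []
  π-injective {P} hx hy hπ = PolyEq⇒≈ λ a b → subst (λ n → Cong p n 0) (sym (coeff≡eval P a b)) (vanishes a b)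
    where
    unit-cancel : ∀ {n c} → n % p ≢ 0 → Cong p (n * c) 0 → Cong p c 0
    unit-cancel {n} {c} n≢0 h with euclidsLemma n c p-prime (Cong-0⇒∣ h)
    ... | inj₁ p∣n = contradiction (n∣m⇒m%n≡0 n p p∣n) n≢0
    ... | inj₂ p∣c = ∣⇒Cong-0 p∣c
    vanishes : ∀ a b → Cong p (eval (δ a b) P) 0
    vanishes a b with a % p ℕₚ.≟ 0 | b % p ℕₚ.≟ 0
    ... | yes a≡0 | yes b≡0 = subst (λ n → Cong p n 0) (trans (coefficient-π (a / p) (b / p) P)
      (cong₂ (λ a b → eval (δ a b) P) (sym (exact a a≡0)) (sym (exact b b≡0)))) (eval-≈ hπ (δ (a / p) (b / p)))
    vanishes zero b | no a≢0 | _ = contradiction (n∣m⇒m%n≡0 0 p (p ∣0)) a≢0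
    vanishes (suc a) b | no a≢0 | _ = unit-cancel {suc a} a≢0
      (subst (λ n → Cong p n 0) (coefficient-derive-x a b P) (eval-≈ hx (δ a b)))
    vanishes a zero | yes _ | no b≢0 = contradiction (n∣m⇒m%n≡0 0 p (p ∣0)) b≢0
    vanishes a (suc b) | yes _ | no b≢0 = unit-cancel {suc b} b≢0
      (subst (λ n → Cong p n 0) (coefficient-derive-y a b P) (eval-≈ hy (δ a b)))

  frame : Frame p
  frame = record
    { R = polynomialRing
    ; X = polyX ; Y = polyY ; part = part
    ; char⇒ = char⇒ ; char⇐ = char⇐ ; constant = λ {u} → constant {u}
    ; part-cong = λ n → operator-cong _ _ _
    ; part-+ = λ n → operator-⊕ _ _ _
    ; part-* = part-⊗
    ; part-*-< = part-⊗-<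
    ; part-part = part-part
    ; Hom-1 = S.refl ; Hom-X = S.refl ; Hom-Y = S.refl
    ; X-cancel = X-cancel ; Y-cancel = Y-cancel ; X+Y-cancel = X+Y-cancel
    ; X∣Y* = X∣Y* ; Y∣X* = Y∣X*
    ; modX = λ {d} {P} → modX {d} {P} ; modY = λ {d} {P} → modY {d} {P}
    ; derivX = derivX ; derivY = derivY
    ; ∂x-X = ≡⇒≈ λ φ → refl
    ; ∂x-Y = ≡⇒≈ λ φ → refl
    ; ∂y-X = ≡⇒≈ λ φ → refl
    ; ∂y-Y = ≡⇒≈ λ φ → refl
    ; part-∂x = part-derive-x ; part-∂y = part-derive-y
    ; euler = λ {d} {P} → euler {d} {P}
    ; Fr = Fr ; π = π
    ; Fr-cong = operator-cong _ _ _
    ; Fr-+ = operator-⊕ _ _ _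
    ; Fr-* = Fr-⊗ ; Fr-1 = Fr-1 ; Fr-X = Fr-X ; Fr-Y = Fr-Y
    ; Fr-Hom = λ {d} {P} → Fr-Homo {d} {P}
    ; π-cong = operator-cong _ _ _
    ; π-+ = operator-⊕ _ _ _
    ; π-Fr = π-Fr
    ; π-Hom = λ {d} {P} → π-Homo {d} {P}
    ; π-injective = π-injective }

-- Translation to the definitions of the statement, and the explicit exponents.

module Conclusion (p : ℕ) (p-prime : Prime p) where
  open import Data.Nat.Base using (_+_; _*_; _∸_; _^_; _<_; _≤_; ∣_-_∣)
  open Div using (_/_)
  open ≡ using (refl; sym; trans; cong; cong₂; subst; subst₂)
  open PolynomialFrame p p-prime using (frame; Homo⇒Homogeneous)
  private instance
    p≢0 = prime⇒nonZero p-prime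
  open Polynomials
  open PolynomialRing p using (_≈_; ≈⇒PolyEq; PolyEq⇒≈)
  private
    module 𝔽 = Frame frame
  open Theory p p-prime frame
  open Basis

  pow≡^ : ∀ i n → pow (linForm i) n ≡ (α i 𝔽.^ n)
  pow≡^ i zero = refl
  pow≡^ i (suc n) = cong₂ _⊗_ (linForm≡α i) (pow≡^ i n)
    where
    linForm≡α : ∀ i → linForm i ≡ α i
    linForm≡α 0F = refl
    linForm≡α 1F = refl
    linForm≡α 2F = refl

  applyDer≡ : ∀ θ i → applyDer θ i ≡ θ ⟨ i ⟩
  applyDer≡ θ 0F = refl
  applyDer≡ θ 1F = refl
  applyDer≡ θ 2F = refl

  ∈D⇒InD : ∀ {μ θ} → θ ∈D μ → InD p μ θ
  ∈D⇒InD {μ} {θ} m i rewrite applyDer≡ θ i | pow≡^ i (μ i) = proj₁ (member m i) , ≈⇒PolyEq (proj₂ (member m i))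

  InD⇒∈D : ∀ {μ θ} → InD p μ θ → θ ∈D μ
  InD⇒∈D {μ} {θ} m = mkD λ i → proj₁ (m i) ,
    subst₂ (λ P M → P ≈ (M ⊗ proj₁ (m i))) (applyDer≡ θ i) (pow≡^ i (μ i)) (PolyEq⇒≈ (proj₂ (m i)))

  Basis⇒Exps : ∀ {μ θ d g} → Basis μ θ d g → Exps p μ d (d + g)
  Basis⇒Exps {μ} {θ} {d} {g} b = θ , θ′ b ,
    (Homo⇒Homogeneous {d} (hom b 0F) , Homo⇒Homogeneous {d} (hom b 1F)) ,
    (Homo⇒Homogeneous {d + g} (hom′ b 0F) , Homo⇒Homogeneous {d + g} (hom′ b 1F)) ,
    ∈D⇒InD {μ} {θ} (div b) , ∈D⇒InD {μ} {θ′ b} (div′ b) ,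
    (λ η m → let s , t , h , k = span b (InD⇒∈D {μ} {η} m) in s , t , ≈⇒PolyEq h , ≈⇒PolyEq k) ,
    λ s s′ t t′ e → let h , k = independent b {s} {s′} {t} {t′} (PolyEq⇒≈ (proj₁ e)) (PolyEq⇒≈ (proj₂ e))
                     in ≈⇒PolyEq {s} {t} h , ≈⇒PolyEq {s′} {t′} k

  exponents : ∀ {μ θ d g D E Δ} → Basis μ θ d g → d ≡ D → g ≡ Δ → D + Δ ≡ E → Exps p μ D E × IsΔ p μ Δ
  exponents {μ} {d = d} {g} b refl refl refl = Basis⇒Exps {μ} b , d , d + g , Basis⇒Exps {μ} b , ℕₚ.∣m-m+n∣≡n d g

  -- |μ| = 2d + g with g ≤ 1, so the parity of |μ| decides the gap.
  balanced-exponents : ∀ {μ} → Balanced μ → (∀ m → ¬ GoodLevel p μ (suc m)) →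
    (IsOdd μ → Exps p μ ((size μ ∸ 1) / 2) ((size μ + 1) / 2) × IsΔ p μ 1) ×
    (IsEven μ → Exps p μ (size μ / 2) (size μ / 2) × IsΔ p μ 0)
  balanced-exponents {μ} bal no-good = let θ , d , g , b = basis μ in by-gap g (small-gap bal no-good b) b
    where
    half : ∀ d → d ≡ 2 * d / 2
    half d = sym (trans (cong (_/ 2) (ℕₚ.*-comm 2 d)) (Div.m*n/n≡m d 2))
    by-gap : ∀ g {θ d} → g ≤ 1 → Basis μ θ d g →
      (IsOdd μ → Exps p μ ((size μ ∸ 1) / 2) ((size μ + 1) / 2) × IsΔ p μ 1) ×
      (IsEven μ → Exps p μ (size μ / 2) (size μ / 2) × IsΔ p μ 0)
    by-gap 0 {d = d} _ b =
      (λ odd → contradiction (trans size≡ (odd⇒1+2n odd)) (ℕₚ.even≢odd d (size μ / 2))) ,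
      (λ even → exponents {μ} b d≡ refl (ℕₚ.+-identityʳ _))
      where
      size≡ : 2 * d ≡ size μ
      size≡ = total b
      d≡ : d ≡ size μ / 2
      d≡ = trans (half d) (cong (_/ 2) size≡)
    by-gap 1 {d = d} _ b =
      (λ odd → exponents {μ} b (trans (half d) (cong (λ s → (s ∸ 1) / 2) size≡)) refl
        (trans (cong (λ s → (s ∸ 1) / 2 + 1) (sym size≡)) (trans (cong (_+ 1) (sym (half d)))
          (trans (trans (ℕₚ.+-comm d 1) (half (suc d))) (cong (_/ 2) (trans (2+ d) (cong (_+ 1) size≡))))))) ,
      (λ even → contradiction (trans (sym (even⇒2n even)) (sym size≡)) (ℕₚ.even≢odd (size μ / 2) d))
      where
      shuffle : ∀ d → suc (2 * d) ≡ d + (d + 1)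
      shuffle = solve-∀
      size≡ : suc (2 * d) ≡ size μ
      size≡ = trans (shuffle d) (total b)
      2+ : ∀ d → 2 * suc d ≡ suc (2 * d) + 1
      2+ = solve-∀
    by-gap (suc (suc _)) (s≤s ()) b

  -- The good level supplies a centre qν with ν a corner of the cube between α and α + (1,1,1). The
  -- hypotheses of the four cases identify the corner.
  module Positive {μ : Mult} (k : ℕ) (maximal : ∀ m → GoodLevel p μ (suc m) → suc m ≤ suc k)
    (good : GoodLevel p μ (suc k)) (α β : Mult) (μ≡ : ∀ i → μ i ≡ p ^ suc k * α i + β i)
    (β<q : ∀ i → β i < p ^ suc k) where

    private
      q = p ^ suc k
      ν = proj₁ (proj₂ good)
      bal = proj₁ (proj₂ (proj₂ good))
      odd = proj₁ (proj₂ (proj₂ (proj₂ good)))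
      near : dist μ (scale q ν) < q
      near = proj₂ (proj₂ (proj₂ (proj₂ good)))
      n = size ν / 2

      offset surplus : Mult
      offset i = ∣ q * ν i - μ i ∣
      surplus i = μ i ∸ q * ν i

      near′ : size offset < q
      near′ = subst (_< q) (dist-sym μ (scale q ν)) near

      part≤size : ∀ i (f : Mult) → f i ≤ size f
      part≤size i f = subst (f i ≤_) (sym (size-rotate i f)) (ℕₚ.m≤m+n (f i) _)

      -- Each single offset is at most the total distance, which is below q.
      digits : ∀ i → Digit (α i) (β i) (q ∸ β i) (ν i) (offset i) (surplus i)
      digits i rewrite μ≡ i = digit q (α i) (β i) (ν i) (β<q i)
        (subst (λ m → ∣ q * ν i - m ∣ < q) (μ≡ i) (ℕₚ.≤-<-trans (part≤size i offset) near′))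

      complete : ∀ i → β i + (q ∸ β i) ≡ q
      complete i = ℕₚ.m+[n∸m]≡n (ℕₚ.<⇒≤ (β<q i))

      conclude : ∀ {D E Δ} i → Answer q n (surplus i + (surplus (next i) + surplus (next (next i))))
        (offset i + (offset (next i) + offset (next (next i)))) D E Δ → Exps p μ D E × IsΔ p μ Δ
      conclude i (answer low gap high) =
        let _ , b = near-centre {μ} {ν} k maximal bal n (odd⇒1+2n {size ν} odd) near
        in exponents {μ} b (trans (cong (_+ q * n) (size-rotate i surplus)) low)
             (trans (cong (q ∸_) (size-rotate i offset)) gap) high

      ν-odd : ∀ i → ν i + (ν (next i) + ν (next (next i))) ≡ suc (2 * n)
      ν-odd i = trans (sym (size-rotate i ν)) (odd⇒1+2n {size ν} odd)

      near-at : ∀ i → offset i + (offset (next i) + offset (next (next i))) < q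
      near-at i = subst (_< q) (size-rotate i offset) near′

      module C i = Cases {q} {α i} {α (next i)} {α (next (next i))} {β i} {β (next i)} {β (next (next i))}
        {q ∸ β i} {q ∸ β (next i)} {q ∸ β (next (next i))} {n}
        (complete i) (complete (next i)) (complete (next (next i)))

      α-even : IsEven α → ∀ i → α i + (α (next i) + α (next (next i))) ≡ 2 * (size α / 2)
      α-even even i = trans (sym (size-rotate i α)) (even⇒2n {size α} even)

      α-odd : IsOdd α → ∀ i → α i + (α (next i) + α (next (next i))) ≡ suc (2 * (size α / 2))
      α-odd odd i = trans (sym (size-rotate i α)) (odd⇒1+2n {size α} odd)

      half-down : IsOdd α → size α / 2 ≡ (size α ∸ 1) / 2
      half-down odd = trans (sym (trans (cong (_/ 2) (ℕₚ.*-comm 2 m)) (Div.m*n/n≡m m 2)))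
        (cong (λ s → (s ∸ 1) / 2) (sym (odd⇒1+2n {size α} odd)))
        where m = size α / 2

      half-up : IsOdd α → suc (size α / 2) ≡ (size α + 1) / 2
      half-up odd = trans (sym (trans (cong (_/ 2) (ℕₚ.*-comm 2 (suc m))) (Div.m*n/n≡m (suc m) 2)))
        (cong (_/ 2) (trans (shuffle m) (cong (_+ 1) (sym (odd⇒1+2n {size α} odd)))))
        where
        m = size α / 2
        shuffle : ∀ m → 2 * suc m ≡ suc (2 * m) + 1
        shuffle = solve-∀

    case-c : IsEven α → ∀ i → size β < 2 * β i →
      Exps p μ ((size α / 2) * q + (β (next i) + β (next (next i)))) ((size α / 2) * q + β i)
        × IsΔ p μ (β i ∸ β (next i) ∸ β (next (next i)))
    case-c even i h = conclude i (C.even-one i {size α / 2} (α-even even i) (digits i) (digits (next i)) (digits (next (next i)))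
      (ν-odd i) (near-at i) (subst (_< 2 * β i) (size-rotate i β) h))

    case-d : IsEven α → 2 * q < size β →
      Exps p μ ((size α / 2) * q + q) ((size α / 2) * q + (size β ∸ q)) × IsΔ p μ (size β ∸ 2 * q)
    case-d even h rewrite size-rotate 0F β = conclude 0F (C.even-all 0F {size α / 2} (α-even even 0F)
      (digits 0F) (digits 1F) (digits 2F) (ν-odd 0F) (near-at 0F) h)

    case-e : IsOdd α → ∀ i → size (compl q β) < 2 * (q ∸ β i) →
      Exps p μ (((size α + 1) / 2) * q + β i) (((size α ∸ 1) / 2) * q + (β (next i) + β (next (next i))))
        × IsΔ p μ ((β (next i) + β (next (next i))) ∸ β i ∸ q)
    case-e odd i h rewrite sym (half-up odd) | sym (half-down odd) = conclude i (C.odd-one i {size α / 2} (α-odd odd i)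
      (digits i) (digits (next i)) (digits (next (next i))) (ν-odd i) (near-at i)
      (subst (_< 2 * (q ∸ β i)) (size-rotate i (compl q β)) h))

    case-f : IsOdd α → 2 * q < size (compl q β) →
      Exps p μ (((size α ∸ 1) / 2) * q + size β) (((size α + 1) / 2) * q) × IsΔ p μ (q ∸ size β)
    case-f odd h rewrite sym (half-up odd) | sym (half-down odd) | size-rotate 0F β =
      conclude 0F (C.odd-all 0F {size α / 2} (α-odd odd 0F)
        (digits 0F) (digits 1F) (digits 2F) (ν-odd 0F) (near-at 0F) (subst (2 * q <_) (size-rotate 0F (compl q β)) h))

open import Data.Nat using (ℕ; _+_; _*_; _∸_; _^_; _<_; _/_)
open import Data.Product using (_×_)
open import Data.Fin using (Fin)

theorem3p6 : (p : ℕ) → Prime p → (μ : Mult) → Balanced μ → (k : ℕ) → IsK p μ k →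
    ((k ≡ 0 → IsOdd μ →
    Exps p μ ((size μ ∸ 1) / 2) ((size μ + 1) / 2) × IsΔ p μ 1) ×
    (k ≡ 0 → IsEven μ →
    Exps p μ (size μ / 2) (size μ / 2) × IsΔ p μ 0)) ×
    (0 < k → (α β : Mult) → (∀ i → μ i ≡ p ^ k * α i + β i) → (∀ i → β i < p ^ k) →
    ((IsEven α → (i : Fin 3) → size β < 2 * β i →
    Exps p μ ((size α / 2) * p ^ k + (β (next i) + β (next (next i))))
    ((size α / 2) * p ^ k + β i)
    × IsΔ p μ (β i ∸ β (next i) ∸ β (next (next i)))) ×
    (IsEven α → 2 * p ^ k < size β →
    Exps p μ ((size α / 2) * p ^ k + p ^ k)
    ((size α / 2) * p ^ k + (size β ∸ p ^ k))
    × IsΔ p μ (size β ∸ 2 * p ^ k)) ×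
    (IsOdd α → (i : Fin 3) → size (compl (p ^ k) β) < 2 * (p ^ k ∸ β i) →
    Exps p μ (((size α + 1) / 2) * p ^ k + β i)
    (((size α ∸ 1) / 2) * p ^ k + (β (next i) + β (next (next i))))
    × IsΔ p μ ((β (next i) + β (next (next i))) ∸ β i ∸ p ^ k)) ×
    (IsOdd α → 2 * p ^ k < size (compl (p ^ k) β) →
    Exps p μ (((size α ∸ 1) / 2) * p ^ k + size β)
    (((size α + 1) / 2) * p ^ k)
    × IsΔ p μ (p ^ k ∸ size β))))
theorem3p6 p p-prime μ bal zero (_ , maximal) =
  ((λ _ → proj₁ at-zero) , (λ _ → proj₂ at-zero)) , λ ()
  where
  open Conclusion p p-prime
  at-zero = balanced-exponents {μ} bal λ m good → contradiction (maximal (suc m) (s≤s z≤n) good) λ ()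
theorem3p6 p p-prime μ bal (suc k) (inj₂ (_ , good) , maximal) =
  ((λ ()) , (λ ())) , λ _ α β μ≡ β<q →
    case-c {μ} k maximal′ good α β μ≡ β<q , case-d {μ} k maximal′ good α β μ≡ β<q ,
    case-e {μ} k maximal′ good α β μ≡ β<q , case-f {μ} k maximal′ good α β μ≡ β<q
  where
  open Conclusion.Positive p p-prime
  maximal′ : ∀ m → GoodLevel p μ (suc m) → suc m ℕ.≤ suc k
  maximal′ m = maximal (suc m) (s≤s z≤n)
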